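{- Define the following power series in $q$ (with $(a;q)_\infty=\prod_{j\ge0}(1-aq^j)$ and $(a_1,\dots,a_k;q)_\infty=(a_1;q)_\infty\cdots(a_k;q)_\infty$): \begin{align*} \sum_{n\ge1}\mathrm{spt}_{G1}(n)q^n&=\sum_{n=1}^\infty \frac{q^n (q^{4n+2};q^2)_\infty}{(q^{2n};q^2)_\infty^2\,(q^{2n+1},q^{2n+2};q^2)_\infty},\\ \sum_{n\ge1}\mathrm{spt}_{G2}(n)q^n&=\sum_{n=1}^\infty \frac{q^n (q^{2n+1};q)_\infty}{(q^{n};q)_\infty^2\,(-q^{2n+1};q^2)_\infty},\\ \sum_{n\ge1}\mathrm{spt}_{F1}(n)q^n&=\sum_{n=1}^\infty \frac{q^{n(n-1)/2} (q^{2n+1};q)_\infty}{(q^{n};q)_\infty^2\,(-q^{n+1};q)_\infty},\\ \sum_{n\ge1}\mathrm{spt}_{G3}(n)q^n&=\sum_{n=1}^\infty \frac{(-1)^nq^{n(n+1)/2} (q^{2n+1};q)_\infty}{(q^{n};q)_\infty^2\,(q^{n+1};q)_\infty},\\ \sum_{n\ge1}\mathrm{spt}_{L7}(n)q^n&=\sum_{n=1}^\infty \frac{q^{2n} (-q^{2n+1};q)_\infty}{(q^{2n};q^2)_\infty^2},\\ \sum_{n\ge1}\mathrm{spt}_{L9}(n)q^n&=\sum_{n=1}^\infty \frac{q^{n} (q^{2n+1};q^2)_\infty}{(q^{n};q)_\infty^2},\\ \sum_{n\ge1}\mathrm{spt}_{L12}(n)q^n&=\sum_{n=1}^\infty \frac{q^{2n}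 (-q^{2n+1},-q^{2n+3};q^2)_\infty}{(q^{2n};q^2)_\infty^2}. \end{align*} Then for all integers $n\ge0$: $\mathrm{spt}_{G1}(3n)\equiv0\pmod 3$, $\mathrm{spt}_{G2}(3n)\equiv0\pmod 3$, $\mathrm{spt}_{G2}(3n+2)\equiv0\pmod 3$, $\mathrm{spt}_{L7}(3n+1)\equiv0\pmod 3$, $\mathrm{spt}_{L9}(3n+2)\equiv0\pmod 3$, $\mathrm{spt}_{L12}(3n)\equiv0\pmod 3$, $\mathrm{spt}_{F1}(10n+9)\equiv0\pmod 5$, and $\mathrm{spt}_{G3}(5n+3)\equiv0\pmod 5$ (where coefficients of $q^0$ are taken to be $0$).
   Context: Standard $q$-Pochhammer notation: $(a;q)_n=\prod_{j=0}^{n-1}(1-aq^j)$, $(a;q)_\infty=\prod_{j=0}^{\infty}(1-aq^j)$, and $(a_1,\dots,a_k;q)_n=(a_1;q)_n\cdots(a_k;q)_n$. All series are formal power series in $q$ with integer coefficients. -}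

module Defs where

open import Data.Nat as ℕ using (ℕ; zero; suc; _≟_)
open import Data.Integer as ℤ using (ℤ; +_; -_)
open import Relation.Nullary using (yes; no)

-- Formal power series in q with integer coefficients: f n = coefficient of q^n.
PS : Set
PS = ℕ → ℤ

sumTo : ℕ → (ℕ → ℤ) → ℤ
sumTo zero    h = h 0
sumTo (suc n) h = sumTo n h ℤ.+ h (suc n)

infixl 6 _⊕_ _⊖_
infixl 7 _⊛_

_⊕_ : PS → PS → PS
(f ⊕ g) n = f n ℤ.+ g n

_⊖_ : PS → PS → PS
(f ⊖ g) n = f n ℤ.- g n

_⊛_ : PS → PS → PS
(f ⊛ g) n = sumTo n (λ k → f k ℤ.* g (n ℕ.∸ k))

mono : ℤ → ℕ → PS
mono c e n with e ≟ n
... | yes _ = c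
... | no  _ = + 0

one : PS
one = mono (+ 1) 0

finProd : ℕ → (ℕ → PS) → PS
finProd zero    F = one
finProd (suc k) F = finProd k F ⊛ F k

-- Infinite product ∏_{j≥0} F j, for factors with F j ≡ 1 (mod q^(j+1)):
-- the coefficient of q^m only depends on the factors F 0, …, F m.
infProd : (ℕ → PS) → PS
infProd F m = finProd (suc m) F m

-- 1/(1 - x q^e) = Σ_{k≥0} x^k q^(e k)   (for e ≥ 1; only the terms with
-- e k ≤ m contribute to the coefficient of q^m, and k ≤ m suffices)
geom : ℤ → ℕ → PS
geom x e m = sumTo m (λ k → mono (x ℤ.^ k) (e ℕ.* k) m)

-- (x q^a ; q^b)_∞ = ∏_{j≥0} (1 - x q^(a + b j))     (a, b ≥ 1)
poch : ℤ → ℕ → ℕ → PS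
poch x a b = infProd (λ j → one ⊖ mono x (a ℕ.+ b ℕ.* j))

-- 1 / (x q^a ; q^b)_∞ = ∏_{j≥0} 1/(1 - x q^(a + b j))  (a, b ≥ 1)
invPoch : ℤ → ℕ → ℕ → PS
invPoch x a b = infProd (λ j → geom x (a ℕ.+ b ℕ.* j))

-- Σ_{n≥1} T n, for terms T n of q-order ≥ n - 1
-- (coefficient of q^m only involves n = 1, …, m+1)
sumFrom1 : (ℕ → PS) → PS
sumFrom1 T m = sumTo m (λ i → T (suc i) m)

-1ℤ : ℤ
-1ℤ = - (+ 1)

genG1 : PS
genG1 = sumFrom1 λ n →
  mono (+ 1) n ⊛ poch (+ 1) (4 ℕ.* n ℕ.+ 2) 2
  ⊛ invPoch (+ 1) (2 ℕ.* n) 2 ⊛ invPoch (+ 1) (2 ℕ.* n) 2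
  ⊛ invPoch (+ 1) (2 ℕ.* n ℕ.+ 1) 2 ⊛ invPoch (+ 1) (2 ℕ.* n ℕ.+ 2) 2

genG2 : PS
genG2 = sumFrom1 λ n →
  mono (+ 1) n ⊛ poch (+ 1) (2 ℕ.* n ℕ.+ 1) 1
  ⊛ invPoch (+ 1) n 1 ⊛ invPoch (+ 1) n 1
  ⊛ invPoch -1ℤ (2 ℕ.* n ℕ.+ 1) 2

genF1 : PS
genF1 = sumFrom1 λ n →
  mono (+ 1) (n ℕ.* (n ℕ.∸ 1) ℕ./ 2) ⊛ poch (+ 1) (2 ℕ.* n ℕ.+ 1) 1
  ⊛ invPoch (+ 1) n 1 ⊛ invPoch (+ 1) n 1
  ⊛ invPoch -1ℤ (n ℕ.+ 1) 1

genG3 : PS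
genG3 = sumFrom1 λ n →
  mono (-1ℤ ℤ.^ n) (n ℕ.* (n ℕ.+ 1) ℕ./ 2) ⊛ poch (+ 1) (2 ℕ.* n ℕ.+ 1) 1
  ⊛ invPoch (+ 1) n 1 ⊛ invPoch (+ 1) n 1
  ⊛ invPoch (+ 1) (n ℕ.+ 1) 1

genL7 : PS
genL7 = sumFrom1 λ n →
  mono (+ 1) (2 ℕ.* n) ⊛ poch -1ℤ (2 ℕ.* n ℕ.+ 1) 1
  ⊛ invPoch (+ 1) (2 ℕ.* n) 2 ⊛ invPoch (+ 1) (2 ℕ.* n) 2

genL9 : PS
genL9 = sumFrom1 λ n →
  mono (+ 1) n ⊛ poch (+ 1) (2 ℕ.* n ℕ.+ 1) 2
  ⊛ invPoch (+ 1) n 1 ⊛ invPoch (+ 1) n 1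

genL12 : PS
genL12 = sumFrom1 λ n →
  mono (+ 1) (2 ℕ.* n) ⊛ poch -1ℤ (2 ℕ.* n ℕ.+ 1) 2 ⊛ poch -1ℤ (2 ℕ.* n ℕ.+ 3) 2
  ⊛ invPoch (+ 1) (2 ℕ.* n) 2 ⊛ invPoch (+ 1) (2 ℕ.* n) 2

coeff≥1 : PS → ℕ → ℤ
coeff≥1 f zero    = + 0
coeff≥1 f (suc n) = f (suc n)

sptG1 sptG2 sptF1 sptG3 sptL7 sptL9 sptL12 : ℕ → ℤ
sptG1  = coeff≥1 genG1
sptG2  = coeff≥1 genG2
sptF1  = coeff≥1 genF1
sptG3  = coeff≥1 genG3
sptL7  = coeff≥1 genL7
sptL9  = coeff≥1 genL9
sptL12 = coeff≥1 genL12

{-# OPTIONS --safe #-}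

-- In each summand the factor (b; b)²ₙ₋₁ / (b; b)₂ₙ, with b = q or b = q², splits off; it is the
-- β of a Bailey pair relative to b with αᵣ = (−1)ʳ⁺¹ (r(r+1)/2) b^(r(r−1)/2) (1 − b^(2r+1)).
-- Hence each generating function is an infinite product times Σ αᵣ Γᵣ, where
-- Γᵣ = Σ δₙ / ((b; b)ₙ₋ᵣ (b; b)ₙ₊ᵣ₊₁) and δₙ is the remaining factor.  Creative telescoping in r
-- evaluates Γᵣ, or shows that it is a partial theta function, up to an infinite product.
--
-- Modulo 3 the coefficient r(r+1)/2 leaves only r ≡ 1 (mod 3), and the infinite product becomes
-- 1/(b; b)³ ≡ 1/(b³; b³), times φ(−q) = Σ (−1)ʲ q^(j²) for G1; so the residues modulo 3 of the
-- exponents that occur can be read off.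
-- Modulo 5 the product is 1/(q; q)² ≡ (q; q)³ / (q⁵; q⁵), and Jacobi's identity restricts the
-- exponents of (q; q)³.  For F1 a multiple of φ(−q) / (q; q)² = 1/(q²; q²) is left over, an
-- even series.
--
-- Working modulo q^N, with q nilpotent, makes all sums and products finite.

module Submission where

open import Defs
open import Level using (Level; 0ℓ)
open import Algebra.Bundles using (CommutativeRing)
open import Algebra.Solver.Ring.AlmostCommutativeRing
  using (fromCommutativeRing; _-Raw-AlmostCommutative⟶_; Induced-equivalence)
open import Data.Nat.Base as ℕ using (ℕ; zero; suc; _%_; _/_)
import Data.Nat.Properties as ℕ
import Data.Nat.DivMod as ℕ
import Data.Nat.Divisibility as ℕ
import Data.Nat.Tactic.RingSolver as ℕ-solver
open import Data.Integer.Base as ℤ using (ℤ; +_; -[1+_])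
import Data.Integer.Properties as ℤ
import Data.Integer.Tactic.RingSolver as ℤ-solver
open import Data.Integer.Divisibility.Signed
  using (divides; ∣-refl; ∣⇒∣ᵤ; ∣ᵤ⇒∣; ∣m∣n⇒∣m+n; ∣m∣n⇒∣m-n; ∣m⇒∣-m; ∣m⇒∣m*n; ∣n⇒∣m*n)
  renaming (_∣_ to _∣ˢ_)
open import Data.List.Base using (List; []; _∷_; foldl; cartesianProductWith)
open import Data.List.Membership.Propositional using (_∈_)
open import Data.List.Membership.Propositional.Properties using (∈-cartesianProductWith⁺)
open import Data.List.Membership.DecPropositional ℕ._≟_ using (_∈?_)
open import Data.List.Relation.Binary.Pointwise.Base as List using ([]; _∷_)
open import Data.List.Relation.Unary.All as All using (All; all?)
open import Data.List.Relation.Unary.Any using (here; there)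
open import Data.Maybe.Base using (just; nothing)
open import Data.Product.Base using (_×_; _,_; proj₁; proj₂)
open import Data.Sum.Base using (_⊎_; inj₁; inj₂)
open import Data.Vec.Base using (Vec; []; _∷_; lookup; map; allFin)
open import Data.Vec.N-ary using (N-ary; _$ⁿ_)
open import Data.Vec.Properties using (lookup-map)
open import Data.Vec.Relation.Binary.Pointwise.Inductive as Vec using ([]; _∷_)
open import Relation.Binary.Definitions using (WeaklyDecidable)
open import Relation.Nullary using (Dec; yes; no; contradiction)
open import Relation.Nullary.Decidable using (True; False; toWitness; toWitnessFalse)
import Relation.Binary.PropositionalEquality as ≡
open ≡ using (_≡_; _≢_; module ≡-Reasoning)

-- A ring solver with integer coefficients

-- Since q and b are nilpotent, nothing may be divided by them. Reciprocals of (b; b)ₖ are therefore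
-- carried as `I`, which is zero at a negative index: supports become finite by themselves, and
-- every recurrence or certificate is a polynomial identity in a few atoms. The Bailey pair comes
-- from the coefficients `g` of (z; b)ₙ₊₁ (b/z; b)ₙ. Each term of it is a difference
-- `g n k - g n (k + 2)`, and the weights r(r+1)/2 are the ones for which summation by parts yields
-- the weights 2k+1 of Jacobi's identity. The delicate family is F1. Its sum contains exponents r²
-- with weight r², and those with r² ≡ 4 (mod 5) fall into the degrees to be excluded. Doubling the
-- sum and splitting off Gauss's series changes these weights to 2r² + 2, which vanish modulo 5
-- exactly when r² ≡ 4. The series split off is the even one, whence the modulus 10.

module IntegerCoefficients {c ℓ : Level} (R : CommutativeRing c ℓ) where
  open CommutativeRing R
  open import Algebra.Properties.Ring ring
  open import Algebra.Properties.AbelianGroup +-abelianGroup using (⁻¹-∙-comm)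
  open import Algebra.Properties.Semiring.Mult.TCOptimised semiring using (1+×; ×-homo-+; ×1-homo-*) renaming (_×_ to _·_)
  open import Relation.Binary.Reasoning.Setoid setoid

  -- The optimised multiple gives `1#` for n = 1 by computation; hence `0-homo` and `1-homo` below
  -- are `refl`, and `con (+ 1)` in the solver denotes `1#` itself.
  fromℕ : ℕ → Carrier
  fromℕ n = n · 1#

  fromℤ : ℤ → Carrier
  fromℤ (+ n)      = fromℕ n
  fromℤ (-[1+ n ]) = - fromℕ (suc n)

  fromℤ-⊖ : ∀ m n → fromℤ (m ℤ.⊖ n) ≈ fromℕ m - fromℕ n
  fromℤ-⊖ m       zero    = begin
    fromℕ m       ≈⟨ +-identityʳ _ ⟨
    fromℕ m + 0#  ≈⟨ +-congˡ -0#≈0# ⟨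
    fromℕ m - 0#  ∎
  fromℤ-⊖ zero    (suc n) = sym (+-identityˡ _)
  fromℤ-⊖ (suc m) (suc n) = begin
    fromℤ (suc m ℤ.⊖ suc n)                 ≡⟨ ≡.cong fromℤ (ℤ.[1+m]⊖[1+n]≡m⊖n m n) ⟩
    fromℤ (m ℤ.⊖ n)                         ≈⟨ fromℤ-⊖ m n ⟩
    fromℕ m - fromℕ n                       ≈⟨ +-congʳ (+-identityˡ _) ⟨
    (0# + fromℕ m) - fromℕ n                ≈⟨ +-congʳ (+-congʳ (-‿inverseˡ 1#)) ⟨
    ((- 1# + 1#) + fromℕ m) - fromℕ n       ≈⟨ +-congʳ (+-assoc _ _ _) ⟩
    (- 1# + (1# + fromℕ m)) - fromℕ n       ≈⟨ +-congʳ (+-comm _ _) ⟩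
    ((1# + fromℕ m) - 1#) - fromℕ n         ≈⟨ +-assoc _ _ _ ⟩
    (1# + fromℕ m) + (- 1# - fromℕ n)       ≈⟨ +-congˡ (⁻¹-∙-comm 1# (fromℕ n)) ⟩
    (1# + fromℕ m) - (1# + fromℕ n)         ≈⟨ +-cong (1+× m 1#) (-‿cong (1+× n 1#)) ⟨
    fromℕ (suc m) - fromℕ (suc n)           ∎

  fromℤ-+ : ∀ i j → fromℤ (i ℤ.+ j) ≈ fromℤ i + fromℤ j
  fromℤ-+ (+ m)      (+ n)      = ×-homo-+ 1# m n
  fromℤ-+ (+ m)      (-[1+ n ]) = fromℤ-⊖ m (suc n)
  fromℤ-+ (-[1+ m ]) (+ n)      = trans (fromℤ-⊖ n (suc m)) (+-comm _ _)
  fromℤ-+ (-[1+ m ]) (-[1+ n ]) = begin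
    - fromℕ (suc (suc (m ℕ.+ n)))      ≡⟨ ≡.cong (λ k → - fromℕ (suc k)) (ℕ.+-suc m n) ⟨
    - fromℕ (suc m ℕ.+ suc n)          ≈⟨ -‿cong (×-homo-+ 1# (suc m) (suc n)) ⟩
    - (fromℕ (suc m) + fromℕ (suc n))  ≈⟨ ⁻¹-∙-comm _ _ ⟨
    - fromℕ (suc m) - fromℕ (suc n)    ∎

  fromℤ-neg : ∀ i → fromℤ (ℤ.- i) ≈ - fromℤ i
  fromℤ-neg (+ zero)    = sym -0#≈0#
  fromℤ-neg (+ (suc n)) = refl
  fromℤ-neg (-[1+ n ])  = sym (-‿involutive _)

  fromℤ-* : ∀ i j → fromℤ (i ℤ.* j) ≈ fromℤ i * fromℤ j
  fromℤ-* (+ m)      (+ n)      = begin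
    fromℤ (+ m ℤ.* + n)  ≡⟨ ≡.cong fromℤ (ℤ.pos-* m n) ⟨
    fromℕ (m ℕ.* n)      ≈⟨ ×1-homo-* m n ⟩
    fromℕ m * fromℕ n    ∎
  fromℤ-* (+ m)      (-[1+ n ]) = begin
    fromℤ (+ m ℤ.* -[1+ n ])         ≡⟨ ≡.cong fromℤ (ℤ.neg-distribʳ-* (+ m) (+ suc n)) ⟨
    fromℤ (ℤ.- (+ m ℤ.* + suc n))    ≈⟨ fromℤ-neg (+ m ℤ.* + suc n) ⟩
    - fromℤ (+ m ℤ.* + suc n)        ≡⟨ ≡.cong (λ k → - fromℤ k) (ℤ.pos-* m (suc n)) ⟨
    - fromℕ (m ℕ.* suc n)            ≈⟨ -‿cong (×1-homo-* m (suc n)) ⟩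
    - (fromℕ m * fromℕ (suc n))      ≈⟨ -‿distribʳ-* _ _ ⟩
    fromℕ m * - fromℕ (suc n)        ∎
  fromℤ-* (-[1+ m ]) (+ n)      = begin
    fromℤ (-[1+ m ] ℤ.* + n)         ≡⟨ ≡.cong fromℤ (ℤ.neg-distribˡ-* (+ suc m) (+ n)) ⟨
    fromℤ (ℤ.- (+ suc m ℤ.* + n))    ≈⟨ fromℤ-neg (+ suc m ℤ.* + n) ⟩
    - fromℤ (+ suc m ℤ.* + n)        ≡⟨ ≡.cong (λ k → - fromℤ k) (ℤ.pos-* (suc m) n) ⟨
    - fromℕ (suc m ℕ.* n)            ≈⟨ -‿cong (×1-homo-* (suc m) n) ⟩
    - (fromℕ (suc m) * fromℕ n)      ≈⟨ -‿distribˡ-* _ _ ⟩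
    - fromℕ (suc m) * fromℕ n        ∎
  fromℤ-* (-[1+ m ]) (-[1+ n ]) = begin
    fromℕ (suc m ℕ.* suc n)            ≈⟨ ×1-homo-* (suc m) (suc n) ⟩
    fromℕ (suc m) * fromℕ (suc n)      ≈⟨ -‿involutive _ ⟨
    - (- (fromℕ (suc m) * fromℕ (suc n)))  ≈⟨ -‿cong (-‿distribʳ-* _ _) ⟩
    - (fromℕ (suc m) * - fromℕ (suc n))    ≈⟨ -‿distribˡ-* _ _ ⟩
    - fromℕ (suc m) * - fromℕ (suc n)  ∎

  private
    acr = fromCommutativeRing R

    morphism : ℤ.+-*-rawRing -Raw-AlmostCommutative⟶ acr
    morphism = record
      { ⟦_⟧ = fromℤ ; +-homo = fromℤ-+ ; *-homo = fromℤ-*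
      ; -‿homo = fromℤ-neg ; 0-homo = refl ; 1-homo = refl }

    -- Equality in an arbitrary ring cannot be tested. Coefficients in ℤ can be compared, and this
    -- is what lets the solver cancel terms.
    coeff≟ : WeaklyDecidable (Induced-equivalence morphism)
    coeff≟ i j with i ℤ.≟ j
    ... | yes i≡j = just (reflexive (≡.cong fromℤ i≡j))
    ... | no  _   = nothing

  open import Algebra.Solver.Ring ℤ.+-*-rawRing acr morphism coeff≟ public
    using (Polynomial; con; var; _:+_; _:*_; _:-_; :-_; _:^_; _:=_; ⟦_⟧; ⟦_⟧↓; solve; prove; op; [+]; [*])
  open import Algebra.Properties.Semiring.Exp semiring using (_^_; ^-congˡ)

  ⟦⟧-cong : ∀ {n} (p : Polynomial n) {ρ σ : Vec Carrier n} →
            Vec.Pointwise _≈_ ρ σ → ⟦ p ⟧ ρ ≈ ⟦ p ⟧ σ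
  ⟦⟧-cong (op [+] p r) e = +-cong (⟦⟧-cong p e) (⟦⟧-cong r e)
  ⟦⟧-cong (op [*] p r) e = *-cong (⟦⟧-cong p e) (⟦⟧-cong r e)
  ⟦⟧-cong (con c)      e = refl
  ⟦⟧-cong (var x)      e = Vec.lookup e x
  ⟦⟧-cong (p :^ n)     e = ^-congˡ n (⟦⟧-cong p e)
  ⟦⟧-cong (:- p)       e = -‿cong (⟦⟧-cong p e)

  substitute : ∀ {k n} → Polynomial n → Vec (Polynomial k) n → Polynomial k
  substitute (op o p r) es = op o (substitute p es) (substitute r es)
  substitute (con c)    es = con c
  substitute (var x)    es = lookup es x
  substitute (p :^ n)   es = substitute p es :^ n
  substitute (:- p)     es = :- substitute p es

  substitute-correct : ∀ {k n} (p : Polynomial n) (es : Vec (Polynomial k) n) (σ : Vec Carrier k) →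
                       ⟦ substitute p es ⟧ σ ≡.≡ ⟦ p ⟧ (map (λ e → ⟦ e ⟧ σ) es)
  substitute-correct (op [+] p r) es σ = ≡.cong₂ _+_ (substitute-correct p es σ) (substitute-correct r es σ)
  substitute-correct (op [*] p r) es σ = ≡.cong₂ _*_ (substitute-correct p es σ) (substitute-correct r es σ)
  substitute-correct (con c)      es σ = ≡.refl
  substitute-correct (var x)      es σ = ≡.sym (lookup-map x (λ e → ⟦ e ⟧ σ) es)
  substitute-correct (p :^ n)     es σ = ≡.cong (λ a → a ^ n) (substitute-correct p es σ)
  substitute-correct (:- p)       es σ = ≡.cong -_ (substitute-correct p es σ)

  -- A conditional ring solver: the atoms ρ are first replaced by polynomials in σ.
  solveBy : ∀ k n (σ : Vec Carrier k) (es : N-ary k (Polynomial k) (Vec (Polynomial k) n)) {ρ : Vec Carrier n} →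
            let es′ = es $ⁿ map var (allFin k) in
            Vec.Pointwise _≈_ ρ (map (λ e → ⟦ e ⟧ σ) es′) →
            (f : N-ary n (Polynomial n) (Polynomial n × Polynomial n)) →
            let p = f $ⁿ map var (allFin n) in
            ⟦ substitute (proj₁ p) es′ ⟧↓ σ ≈ ⟦ substitute (proj₂ p) es′ ⟧↓ σ →
            ⟦ proj₁ p ⟧ ρ ≈ ⟦ proj₂ p ⟧ ρ
  solveBy k n σ es {ρ} e f hyp = begin
    ⟦ p ⟧ ρ                             ≈⟨ ⟦⟧-cong p e ⟩
    ⟦ p ⟧ (map (λ e → ⟦ e ⟧ σ) es′)     ≡⟨ substitute-correct p es′ σ ⟨
    ⟦ substitute p es′ ⟧ σ              ≈⟨ prove σ (substitute p es′) (substitute r es′) hyp ⟩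
    ⟦ substitute r es′ ⟧ σ              ≡⟨ substitute-correct r es′ σ ⟩
    ⟦ r ⟧ (map (λ e → ⟦ e ⟧ σ) es′)     ≈⟨ ⟦⟧-cong r e ⟨
    ⟦ r ⟧ ρ                             ∎
    where
    es′ = es $ⁿ map var (allFin k)
    p = proj₁ (f $ⁿ map var (allFin n))
    r = proj₂ (f $ⁿ map var (allFin n))

-- Finite sums and q-products

module FiniteSums {c ℓ : Level} (R : CommutativeRing c ℓ) where
  open CommutativeRing R
  open IntegerCoefficients R
  open import Relation.Binary.Reasoning.Setoid setoid

  ∑ : ℕ → (ℕ → Carrier) → Carrier
  ∑ zero    f = 0#
  ∑ (suc n) f = ∑ n f + f n

  ∑-cong< : ∀ n {f g : ℕ → Carrier} → (∀ k → k ℕ.< n → f k ≈ g k) → ∑ n f ≈ ∑ n g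
  ∑-cong< zero    e = refl
  ∑-cong< (suc n) e = +-cong (∑-cong< n (λ k k<n → e k (ℕ.m<n⇒m<1+n k<n))) (e n ℕ.≤-refl)

  ∑-cong : ∀ n {f g : ℕ → Carrier} → (∀ k → f k ≈ g k) → ∑ n f ≈ ∑ n g
  ∑-cong n e = ∑-cong< n (λ k _ → e k)

  ∑-+ : ∀ n (f g : ℕ → Carrier) → ∑ n (λ k → f k + g k) ≈ ∑ n f + ∑ n g
  ∑-+ zero    f g = sym (+-identityˡ 0#)
  ∑-+ (suc n) f g = trans (+-congʳ (∑-+ n f g))
    (solve 4 (λ a b c d → (a :+ b) :+ (c :+ d) := (a :+ c) :+ (b :+ d)) refl (∑ n f) (∑ n g) (f n) (g n))

  ∑-*ˡ : ∀ n c (f : ℕ → Carrier) → ∑ n (λ k → c * f k) ≈ c * ∑ n f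
  ∑-*ˡ zero    c f = sym (zeroʳ c)
  ∑-*ˡ (suc n) c f = trans (+-congʳ (∑-*ˡ n c f)) (sym (distribˡ c _ _))

  ∑-0 : ∀ n {f : ℕ → Carrier} → (∀ k → f k ≈ 0#) → ∑ n f ≈ 0#
  ∑-0 zero    e = refl
  ∑-0 (suc n) e = trans (+-cong (∑-0 n e) (e n)) (+-identityˡ 0#)

  ∑-split : ∀ m n (f : ℕ → Carrier) → ∑ (m ℕ.+ n) f ≈ ∑ m f + ∑ n (λ k → f (m ℕ.+ k))
  ∑-split m zero    f = trans (reflexive (≡.cong (λ j → ∑ j f) (ℕ.+-identityʳ m))) (sym (+-identityʳ _))
  ∑-split m (suc n) f = begin
    ∑ (m ℕ.+ suc n) f                                       ≡⟨ ≡.cong (λ j → ∑ j f) (ℕ.+-suc m n) ⟩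
    ∑ (m ℕ.+ n) f + f (m ℕ.+ n)                             ≈⟨ +-congʳ (∑-split m n f) ⟩
    (∑ m f + ∑ n (λ k → f (m ℕ.+ k))) + f (m ℕ.+ n)         ≈⟨ +-assoc _ _ _ ⟩
    ∑ m f + (∑ n (λ k → f (m ℕ.+ k)) + f (m ℕ.+ n))         ∎

  ∑-shift : ∀ n (f : ℕ → Carrier) → ∑ (suc n) f ≈ f 0 + ∑ n (λ k → f (suc k))
  ∑-shift n f = trans (∑-split 1 n f) (+-congʳ (+-identityˡ (f 0)))

  ∑-vanish : ∀ m n {f : ℕ → Carrier} → m ℕ.≤ n → (∀ k → m ℕ.≤ k → f k ≈ 0#) → ∑ n f ≈ ∑ m f
  ∑-vanish m n {f} m≤n e = begin
    ∑ n f                                             ≡⟨ ≡.cong (λ j → ∑ j f) (ℕ.m+[n∸m]≡n m≤n) ⟨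
    ∑ (m ℕ.+ (n ℕ.∸ m)) f                             ≈⟨ ∑-split m (n ℕ.∸ m) f ⟩
    ∑ m f + ∑ (n ℕ.∸ m) (λ k → f (m ℕ.+ k))           ≈⟨ +-congˡ (∑-0 (n ℕ.∸ m) (λ k → e _ (ℕ.m≤m+n m k))) ⟩
    ∑ m f + 0#                                        ≈⟨ +-identityʳ _ ⟩
    ∑ m f                                             ∎

  -- Both sides run over the pairs (k, m) with k + m < n, by antidiagonals on the left and by rows
  -- on the right.
  ∑-triangle : ∀ n (g : ℕ → ℕ → Carrier) →
               ∑ n (λ j → ∑ (suc j) (λ k → g k (j ℕ.∸ k))) ≈ ∑ n (λ k → ∑ (n ℕ.∸ k) (g k))
  ∑-triangle zero    g = refl
  ∑-triangle (suc n) g = begin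
    ∑ n (λ j → ∑ (suc j) (λ k → g k (j ℕ.∸ k))) + (∑ n (λ k → g k (n ℕ.∸ k)) + g n (n ℕ.∸ n))
      ≈⟨ +-congʳ (∑-triangle n g) ⟩
    ∑ n (λ k → ∑ (n ℕ.∸ k) (g k)) + (∑ n (λ k → g k (n ℕ.∸ k)) + g n (n ℕ.∸ n))
      ≈⟨ +-assoc _ _ _ ⟨
    (∑ n (λ k → ∑ (n ℕ.∸ k) (g k)) + ∑ n (λ k → g k (n ℕ.∸ k))) + g n (n ℕ.∸ n)
      ≈⟨ +-cong (sym (∑-+ n _ _)) (sym (last n)) ⟩
    ∑ n (λ k → ∑ (suc (n ℕ.∸ k)) (g k)) + ∑ (suc n ℕ.∸ n) (g n)
      ≈⟨ +-congʳ (∑-cong< n (λ k k<n → reflexive (≡.cong (λ j → ∑ j (g k)) (≡.sym (ℕ.+-∸-assoc 1 (ℕ.<⇒≤ k<n)))))) ⟩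
    ∑ (suc n) (λ k → ∑ (suc n ℕ.∸ k) (g k)) ∎
    where
    last : ∀ n → ∑ (suc n ℕ.∸ n) (g n) ≈ g n (n ℕ.∸ n)
    last n = begin
      ∑ (suc n ℕ.∸ n) (g n)  ≡⟨ ≡.cong (λ j → ∑ j (g n)) (ℕ.m+n∸n≡m 1 n) ⟩
      0# + g n 0             ≈⟨ +-identityˡ _ ⟩
      g n 0                  ≡⟨ ≡.cong (g n) (ℕ.n∸n≡0 n) ⟨
      g n (n ℕ.∸ n)          ∎

  -- The terms of `a` run one step ahead of those of `b`, so the initial value of the certificate
  -- `g` has to absorb `a 0`.
  ∑-telescope : ∀ {a b g : ℕ → Carrier} → a 0 ≈ g 0 → (∀ m → a (suc m) + g m ≈ b m + g (suc m)) →
                ∀ n → ∑ (suc n) a ≈ ∑ n b + g n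
  ∑-telescope         base step zero    = +-congˡ base
  ∑-telescope {a} {b} {g} base step (suc n) = begin
    ∑ (suc n) a + a (suc n)          ≈⟨ +-congʳ (∑-telescope base step n) ⟩
    (∑ n b + g n) + a (suc n)        ≈⟨ solve 3 (λ s u v → (s :+ u) :+ v := s :+ (v :+ u)) refl _ _ _ ⟩
    ∑ n b + (a (suc n) + g n)        ≈⟨ +-congˡ (step n) ⟩
    ∑ n b + (b n + g (suc n))        ≈⟨ +-assoc _ _ _ ⟨
    ∑ (suc n) b + g (suc n)          ∎

module Nilpotent {c ℓ : Level} (R : CommutativeRing c ℓ) (N : ℕ) where
  open CommutativeRing R
  open IntegerCoefficients R
  open FiniteSums R
  open import Algebra.Properties.Ring ring using (-0#≈0#)
  open import Algebra.Properties.CommutativeSemiring.Exp commutativeSemiring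
  open import Relation.Binary.Reasoning.Setoid setoid

  Nilp : Carrier → Set ℓ
  Nilp x = x ^ N ≈ 0#

  nilp-≈ : ∀ {x y} → x ≈ y → Nilp x → Nilp y
  nilp-≈ e n = trans (^-congˡ N (sym e)) n

  nilp-*ˡ : ∀ {x} y → Nilp x → Nilp (x * y)
  nilp-*ˡ {x} y n = trans (^-distrib-* x y N) (trans (*-congʳ n) (zeroˡ _))

  nilp-*ʳ : ∀ {x} y → Nilp x → Nilp (y * x)
  nilp-*ʳ y n = nilp-≈ (*-comm _ _) (nilp-*ˡ y n)

  nilp-^ : ∀ {x} k → Nilp x → Nilp (x ^ suc k)
  nilp-^ k n = nilp-*ˡ _ n

  nilp-≥ : ∀ {x} k → N ℕ.≤ k → Nilp x → x ^ k ≈ 0#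
  nilp-≥ {x} k N≤k n = begin
    x ^ k                      ≡⟨ ≡.cong (x ^_) (ℕ.m+[n∸m]≡n N≤k) ⟨
    x ^ (N ℕ.+ (k ℕ.∸ N))      ≈⟨ ^-homo-* x N (k ℕ.∸ N) ⟩
    x ^ N * x ^ (k ℕ.∸ N)      ≈⟨ *-congʳ n ⟩
    0# * x ^ (k ℕ.∸ N)         ≈⟨ zeroˡ _ ⟩
    0#                         ∎

  0^ : ∀ k → 0# ^ suc k ≈ 0#
  0^ k = zeroˡ _

  geo : Carrier → Carrier
  geo x = ∑ N (x ^_)

  geo-cong : ∀ {x y} → x ≈ y → geo x ≈ geo y
  geo-cong e = ∑-cong N (λ k → ^-congˡ k e)

  geo-partial : ∀ x n → (1# - x) * ∑ n (x ^_) ≈ 1# - x ^ n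
  geo-partial x zero    = trans (zeroʳ _) (sym (-‿inverseʳ 1#))
  geo-partial x (suc n) = begin
    (1# - x) * (∑ n (x ^_) + x ^ n)             ≈⟨ distribˡ _ _ _ ⟩
    (1# - x) * ∑ n (x ^_) + (1# - x) * x ^ n    ≈⟨ +-congʳ (geo-partial x n) ⟩
    (1# - x ^ n) + (1# - x) * x ^ n             ≈⟨ solve 2 (λ x y → (con (+ 1) :- y) :+ (con (+ 1) :- x) :* y := con (+ 1) :- x :* y) refl x (x ^ n) ⟩
    1# - x * x ^ n                              ∎

  1-0≈1 : 1# - 0# ≈ 1#
  1-0≈1 = trans (+-congˡ -0#≈0#) (+-identityʳ 1#)

  geo-inverse : ∀ {x} → Nilp x → (1# - x) * geo x ≈ 1#
  geo-inverse {x} n = begin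
    (1# - x) * geo x  ≈⟨ geo-partial x N ⟩
    1# - x ^ N        ≈⟨ +-congˡ (-‿cong n) ⟩
    1# - 0#           ≈⟨ 1-0≈1 ⟩
    1#                ∎

  inverse-unique : ∀ {a b c} → a * b ≈ 1# → a * c ≈ 1# → b ≈ c
  inverse-unique {a} {b} {c} ab ac = begin
    b            ≈⟨ *-identityʳ b ⟨
    b * 1#       ≈⟨ *-congˡ ac ⟨
    b * (a * c)  ≈⟨ solve 3 (λ a b c → b :* (a :* c) := (a :* b) :* c) refl a b c ⟩
    (a * b) * c  ≈⟨ *-congʳ ab ⟩
    1# * c       ≈⟨ *-identityˡ c ⟩
    c            ∎

  cancelˡ : ∀ {a a′ x y} → a * a′ ≈ 1# → a * x ≈ a * y → x ≈ y
  cancelˡ {a} {a′} {x} {y} aa′ e = begin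
    x              ≈⟨ undo x ⟩
    a′ * (a * x)   ≈⟨ *-congˡ e ⟩
    a′ * (a * y)   ≈⟨ undo y ⟨
    y              ∎
    where
    undo : ∀ z → z ≈ a′ * (a * z)
    undo z = begin
      z             ≈⟨ *-identityˡ z ⟨
      1# * z        ≈⟨ *-congʳ aa′ ⟨
      (a * a′) * z  ≈⟨ solve 3 (λ a b z → (a :* b) :* z := b :* (a :* z)) refl a a′ z ⟩
      a′ * (a * z)  ∎

  -- For N = 0 the sum `geo` is empty, and `Nilp 0#` then says that the ring is trivial.
  geo-0 : Nilp 0# → geo 0# ≈ 1#
  geo-0 n = trans (sym (*-identityˡ _)) (trans (*-congʳ (sym 1-0≈1)) (geo-inverse n))

  ∏ : ℕ → (ℕ → Carrier) → Carrier
  ∏ zero    f = 1#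
  ∏ (suc k) f = ∏ k f * f k

  ∏-cong : ∀ k {f g : ℕ → Carrier} → (∀ j → f j ≈ g j) → ∏ k f ≈ ∏ k g
  ∏-cong zero    e = refl
  ∏-cong (suc k) e = *-cong (∏-cong k e) (e k)

  ∏-* : ∀ k (f g : ℕ → Carrier) → ∏ k (λ j → f j * g j) ≈ ∏ k f * ∏ k g
  ∏-* zero    f g = sym (*-identityˡ 1#)
  ∏-* (suc k) f g = trans (*-congʳ (∏-* k f g))
    (solve 4 (λ a b c d → (a :* b) :* (c :* d) := (a :* c) :* (b :* d)) refl _ _ _ _)

  ∏-1 : ∀ k {f : ℕ → Carrier} → (∀ j → f j ≈ 1#) → ∏ k f ≈ 1#
  ∏-1 zero    e = refl
  ∏-1 (suc k) e = trans (*-cong (∏-1 k e) (e k)) (*-identityˡ 1#)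

  ∏-split : ∀ m n (f : ℕ → Carrier) → ∏ (m ℕ.+ n) f ≈ ∏ m f * ∏ n (λ k → f (m ℕ.+ k))
  ∏-split m zero    f = trans (reflexive (≡.cong (λ j → ∏ j f) (ℕ.+-identityʳ m))) (sym (*-identityʳ _))
  ∏-split m (suc n) f = begin
    ∏ (m ℕ.+ suc n) f                                       ≡⟨ ≡.cong (λ j → ∏ j f) (ℕ.+-suc m n) ⟩
    ∏ (m ℕ.+ n) f * f (m ℕ.+ n)                             ≈⟨ *-congʳ (∏-split m n f) ⟩
    (∏ m f * ∏ n (λ k → f (m ℕ.+ k))) * f (m ℕ.+ n)         ≈⟨ *-assoc _ _ _ ⟩
    ∏ m f * (∏ n (λ k → f (m ℕ.+ k)) * f (m ℕ.+ n))         ∎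

  ∏-pairs : ∀ n (f : ℕ → Carrier) →
            ∏ (n ℕ.+ n) f ≈ ∏ n (λ j → f (j ℕ.+ j)) * ∏ n (λ j → f (suc (j ℕ.+ j)))
  ∏-pairs zero    f = sym (*-identityˡ 1#)
  ∏-pairs (suc n) f = begin
    ∏ (n ℕ.+ suc n) f * f (n ℕ.+ suc n)                 ≡⟨ ≡.cong (λ j → ∏ j f * f j) (ℕ.+-suc n n) ⟩
    ∏ (n ℕ.+ n) f * f (n ℕ.+ n) * f (suc (n ℕ.+ n))     ≈⟨ *-congʳ (*-congʳ (∏-pairs n f)) ⟩
    _ * _ * f (n ℕ.+ n) * f (suc (n ℕ.+ n))             ≈⟨ solve 4 (λ a b c d → a :* b :* c :* d := (a :* c) :* (b :* d)) refl _ _ _ _ ⟩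
    (_ * f (n ℕ.+ n)) * (_ * f (suc (n ℕ.+ n)))         ∎

  -- (a; b)ₖ and its inverse
  P V : Carrier → Carrier → ℕ → Carrier
  P a b k = ∏ k (λ j → 1# - a * b ^ j)
  V a b k = ∏ k (λ j → geo (a * b ^ j))

  1--cong : ∀ {x y} → x ≈ y → 1# - x ≈ 1# - y
  1--cong e = +-congˡ (-‿cong e)

  P-cong : ∀ {a a′ b b′} k → a ≈ a′ → b ≈ b′ → P a b k ≈ P a′ b′ k
  P-cong k ea eb = ∏-cong k (λ j → 1--cong (*-cong ea (^-congˡ j eb)))

  V-cong : ∀ {a a′ b b′} k → a ≈ a′ → b ≈ b′ → V a b k ≈ V a′ b′ k
  V-cong k ea eb = ∏-cong k (λ j → geo-cong (*-cong ea (^-congˡ j eb)))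

  PV : ∀ {a} b k → Nilp a → P a b k * V a b k ≈ 1#
  PV b k n = trans (sym (∏-* k _ _)) (∏-1 k (λ j → geo-inverse (nilp-*ˡ _ n)))

  -- A general factor φ lets the finite products and their inverses share one set of proofs: φ x is
  -- `1# - x` for `P` and `geo x` for `V`.
  module Splitting (φ : Carrier → Carrier) (φ-cong : ∀ {x y} → x ≈ y → φ x ≈ φ y) where
    Φ : Carrier → Carrier → ℕ → Carrier
    Φ a b k = ∏ k (λ j → φ (a * b ^ j))

    Φ-split : ∀ a b m n → Φ a b (m ℕ.+ n) ≈ Φ a b m * Φ (a * b ^ m) b n
    Φ-split a b m n = trans (∏-split m n _) (*-congˡ (∏-cong n (λ j → φ-cong (begin
      a * b ^ (m ℕ.+ j)      ≈⟨ *-congˡ (^-homo-* b m j) ⟩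
      a * (b ^ m * b ^ j)    ≈⟨ *-assoc _ _ _ ⟨
      a * b ^ m * b ^ j      ∎))))

    Φ-pairs : ∀ a b n → Φ a b (n ℕ.+ n) ≈ Φ a (b * b) n * Φ (a * b) (b * b) n
    Φ-pairs a b n = trans (∏-pairs n _) (*-cong (∏-cong n (λ j → φ-cong (*-congˡ (double j))))
      (∏-cong n (λ j → φ-cong (trans (sym (*-assoc _ _ _)) (*-congˡ (double j))))))
      where
      double : ∀ j → b ^ (j ℕ.+ j) ≈ (b * b) ^ j
      double j = trans (^-homo-* b j j) (sym (^-distrib-* b b j))

    module _ (φ0 : φ 0# ≈ 1#) where
      -- From j = N on `b ^ j` is zero and the factor is φ 0 = 1. A product of N factors thus plays
      -- the part of the infinite product.
      Φ-stable : ∀ {a b} → Nilp b → ∀ k → N ℕ.≤ k → Φ a b k ≈ Φ a b N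
      Φ-stable {a} {b} n k N≤k = begin
        Φ a b k                                  ≡⟨ ≡.cong (Φ a b) (ℕ.m+[n∸m]≡n N≤k) ⟨
        Φ a b (N ℕ.+ (k ℕ.∸ N))                  ≈⟨ ∏-split N (k ℕ.∸ N) _ ⟩
        Φ a b N * ∏ (k ℕ.∸ N) _                  ≈⟨ *-congˡ (∏-1 (k ℕ.∸ N) (λ j → trans (φ-cong (trans (*-congˡ (nilp-≥ (N ℕ.+ j) (ℕ.m≤m+n N j) n)) (zeroʳ a))) φ0)) ⟩
        Φ a b N * 1#                             ≈⟨ *-identityʳ _ ⟩
        Φ a b N                                  ∎

      Φ-tail : ∀ {a b} → Nilp b → ∀ n → Φ a b n * Φ (a * b ^ n) b N ≈ Φ a b N
      Φ-tail {a} {b} nb n = trans (sym (Φ-split a b n N)) (Φ-stable nb (n ℕ.+ N) (ℕ.m≤n+m N n))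

  module SP = Splitting (λ x → 1# - x) 1--cong
  module SV = Splitting geo geo-cong
  open SP public using () renaming (Φ-pairs to P-pairs)
  open SV public using () renaming (Φ-pairs to V-pairs)

  P-stable : ∀ {a b} → Nilp b → ∀ k → N ℕ.≤ k → P a b k ≈ P a b N
  P-stable = SP.Φ-stable 1-0≈1

  P-tail : ∀ {a b} → Nilp b → ∀ n → P a b n * P (a * b ^ n) b N ≈ P a b N
  P-tail = SP.Φ-tail 1-0≈1

  nilp-0 : ∀ {x} → Nilp x → Nilp 0#
  nilp-0 {x} n = nilp-≈ (zeroʳ x) (nilp-*ˡ 0# n)

  V-stable : ∀ {a b} → Nilp b → ∀ k → N ℕ.≤ k → V a b k ≈ V a b N
  V-stable n = SV.Φ-stable (geo-0 (nilp-0 n)) n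

  V-tail : ∀ {a b} → Nilp b → ∀ n → V a b n * V (a * b ^ n) b N ≈ V a b N
  V-tail nb = SV.Φ-tail (geo-0 (nilp-0 nb)) nb

  P-tail′ : ∀ {a b} → Nilp a → Nilp b → ∀ n → P (a * b ^ n) b N ≈ P a b N * V a b n
  P-tail′ {a} {b} na nb n = sym (begin
    P a b N * V a b n                          ≈⟨ *-congʳ (P-tail nb n) ⟨
    (P a b n * P (a * b ^ n) b N) * V a b n    ≈⟨ solve 3 (λ x y z → (x :* y) :* z := (x :* z) :* y) refl _ _ _ ⟩
    (P a b n * V a b n) * P (a * b ^ n) b N    ≈⟨ *-congʳ (PV b n na) ⟩
    1# * P (a * b ^ n) b N                     ≈⟨ *-identityˡ _ ⟩
    P (a * b ^ n) b N                          ∎)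

  V-tail′ : ∀ {a b} → Nilp a → Nilp b → ∀ n → V (a * b ^ n) b N ≈ V a b N * P a b n
  V-tail′ {a} {b} na nb n = sym (begin
    V a b N * P a b n                          ≈⟨ *-congʳ (V-tail nb n) ⟨
    (V a b n * V (a * b ^ n) b N) * P a b n    ≈⟨ solve 3 (λ x y z → (x :* y) :* z := (z :* x) :* y) refl _ _ _ ⟩
    (P a b n * V a b n) * V (a * b ^ n) b N    ≈⟨ *-congʳ (PV b n na) ⟩
    1# * V (a * b ^ n) b N                     ≈⟨ *-identityˡ _ ⟩
    V (a * b ^ n) b N                          ∎)

-- The Bailey pair

-- The triangular number k(k+1)/2. It serves both as the weight in α and as the exponent in `s`.
T : ℕ → ℕ
T zero    = 0
T (suc k) = suc k ℕ.+ T k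

T-≥ : ∀ n → n ℕ.≤ T n
T-≥ zero    = ℕ.z≤n
T-≥ (suc n) = ℕ.m≤m+n (suc n) (T n)

module Bailey {c ℓ : Level} (R : CommutativeRing c ℓ) (N : ℕ)
              (b : CommutativeRing.Carrier R) (b-nilp : Nilpotent.Nilp R N b) where
  open CommutativeRing R
  open IntegerCoefficients R
  open FiniteSums R
  open Nilpotent R N
  open import Algebra.Properties.CommutativeSemiring.Exp commutativeSemiring
  open import Algebra.Properties.Semiring.Mult.TCOptimised semiring using (1+×; ×-homo-+)
  open import Relation.Binary.Reasoning.Setoid setoid

  -- I k = 1 / (b; b)ₖ₋₁, where 1 / (b; b)₋₁ = 0
  I : ℕ → Carrier
  I zero    = 0#
  I (suc k) = V b b k

  -- The value `I 0 = 0` is the right one here: at k = 0 the factor `1# - b ^ 0` is zero.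
  I-step : ∀ k → I k ≈ (1# - b ^ k) * I (suc k)
  I-step zero    = sym (trans (*-congʳ (-‿inverseʳ 1#)) (zeroˡ _))
  I-step (suc k) = begin
    V b b k                                            ≈⟨ *-identityʳ _ ⟨
    V b b k * 1#                                       ≈⟨ *-congˡ (geo-inverse (nilp-*ˡ _ b-nilp)) ⟨
    V b b k * ((1# - b * b ^ k) * geo (b * b ^ k))     ≈⟨ solve 3 (λ v f g → v :* (f :* g) := f :* (v :* g)) refl _ _ _ ⟩
    (1# - b * b ^ k) * (V b b k * geo (b * b ^ k))     ∎

  I-step′ : ∀ k {x} → b ^ k ≈ x → I k ≈ (1# - x) * I (suc k)
  I-step′ k e = trans (I-step k) (*-congʳ (1--cong e))

  -- The step from `I (k - 1)` has the factor 1 - b^(k-1); multiplying by b clears the negative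
  -- exponent at k = 0. Truncated subtraction does no harm there, as both sides are zero.
  I-pred : ∀ k → b * I (k ℕ.∸ 1) ≈ (b - b ^ k) * I k
  I-pred zero    = trans (zeroʳ b) (sym (zeroʳ _))
  I-pred (suc k) = trans (*-congˡ (I-step k))
    (solve 3 (λ b x i → b :* ((con (+ 1) :- x) :* i) := (b :- b :* x) :* i) refl b (b ^ k) _)

  -- In closed form (-1)ᵏ b^(k(k+1)/2).
  s : ℕ → Carrier
  s zero    = 1#
  s (suc k) = - (s k * b ^ suc k)

  # : ℕ → Carrier
  #  = fromℕ

  #-+ : ∀ m n → # (m ℕ.+ n) ≈ # m + # n
  #-+ = ×-homo-+ 1#

  odd : ℕ → Carrier
  odd k = # (suc (k ℕ.+ k))

  odd-suc : ∀ k → odd (suc k) ≈ odd k + (1# + 1#)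
  odd-suc k = trans (reflexive (≡.cong (λ j → # (suc (suc j))) (ℕ.+-suc k k)))
    (trans (1+× (suc (suc (k ℕ.+ k))) 1#) (trans (+-congˡ (1+× (suc (k ℕ.+ k)) 1#))
      (solve 1 (λ o → con (+ 1) :+ (con (+ 1) :+ o) := o :+ (con (+ 1) :+ con (+ 1))) refl (odd k))))

  D : ℕ → Carrier
  D n = P b b (suc (n ℕ.+ n))

  b^+ : ∀ j k {x y} → b ^ j ≈ x → b ^ k ≈ y → b ^ (j ℕ.+ k) ≈ x * y
  b^+ j k ex ey = trans (^-homo-* b j k) (*-cong ex ey)

  P-double : ∀ n {x} → b ^ n ≈ x → P b b (suc n ℕ.+ suc n) ≈ D n * (1# - b * (b * (x * x)))
  P-double n e = trans (reflexive (≡.cong (λ j → P b b (suc j)) (ℕ.+-suc n n)))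
    (*-congˡ (1--cong (*-congˡ (*-congˡ (b^+ n n e e)))))

  D-suc : ∀ n {x} → b ^ n ≈ x →
          D (suc n) ≈ D n * (1# - b * (b * (x * x))) * (1# - b * (b * (b * (x * x))))
  D-suc n e = *-cong (P-double n e) (1--cong (*-congˡ
    (trans (reflexive (≡.cong (λ j → b ^ suc j) (ℕ.+-suc n n))) (*-congˡ (*-congˡ (b^+ n n e e))))))

  -- Up to sign, the coefficient of z^(k+1) in (z; b)ₙ₊₁ (b/z; b)ₙ.
  g : ℕ → ℕ → Carrier
  g n k = s k * (D n * (I (suc (suc (k ℕ.+ n))) * I (suc n ℕ.∸ k)))

  -- The edge case of `g-recurrence`: the coefficients of z⁰ and z¹ are opposite, so `- g n 0` takes
  -- the place of the missing neighbour.
  g-recurrence₀ : ∀ n → let q = b * b ^ n in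
                  g (suc n) 0 ≈ (1# + q * q) * g n 0 - q * (g n 1 - g n 0)
  g-recurrence₀ n = solveBy 5 9 (b ∷ x ∷ D n ∷ A ∷ C ∷ [])
    (λ b x D A C →
      let o = con (+ 1) in
      b ∷ x ∷ D ∷ D :* (o :- b :* (b :* (x :* x))) :* (o :- b :* (b :* (b :* (x :* x)))) ∷
      A ∷ (o :- b :* (b :* x)) :* A ∷ (o :- b :* x) :* C ∷
      (o :- x) :* ((o :- b :* x) :* C) ∷ C ∷ [])
    (refl ∷ refl ∷ refl ∷ D-suc n refl ∷ refl ∷ I-step (suc (suc n)) ∷ I-step (suc n) ∷
     trans (I-step n) (*-congˡ (I-step (suc n))) ∷ refl ∷ [])
    (λ b x D D′ A A₂ j₁ j₀ j₂ →
      let o = con (+ 1) ; q = b :* x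
          g₀ = o :* (D :* (A₂ :* j₁))
      in
      o :* (D′ :* (A :* j₂)) :=
      (o :+ q :* q) :* g₀ :- q :* (:- (o :* (b :* o)) :* (D :* (A :* j₀)) :- g₀))
    refl
    where
    x = b ^ n
    A = I (3 ℕ.+ n)
    C = I (suc (suc n))

  -- With n = k + m every power of b that occurs is a monomial in b, x and y, which is the form
  -- `solveBy` needs.
  module Complement (n k : ℕ) (k≤n : k ℕ.≤ n) where
    m = n ℕ.∸ k
    x = b ^ m
    y = b ^ k
    C = I (suc m)
    n-split : b ^ n ≈ y * x
    n-split = trans (reflexive (≡.cong (b ^_) (≡.sym (ℕ.m+[n∸m]≡n k≤n)))) (^-homo-* b k m)
    kn : b ^ (k ℕ.+ n) ≈ y * (y * x)
    kn = b^+ k n refl n-split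
    j₀ : I (suc n ℕ.∸ k) ≈ C
    j₀ = reflexive (≡.cong I (ℕ.+-∸-assoc 1 k≤n))
    bj₂ : b * I (n ℕ.∸ suc k) ≈ (b - x) * ((1# - x) * C)
    bj₂ = trans (*-congˡ (reflexive (≡.cong I (≡.trans (≡.cong (n ℕ.∸_) (ℕ.+-comm 1 k)) (≡.sym (ℕ.∸-+-assoc n k 1))))))
      (trans (I-pred m) (*-congˡ (I-step m)))

  module Complement-g (n k : ℕ) (k≤n : k ℕ.≤ n) where
    open Complement n k k≤n public
    A = I (4 ℕ.+ (k ℕ.+ n))
    A₁ : I (3 ℕ.+ (k ℕ.+ n)) ≈ (1# - b * (b * (b * (y * (y * x))))) * A
    A₁ = I-step′ (3 ℕ.+ (k ℕ.+ n)) (*-congˡ (*-congˡ (*-congˡ kn)))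
    A₀ : I (suc (suc (k ℕ.+ n))) ≈ (1# - b * (b * (y * (y * x)))) * ((1# - b * (b * (b * (y * (y * x))))) * A)
    A₀ = trans (I-step′ (suc (suc (k ℕ.+ n))) (*-congˡ (*-congˡ kn))) (*-congˡ A₁)

  -- Passing from n to n + 1 multiplies the product by (1 - zq)(1 - q/z) = 1 + q² - q(z + 1/z),
  -- where q = b^(n+1). The recurrence compares coefficients; the sign in `g` is the same for all k
  -- and does not disturb it.
  g-recurrence : ∀ n k → k ℕ.≤ n → let q = b * b ^ n in
                 g (suc n) (suc k) ≈ (1# + q * q) * g n (suc k) - q * (g n k + g n (suc (suc k)))
  g-recurrence n k k≤n = trans
    (solveBy 7 13 (b ∷ x ∷ y ∷ D n ∷ A ∷ C ∷ s k ∷ [])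
       (λ b x y D A C s →
         let o = con (+ 1) ; q = y :* x ; w = y :* (y :* x) in
         b ∷ q ∷ y ∷ D ∷ D :* (o :- b :* (b :* (q :* q))) :* (o :- b :* (b :* (b :* (q :* q)))) ∷
         (o :- b :* (b :* w)) :* ((o :- b :* (b :* (b :* w))) :* A) ∷
         (o :- b :* (b :* (b :* w))) :* A ∷ A ∷ A ∷
         C ∷ (o :- x) :* C ∷ (b :- x) :* ((o :- x) :* C) ∷ s ∷ [])
       (refl ∷ n-split ∷ refl ∷ refl ∷ D-suc n n-split ∷ A₀ ∷ A₁ ∷ refl ∷ A′ ∷
        j₀ ∷ I-step m ∷
        bj₂ ∷ refl ∷ [])
       (λ b q y D D′ a₀ a₁ a₂ a′ j₀ j₁ bj₂ s →
         let p = b :* q in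
         :- (s :* (b :* y)) :* (D′ :* (a′ :* j₀)) :=
         (con (+ 1) :+ p :* p) :* (:- (s :* (b :* y)) :* (D :* (a₁ :* j₁))) :-
         p :* (s :* (D :* (a₀ :* j₀)) :+ s :* ((b :* (y :* y)) :* (b :* (D :* (a₂ :* bj₂))))))
       refl)
    -- One of the powers of b in `s (suc (suc k))` supplies the factor b that `bj₂` requires.
    (+-congˡ (-‿cong (*-congˡ (+-congˡ (solve 6 (λ s b y D a j →
       s :* ((b :* (y :* y)) :* (b :* (D :* (a :* (b :* j))))) :=
       :- (:- (s :* (b :* y)) :* (b :* (b :* y))) :* (D :* (a :* j))) refl (s k) b y (D n) _ _)))))
    where
    open Complement-g n k k≤n
    A′ : I (3 ℕ.+ (k ℕ.+ suc n)) ≈ A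
    A′ = reflexive (≡.cong (λ j → I (3 ℕ.+ j)) (ℕ.+-suc k n))

  g-zero : ∀ n k → n ℕ.< k → g n k ≈ 0#
  g-zero n k n<k = trans (*-congˡ (*-congˡ (*-congˡ (reflexive (≡.cong I (ℕ.m≤n⇒m∸n≡0 n<k))))))
    (solve 3 (λ s d i → s :* (d :* (i :* con (+ 0))) := con (+ 0)) refl _ _ _)

  -- The Casoratian of `odd` and `g n`. The second difference of `odd` is zero, so summing it
  -- against the second difference of `g n` leaves only this end term.
  boundary : ℕ → ℕ → Carrier
  boundary n zero    = 0#
  boundary n (suc k) = odd k * g n (suc k) - odd (suc k) * g n k

  -- (2k+1)(g(k+1) − 2g(k) + g(k−1)) is the difference of consecutive boundary terms.
  odd-sum-step : ∀ n K → K ℕ.≤ suc (suc n) → let q = b * b ^ n in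
                 ∑ K (λ k → odd k * g (suc n) k) ≈
                 (1# - q) * (1# - q) * ∑ K (λ k → odd k * g n k) - q * boundary n K
  odd-sum-step n zero    _   = solve 1 (λ q → con (+ 0) :=
    (con (+ 1) :- q) :* (con (+ 1) :- q) :* con (+ 0) :- q :* con (+ 0)) refl (b * b ^ n)
  odd-sum-step n (suc zero) _ = trans (+-congˡ (*-congˡ (g-recurrence₀ n)))
    (trans (solve 3 (λ q g₀ g₁ → con (+ 0) :+ con (+ 1) :* ((con (+ 1) :+ q :* q) :* g₀ :- q :* (g₁ :- g₀)) :=
       (con (+ 1) :- q) :* (con (+ 1) :- q) :* (con (+ 0) :+ con (+ 1) :* g₀) :-
       q :* (con (+ 1) :* g₁ :- (con (+ 1) :+ (con (+ 1) :+ con (+ 1))) :* g₀)) refl (b * b ^ n) (g n 0) (g n 1))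
     (+-congˡ (-‿cong (*-congˡ (+-congˡ (-‿cong (*-congʳ (sym (odd-suc 0)))))))))
  odd-sum-step n (suc (suc k)) (ℕ.s≤s k<n) = trans
    (+-cong (odd-sum-step n (suc k) (ℕ.m≤n⇒m≤1+n k<n)) (*-congˡ (g-recurrence n k (ℕ.s≤s⁻¹ k<n))))
    (solveBy 6 8 (q ∷ S ∷ g n k ∷ g n (suc k) ∷ g n (suc (suc k)) ∷ odd k ∷ [])
      (λ q S g₀ g₁ g₂ o → let two = con (+ 1) :+ con (+ 1) in
        q ∷ S ∷ g₀ ∷ g₁ ∷ g₂ ∷ o ∷ o :+ two ∷ (o :+ two) :+ two ∷ [])
      (refl ∷ refl ∷ refl ∷ refl ∷ refl ∷ refl ∷ odd-suc k ∷ trans (odd-suc (suc k)) (+-congʳ (odd-suc k)) ∷ [])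
      (λ q S g₀ g₁ g₂ o₀ o₁ o₂ → let o = con (+ 1) in
        ((o :- q) :* (o :- q) :* S :- q :* (o₀ :* g₁ :- o₁ :* g₀)) :+
          o₁ :* ((o :+ q :* q) :* g₁ :- q :* (g₀ :+ g₂)) :=
        (o :- q) :* (o :- q) :* (S :+ o₁ :* g₁) :- q :* (o₁ :* g₂ :- o₂ :* g₁))
      refl)
    where
    q = b * b ^ n
    S = ∑ (suc k) (λ k → odd k * g n k)

  -- A finite form of Jacobi's identity for (b; b)³.
  odd-sum : ∀ n → ∑ (suc n) (λ k → odd k * g n k) ≈ P b b n * P b b n
  odd-sum zero    = begin
    0# + 1# * (1# * ((1# * (1# - b * 1#)) * ((1# * geo (b * 1#)) * 1#)))
      ≈⟨ solve 2 (λ p v → con (+ 0) :+ con (+ 1) :* (con (+ 1) :* ((con (+ 1) :* p) :* ((con (+ 1) :* v) :* con (+ 1)))) := p :* v) refl _ _ ⟩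
    (1# - b * 1#) * geo (b * 1#)  ≈⟨ geo-inverse (nilp-*ˡ 1# b-nilp) ⟩
    1#                            ≈⟨ *-identityˡ 1# ⟨
    1# * 1#                       ∎
  odd-sum (suc n) = begin
    ∑ (suc (suc n)) (λ k → odd k * g (suc n) k)
      ≈⟨ odd-sum-step n (suc (suc n)) ℕ.≤-refl ⟩
    (1# - q) * (1# - q) * (∑ (suc n) (λ k → odd k * g n k) + odd (suc n) * g n (suc n)) -
      q * (odd (suc n) * g n (suc (suc n)) - odd (suc (suc n)) * g n (suc n))
      ≈⟨ +-cong (*-congˡ (+-cong (odd-sum n) (*-congˡ z₁))) (-‿cong (*-congˡ (+-cong (*-congˡ z₂) (-‿cong (*-congˡ z₁))))) ⟩
    (1# - q) * (1# - q) * (P b b n * P b b n + odd (suc n) * 0#) -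
      q * (odd (suc n) * 0# - odd (suc (suc n)) * 0#)
      ≈⟨ solve 4 (λ q p x y → let o = con (+ 1) ; z = con (+ 0) in
           (o :- q) :* (o :- q) :* (p :* p :+ x :* z) :- q :* (x :* z :- y :* z) :=
           (p :* (o :- q)) :* (p :* (o :- q))) refl q (P b b n) _ _ ⟩
    P b b (suc n) * P b b (suc n) ∎
    where
    q = b * b ^ n
    z₁ = g-zero n (suc n) ℕ.≤-refl
    z₂ = g-zero n (suc (suc n)) (ℕ.m≤n⇒m≤1+n ℕ.≤-refl)

  -- The Bailey pair: αₖ and Bₖ belong to the index r = k+1 of the literature,
  -- Bₖ(m) being 1 / ((b)ₙ₋ᵣ (b)ₙ₊ᵣ₊₁) with n = r + m.
  α : ℕ → Carrier
  α k = # (T (suc k)) * (s k * (1# - b * (b * (b * (b ^ k * b ^ k)))))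

  B : ℕ → ℕ → Carrier
  B k m = I (suc m) * I (4 ℕ.+ (k ℕ.+ k ℕ.+ m))

  -- Over the common denominator (b)ₙ₋ₖ (b)ₙ₊ₖ₊₃ the difference has the numerator (1 - b^(n+k+2))(1
  -- - b^(n+k+3)) - b^(2k+3)(1 - b^(n-k))(1 - b^(n-k-1)), which factors as (1 - b^(2k+3))(1 -
  -- b^(2n+2)).
  d-telescopes : ∀ n k → k ℕ.≤ n →
    P b b (suc n ℕ.+ suc n) * (s k * (1# - b * (b * (b * (b ^ k * b ^ k)))) * B k (n ℕ.∸ k)) ≈
    g n k - g n (suc (suc k))
  d-telescopes n k k≤n = trans
    (solveBy 7 11 (b ∷ x ∷ y ∷ D n ∷ A ∷ C ∷ s k ∷ [])
      (λ b x y D A C s →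
        let o = con (+ 1) ; q = y :* x ; w = y :* (y :* x) in
        b ∷ y ∷ D ∷ D :* (o :- b :* (b :* (q :* q))) ∷
        (o :- b :* (b :* w)) :* ((o :- b :* (b :* (b :* w))) :* A) ∷ A ∷ A ∷
        C ∷ C ∷ (b :- x) :* ((o :- x) :* C) ∷ s ∷ [])
      (refl ∷ refl ∷ refl ∷ P-double n n-split ∷ A₀ ∷ refl ∷ A′ ∷
       refl ∷ j₀ ∷ bj₂ ∷ refl ∷ [])
      (λ b y D D′ a₀ a₂ a′ c j₀ bj₂ s → let o = con (+ 1) in
        D′ :* (s :* (o :- b :* (b :* (b :* (y :* y)))) :* (c :* a′)) :=
        s :* (D :* (a₀ :* j₀)) :- s :* ((b :* (y :* y)) :* (b :* (D :* (a₂ :* bj₂)))))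
      refl)
    (+-congˡ (-‿cong (solve 6 (λ s b y D a j →
       s :* ((b :* (y :* y)) :* (b :* (D :* (a :* (b :* j))))) :=
       :- (:- (s :* (b :* y)) :* (b :* (b :* y))) :* (D :* (a :* j))) refl (s k) b y (D n) _ _)))
    where
    open Complement-g n k k≤n
    A′ : I (4 ℕ.+ (k ℕ.+ k ℕ.+ m)) ≈ A
    A′ = reflexive (≡.cong (λ j → I (4 ℕ.+ j))
      (≡.trans (ℕ.+-assoc k k m) (≡.cong (k ℕ.+_) (ℕ.m+[n∸m]≡n k≤n))))

  #-T : ∀ k → # (T (suc (suc k))) ≈ # (T k) + odd (suc k)
  #-T k = trans (reflexive (≡.cong # arith)) (#-+ (T k) _)
    where
    arith : T (suc (suc k)) ≡ T k ℕ.+ suc (suc k ℕ.+ suc k)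
    arith = ≡.trans (≡.cong (suc (suc k) ℕ.+_) (ℕ.+-comm (suc k) (T k)))
      (≡.trans (≡.sym (ℕ.+-assoc (suc (suc k)) (T k) (suc k)))
      (≡.trans (≡.cong (ℕ._+ suc k) (ℕ.+-comm (suc (suc k)) (T k)))
        (ℕ.+-assoc (T k) (suc (suc k)) (suc k))))

  -- Summation by parts with step two: T(k+1) - T(k-1) = 2k + 1. The step two is the cause of the
  -- two end terms.
  abel : ∀ n K →
    ∑ K (λ k → # (T (suc k)) * (g n k - g n (suc (suc k)))) ≈
    ∑ K (λ k → odd k * g n k) - # (T K) * g n (suc K) - # (T (K ℕ.∸ 1)) * g n K
  abel n zero = solve 2 (λ x y → con (+ 0) := con (+ 0) :- con (+ 0) :* x :- con (+ 0) :* y) refl _ _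
  abel n (suc zero) = trans (+-congʳ (abel n 0))
    (solve 3 (λ x y z → let o = con (+ 1) ; l = con (+ 0) in
      (l :- l :* y :- l :* x) :+ o :* (x :- z) := (l :+ o :* x) :- o :* z :- l :* y) refl _ _ _)
  abel n (suc (suc k)) = trans (+-congʳ (abel n (suc k)))
    (solveBy 7 8 (S ∷ g n (suc k) ∷ g n (suc (suc k)) ∷ g n (3 ℕ.+ k) ∷ # (T k) ∷ odd (suc k) ∷ # (T (suc k)) ∷ [])
      (λ S x y z t o t₁ → S ∷ x ∷ y ∷ z ∷ t ∷ o ∷ t₁ ∷ (t :+ o) ∷ [])
      (refl ∷ refl ∷ refl ∷ refl ∷ refl ∷ refl ∷ refl ∷ #-T k ∷ [])
      (λ S x y z t o t₁ t₂ →
        (S :- t₁ :* y :- t :* x) :+ t₂ :* (x :- z) := (S :+ o :* x) :- t₂ :* z :- t₁ :* y) refl)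
    where S = ∑ (suc k) (λ k → odd k * g n k)

  -- After multiplication by (b; b)₂ₙ₊₂ the terms are weighted differences of `g n`; `abel` turns
  -- them into the sum of `odd-sum`, and the end terms lie outside the support of `g n`. The index n
  -- stands for n + 1 of the literature.
  bailey-pair : ∀ n → P b b n * P b b n * V b b (suc n ℕ.+ suc n) ≈
                ∑ (suc n) (λ k → α k * B k (n ℕ.∸ k))
  bailey-pair n = sym (begin
    ∑ (suc n) (λ k → α k * B k (n ℕ.∸ k))
      ≈⟨ *-identityˡ _ ⟨
    1# * ∑ (suc n) (λ k → α k * B k (n ℕ.∸ k))
      ≈⟨ *-congʳ (trans (*-comm _ _) (PV b (suc n ℕ.+ suc n) b-nilp)) ⟨
    V₂ * P₂ * ∑ (suc n) (λ k → α k * B k (n ℕ.∸ k))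
      ≈⟨ *-assoc _ _ _ ⟩
    V₂ * (P₂ * ∑ (suc n) (λ k → α k * B k (n ℕ.∸ k)))
      ≈⟨ *-congˡ (trans (sym (∑-*ˡ (suc n) P₂ _)) (∑-cong< (suc n) (λ k k<1+n → trans
           (solve 5 (λ p t s e c → p :* (t :* (s :* e) :* c) := t :* (p :* (s :* e :* c))) refl _ _ _ _ _)
           (*-congˡ (d-telescopes n k (ℕ.s≤s⁻¹ k<1+n)))))) ⟩
    V₂ * ∑ (suc n) (λ k → # (T (suc k)) * (g n k - g n (suc (suc k))))
      ≈⟨ *-congˡ (abel n (suc n)) ⟩
    V₂ * (∑ (suc n) (λ k → odd k * g n k) - # (T (suc n)) * g n (suc (suc n)) - # (T n) * g n (suc n))
      ≈⟨ *-congˡ (+-cong (+-cong (odd-sum n) (-‿cong (*-congˡ (g-zero n _ (ℕ.m≤n⇒m≤1+n ℕ.≤-refl)))))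
           (-‿cong (*-congˡ (g-zero n _ ℕ.≤-refl)))) ⟩
    V₂ * (P b b n * P b b n - # (T (suc n)) * 0# - # (T n) * 0#)
      ≈⟨ solve 4 (λ v p x y → v :* (p :* p :- x :* con (+ 0) :- y :* con (+ 0)) := p :* p :* v) refl _ _ _ _ ⟩
    P b b n * P b b n * V₂ ∎)
    where
    V₂ = V b b (suc n ℕ.+ suc n)
    P₂ = P b b (suc n ℕ.+ suc n)

  β : ℕ → Carrier
  β n = P b b n * P b b n * V b b (suc n ℕ.+ suc n)

  Γ : (ℕ → Carrier) → ℕ → Carrier
  Γ δ k = ∑ N (λ m → δ (k ℕ.+ m) * B k m)

  -- Bailey's transform: the pair is inserted and the order of summation interchanged. Since δ
  -- vanishes from N on, the inner sums may be extended from N - k to N terms, which makes them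
  -- `Γ δ k`.
  bailey-sum : ∀ δ → (∀ n → N ℕ.≤ n → δ n ≈ 0#) →
               ∑ N (λ n → δ n * β n) ≈ ∑ N (λ k → α k * Γ δ k)
  bailey-sum δ δ-zero = begin
    ∑ N (λ n → δ n * β n)
      ≈⟨ ∑-cong N (λ n → trans (*-congˡ (bailey-pair n)) (trans (sym (∑-*ˡ (suc n) (δ n) _))
           (∑-cong< (suc n) (λ k k<1+n → trans
             (solve 3 (λ d a c → d :* (a :* c) := a :* (d :* c)) refl _ _ _)
             (*-congˡ (*-congʳ (reflexive (≡.cong δ (≡.sym (ℕ.m+[n∸m]≡n (ℕ.s≤s⁻¹ k<1+n))))))))))) ⟩
    ∑ N (λ n → ∑ (suc n) (λ k → α k * (δ (k ℕ.+ (n ℕ.∸ k)) * B k (n ℕ.∸ k))))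
      ≈⟨ ∑-triangle N (λ k m → α k * (δ (k ℕ.+ m) * B k m)) ⟩
    ∑ N (λ k → ∑ (N ℕ.∸ k) (λ m → α k * (δ (k ℕ.+ m) * B k m)))
      ≈⟨ ∑-cong N (λ k → trans (sym (∑-vanish (N ℕ.∸ k) N (ℕ.m∸n≤m N k) (λ m N∸k≤m →
           trans (*-congˡ (*-congʳ (δ-zero (k ℕ.+ m) (bound k m N∸k≤m))))
             (solve 2 (λ a c → a :* (con (+ 0) :* c) := con (+ 0)) refl _ _))))
           (∑-*ˡ N (α k) _)) ⟩
    ∑ N (λ k → α k * Γ δ k) ∎
    where
    bound : ∀ k m → N ℕ.∸ k ℕ.≤ m → N ℕ.≤ k ℕ.+ m
    bound k m le = ℕ.≤-trans (ℕ.m≤n+m∸n N k) (ℕ.+-monoʳ-≤ k le)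

-- The identities of Jacobi and Gauss

module Jacobi {c ℓ : Level} (R : CommutativeRing c ℓ) (N : ℕ)
              (b : CommutativeRing.Carrier R) (b-nilp : Nilpotent.Nilp R N b) where
  open CommutativeRing R
  open IntegerCoefficients R
  open FiniteSums R
  open Nilpotent R N
  open Bailey R N b b-nilp
  open import Algebra.Properties.Ring ring using (-0#≈0#)
  open import Algebra.Properties.CommutativeSemiring.Exp commutativeSemiring
  open import Relation.Binary.Reasoning.Setoid setoid

  L J : Carrier
  L = P b b N
  J = V b b N

  LJ : L * J ≈ 1#
  LJ = PV b N b-nilp

  I-stable : ∀ k → N ℕ.≤ k → I (suc k) ≈ J
  I-stable = V-stable b-nilp

  L-stable : ∀ k → N ℕ.≤ k → P b b k ≈ L
  L-stable = P-stable b-nilp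

  private
    -‿zero : ∀ {x} → x ≈ 0# → - x ≈ 0#
    -‿zero e = trans (-‿cong e) -0#≈0#

    factor-limit : ∀ {S Z} → S * (L * (J * J)) ≈ Z → S ≈ Z * L
    factor-limit {S} {Z} e = begin
      S                             ≈⟨ *-identityʳ S ⟨
      S * 1#                        ≈⟨ *-congˡ (trans (*-cong LJ LJ) (*-identityˡ 1#)) ⟨
      S * (L * J * (L * J))         ≈⟨ solve 3 (λ s l j → s :* (l :* j :* (l :* j)) := s :* (l :* (j :* j)) :* l) refl S L J ⟩
      S * (L * (J * J)) * L         ≈⟨ *-congʳ e ⟩
      Z * L                         ∎

    -- The choice n = 2N keeps both n + k and n - k at least N for every k ≤ N, so that all the
    -- factorials have reached their stable values.
    far : ∀ k → k ℕ.≤ N → N ℕ.≤ (N ℕ.+ N) ℕ.∸ k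
    far k k≤N = ℕ.≤-trans (ℕ.m≤m+n N (N ℕ.∸ k)) (ℕ.≤-reflexive (≡.sym (ℕ.+-∸-assoc N k≤N)))

    far′ : ∀ k → k ℕ.≤ N → suc (N ℕ.+ N) ℕ.∸ k ≡ suc ((N ℕ.+ N) ℕ.∸ k)
    far′ k k≤N = ℕ.+-∸-assoc 1 (ℕ.≤-trans k≤N (ℕ.m≤m+n N N))

  s-zero : ∀ k → N ℕ.≤ k → s k ≈ 0#
  -- Here N = 0, and nilpotency of b says 1 ≈ 0.
  s-zero zero    N≤k = nilp-≥ 0 N≤k b-nilp
  s-zero (suc k) N≤k = -‿zero (trans (*-congˡ (nilp-≥ (suc k) N≤k b-nilp)) (zeroʳ _))

  -- The identity `odd-sum` at n = 2N: for k < N the q-binomial coefficient in `g` equals its limit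
  -- L J² , and for k ≥ N the factor `s k` is zero.
  jacobi : ∑ N (λ k → odd k * s k) ≈ L * L * L
  jacobi = factor-limit (begin
    ∑ N (λ k → odd k * s k) * (L * (J * J))
      ≈⟨ trans (*-comm _ _) (sym (∑-*ˡ N _ _)) ⟩
    ∑ N (λ k → L * (J * J) * (odd k * s k))
      ≈⟨ ∑-cong< N (λ k k<N → trans
           (solve 4 (λ l j o s → l :* (j :* j) :* (o :* s) := o :* (s :* (l :* (j :* j)))) refl L J _ _)
           (*-congˡ (*-congˡ (sym (*-cong (L-stable _ (ℕ.m≤n⇒m≤1+n (ℕ.≤-trans (ℕ.m≤m+n N N) (ℕ.m≤m+n _ _))))
             (*-cong (I-stable _ (ℕ.m≤n⇒m≤1+n (ℕ.≤-trans (ℕ.m≤m+n N N) (ℕ.m≤n+m _ k))))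
               (trans (reflexive (≡.cong I (far′ k (ℕ.<⇒≤ k<N)))) (I-stable _ (far k (ℕ.<⇒≤ k<N)))))))))) ⟩
    ∑ N (λ k → odd k * g (N ℕ.+ N) k)
      ≈⟨ ∑-vanish N (suc (N ℕ.+ N)) (ℕ.m≤n⇒m≤1+n (ℕ.m≤m+n N N))
           (λ k N≤k → trans (*-congˡ (trans (*-congʳ (s-zero k N≤k)) (zeroˡ _))) (zeroʳ _)) ⟨
    ∑ (suc (N ℕ.+ N)) (λ k → odd k * g (N ℕ.+ N) k)
      ≈⟨ odd-sum (N ℕ.+ N) ⟩
    P b b (N ℕ.+ N) * P b b (N ℕ.+ N)
      ≈⟨ *-cong (L-stable _ (ℕ.m≤m+n N N)) (L-stable _ (ℕ.m≤m+n N N)) ⟩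
    L * L ∎)

  module Gauss (u : Carrier) (b≈u² : b ≈ u * u) where

    -- Because b = u², the closed form is (-1)ᵏ u^(k²).
    σ : ℕ → Carrier
    σ zero    = 1#
    σ (suc k) = - (σ k * (u * b ^ k))

    -- The weights by which a sum over all integers, symmetric under k ↦ -k, is folded to k ≥ 0.
    bilateral : ℕ → Carrier
    bilateral zero    = 1#
    bilateral (suc k) = 1# + 1#

    E : ℕ → Carrier
    E n = P b b (n ℕ.+ n)

    E-suc : ∀ n {x} → b ^ n ≈ x →
            E (suc n) ≈ E n * (1# - u * u * (x * x)) * (1# - u * u * (u * u * (x * x)))
    E-suc n e = trans (P-double n e) (trans (*-congʳ (*-congˡ (1--cong (*-congˡ (b^+ n n e e)))))
      (*-cong (*-congˡ (1--cong (*-congʳ b≈u²))) (1--cong (*-cong b≈u² (*-congʳ b≈u²)))))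

    -- The coefficient of z^k in (u z; b)ₙ (u/z; b)ₙ.
    h : ℕ → ℕ → Carrier
    h n k = σ k * (E n * (I (suc (k ℕ.+ n)) * I (suc n ℕ.∸ k)))

    -- By symmetry the coefficient at -1 is `h n 1`, so it occurs twice.
    h-recurrence₀ : ∀ n → let p = u * b ^ n in
                    h (suc n) 0 ≈ (1# + p * p) * h n 0 - p * (h n 1 + h n 1)
    h-recurrence₀ n = solveBy 4 7 (u ∷ b ^ n ∷ E n ∷ I (suc (suc n)) ∷ [])
      (λ u x E A → let o = con (+ 1) ; b = u :* u in
        u ∷ x ∷ E ∷ E :* (o :- b :* (x :* x)) :* (o :- b :* (b :* (x :* x))) ∷
        A ∷ (o :- b :* x) :* A ∷ (o :- x) :* ((o :- b :* x) :* A) ∷ [])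
      (refl ∷ refl ∷ refl ∷ E-suc n refl ∷ refl ∷ I₁ ∷ trans (I-step n) (*-congˡ I₁) ∷ [])
      (λ u x E E′ A a₁ a₀ → let o = con (+ 1) ; p = u :* x
                                h₀ = o :* (E :* (a₁ :* a₁))
                                h₁ = :- (o :* (u :* o)) :* (E :* (A :* a₀)) in
        o :* (E′ :* (A :* A)) := (o :+ p :* p) :* h₀ :- p :* (h₁ :+ h₁))
      refl
      where
      I₁ : I (suc n) ≈ (1# - u * u * b ^ n) * I (suc (suc n))
      I₁ = I-step′ (suc n) (*-congʳ b≈u²)

    -- The factor that leads from n to n + 1 is (1 - zp)(1 - p/z) = 1 + p² - p(z + 1/z).
    h-recurrence : ∀ n k → k ℕ.≤ n → let p = u * b ^ n in
                   h (suc n) (suc k) ≈ (1# + p * p) * h n (suc k) - p * (h n k + h n (suc (suc k)))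
    h-recurrence n k k≤n = trans
      (solveBy 7 13 (u ∷ x ∷ y ∷ E n ∷ A ∷ C ∷ σ k ∷ [])
         (λ u x y E A C s →
           let o = con (+ 1) ; b = u :* u ; q = y :* x ; w = y :* (y :* x) in
           u ∷ q ∷ y ∷ E ∷ E :* (o :- b :* (q :* q)) :* (o :- b :* (b :* (q :* q))) ∷
           (o :- b :* w) :* ((o :- b :* (b :* w)) :* A) ∷
           (o :- b :* (b :* w)) :* A ∷ A ∷ A ∷
           C ∷ (o :- x) :* C ∷ (b :- x) :* ((o :- x) :* C) ∷ s ∷ [])
         (refl ∷ n-split ∷ refl ∷ refl ∷ E-suc n n-split ∷ A₀ ∷ A₁ ∷ refl ∷ A′ ∷
          j₀ ∷ I-step m ∷
          trans bj₂ (*-congʳ (+-congʳ b≈u²)) ∷ refl ∷ [])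
         (λ u q y E E′ a₀ a₁ a₂ a′ j₀ j₁ bj₂ s →
           let p = u :* q in
           :- (s :* (u :* y)) :* (E′ :* (a′ :* j₀)) :=
           (con (+ 1) :+ p :* p) :* (:- (s :* (u :* y)) :* (E :* (a₁ :* j₁))) :-
           p :* (s :* (E :* (a₀ :* j₀)) :+ s :* ((u :* u) :* (y :* y) :* (E :* (a₂ :* bj₂)))))
         refl)
      (+-congˡ (-‿cong (*-congˡ (+-congˡ (solve 7 (λ s b u y D a j →
         s :* ((u :* u) :* (y :* y) :* (D :* (a :* (b :* j)))) :=
         :- (:- (s :* (u :* y)) :* (u :* (b :* y))) :* (D :* (a :* j))) refl (σ k) b u y (E n) _ _)))))
      where
      open Complement n k k≤n
      A = I (3 ℕ.+ (k ℕ.+ n))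
      A₁ : I (suc (suc (k ℕ.+ n))) ≈ (1# - u * u * (u * u * (y * (y * x)))) * A
      A₁ = I-step′ (suc (suc (k ℕ.+ n))) (*-cong b≈u² (*-cong b≈u² kn))
      A₀ : I (suc (k ℕ.+ n)) ≈ (1# - u * u * (y * (y * x))) * ((1# - u * u * (u * u * (y * (y * x)))) * A)
      A₀ = trans (I-step′ (suc (k ℕ.+ n)) (*-cong b≈u² kn)) (*-congˡ A₁)
      A′ : I (suc (suc (k ℕ.+ suc n))) ≈ A
      A′ = reflexive (≡.cong (λ j → I (suc (suc j))) (ℕ.+-suc k n))

    h-zero : ∀ n k → n ℕ.< k → h n k ≈ 0#
    h-zero n k n<k = trans (*-congˡ (*-congˡ (*-congˡ (reflexive (≡.cong I (ℕ.m≤n⇒m∸n≡0 n<k))))))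
      (solve 3 (λ s d i → s :* (d :* (i :* con (+ 0))) := con (+ 0)) refl _ _ _)

    -- As 1 + p² = (1 - p)² + 2p, the recurrence is (1 - p)² times the old value minus p times a
    -- second difference, and the latter sums to a first difference at the end.
    bilateral-sum-step : ∀ n K → K ℕ.≤ suc n → let p = u * b ^ n in
      ∑ (suc K) (λ k → bilateral k * h (suc n) k) ≈
      (1# - p) * (1# - p) * ∑ (suc K) (λ k → bilateral k * h n k) -
      p * ((1# + 1#) * h n (suc K) - (1# + 1#) * h n K)
    bilateral-sum-step n zero    _   = trans (+-congˡ (*-congˡ (h-recurrence₀ n)))
      (solve 3 (λ p h₀ h₁ → let o = con (+ 1) in
        con (+ 0) :+ o :* ((o :+ p :* p) :* h₀ :- p :* (h₁ :+ h₁)) :=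
        (o :- p) :* (o :- p) :* (con (+ 0) :+ o :* h₀) :- p :* ((o :+ o) :* h₁ :- (o :+ o) :* h₀)) refl _ _ _)
    bilateral-sum-step n (suc k) k<n = trans
      (+-cong (bilateral-sum-step n k (ℕ.<⇒≤ k<n)) (*-congˡ (h-recurrence n k (ℕ.s≤s⁻¹ k<n))))
      (solve 5 (λ p S h₀ h₁ h₂ → let o = con (+ 1) ; t = o :+ o in
        ((o :- p) :* (o :- p) :* S :- p :* (t :* h₁ :- t :* h₀)) :+
          t :* ((o :+ p :* p) :* h₁ :- p :* (h₀ :+ h₂)) :=
        (o :- p) :* (o :- p) :* (S :+ t :* h₁) :- p :* (t :* h₂ :- t :* h₁)) refl _ _ _ _ _)

    -- This is the value at z = 1 of the Laurent polynomial whose coefficients are `h n`.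
    bilateral-sum : ∀ n → ∑ (suc n) (λ k → bilateral k * h n k) ≈ P u b n * P u b n
    bilateral-sum zero    = solve 0 (let o = con (+ 1) in con (+ 0) :+ o :* (o :* (o :* (o :* o))) := o :* o) refl
    bilateral-sum (suc n) = begin
      ∑ (suc (suc n)) (λ k → bilateral k * h (suc n) k)
        ≈⟨ bilateral-sum-step n (suc n) ℕ.≤-refl ⟩
      (1# - p) * (1# - p) * (∑ (suc n) (λ k → bilateral k * h n k) + (1# + 1#) * h n (suc n)) -
        p * ((1# + 1#) * h n (suc (suc n)) - (1# + 1#) * h n (suc n))
        ≈⟨ +-cong (*-congˡ (+-cong (bilateral-sum n) (*-congˡ z₁))) (-‿cong (*-congˡ (+-cong (*-congˡ z₂) (-‿cong (*-congˡ z₁))))) ⟩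
      (1# - p) * (1# - p) * (P u b n * P u b n + (1# + 1#) * 0#) -
        p * ((1# + 1#) * 0# - (1# + 1#) * 0#)
        ≈⟨ solve 2 (λ p f → let o = con (+ 1) ; t = o :+ o ; z = con (+ 0) in
             (o :- p) :* (o :- p) :* (f :* f :+ t :* z) :- p :* (t :* z :- t :* z) :=
             (f :* (o :- p)) :* (f :* (o :- p))) refl p (P u b n) ⟩
      P u b (suc n) * P u b (suc n) ∎
      where
      p = u * b ^ n
      z₁ = h-zero n (suc n) ℕ.≤-refl
      z₂ = h-zero n (suc (suc n)) (ℕ.m≤n⇒m≤1+n ℕ.≤-refl)

    -- The last factor of `σ (suc k)` is only `b ^ k`, so vanishing starts one index later than for
    -- `s`; this is why the theta sums have `suc N` terms.
    σ-zero : ∀ k → suc N ℕ.≤ k → σ k ≈ 0#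
    σ-zero (suc k) (ℕ.s≤s N≤k) = -‿zero (trans (*-congˡ (*-congˡ (nilp-≥ k N≤k b-nilp)))
      (solve 2 (λ s u → s :* (u :* con (+ 0)) := con (+ 0)) refl _ _))

    -- The case z = 1 of the triple product, obtained from `bilateral-sum` at n = 2N in the way
    -- `jacobi` is obtained from `odd-sum`.
    gauss : ∑ (suc N) (λ k → bilateral k * σ k) ≈ P u b N * P u b N * L
    gauss = factor-limit (begin
      ∑ (suc N) (λ k → bilateral k * σ k) * (L * (J * J))
        ≈⟨ trans (*-comm _ _) (sym (∑-*ˡ (suc N) _ _)) ⟩
      ∑ (suc N) (λ k → L * (J * J) * (bilateral k * σ k))
        ≈⟨ ∑-cong< (suc N) (λ k k≤N → trans
             (solve 4 (λ l j o s → l :* (j :* j) :* (o :* s) := o :* (s :* (l :* (j :* j)))) refl L J _ _)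
             (*-congˡ (*-congˡ (sym (*-cong (L-stable _ (ℕ.≤-trans (ℕ.m≤m+n N N) (ℕ.m≤m+n _ _)))
               (*-cong (I-stable _ (ℕ.≤-trans (ℕ.m≤m+n N N) (ℕ.m≤n+m _ k)))
                 (trans (reflexive (≡.cong I (far′ k (ℕ.s≤s⁻¹ k≤N)))) (I-stable _ (far k (ℕ.s≤s⁻¹ k≤N)))))))))) ⟩
      ∑ (suc N) (λ k → bilateral k * h (N ℕ.+ N) k)
        ≈⟨ ∑-vanish (suc N) (suc (N ℕ.+ N)) (ℕ.s≤s (ℕ.m≤m+n N N))
             (λ k N<k → trans (*-congˡ (trans (*-congʳ (σ-zero k N<k)) (zeroˡ _))) (zeroʳ _)) ⟨
      ∑ (suc (N ℕ.+ N)) (λ k → bilateral k * h (N ℕ.+ N) k)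
        ≈⟨ bilateral-sum (N ℕ.+ N) ⟩
      P u b (N ℕ.+ N) * P u b (N ℕ.+ N)
        ≈⟨ *-cong (P-stable b-nilp _ (ℕ.m≤m+n N N)) (P-stable b-nilp _ (ℕ.m≤m+n N N)) ⟩
      P u b N * P u b N ∎)

-- Conjugate Bailey sums

-- Induction from infinity. The recurrences below relate k to k + 1, and their initial value is the
-- limit, which is already attained for k ≥ N.
downward : ∀ {p} (N : ℕ) (S : ℕ → Set p) →
           (∀ k → N ℕ.≤ k → S k) → (∀ k → S (suc k) → S k) → ∀ k → S k
downward N S base step k = go N k (ℕ.m≤n+m N k)
  where
  go : ∀ j k → N ℕ.≤ k ℕ.+ j → S k
  go zero    k le = base k (ℕ.≤-trans le (ℕ.≤-reflexive (ℕ.+-identityʳ k)))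
  go (suc j) k le = step k (go j (suc k) (ℕ.≤-trans le (ℕ.≤-reflexive (ℕ.+-suc k j))))

module Certificates {c ℓ : Level} (R : CommutativeRing c ℓ) (N : ℕ)
              (b : CommutativeRing.Carrier R) (b-nilp : Nilpotent.Nilp R N b) where
  open CommutativeRing R
  open IntegerCoefficients R
  open FiniteSums R
  open Nilpotent R N
  open Bailey R N b b-nilp
  open import Algebra.Properties.CommutativeSemiring.Exp commutativeSemiring
  open import Relation.Binary.Reasoning.Setoid setoid

  -- Creative telescoping in the index k, with certificate G.
  Γ-recurrence : ∀ δ c c′ k (G : ℕ → Carrier) → (∀ n → N ℕ.≤ n → δ n ≈ 0#) → G 0 ≈ 0# →
    (∀ m → c * (δ (k ℕ.+ m) * B k m) + G m ≈
           c′ * (δ (k ℕ.+ m) * (I m * I (5 ℕ.+ (k ℕ.+ k ℕ.+ m)))) + G (suc m)) →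
    c * Γ δ k ≈ c′ * Γ δ (suc k) + G (suc N)
  Γ-recurrence δ c c′ k G δ-zero G0 step = begin
    c * Γ δ k
      ≈⟨ ∑-*ˡ N c _ ⟨
    ∑ N (λ m → c * (δ (k ℕ.+ m) * B k m))
      ≈⟨ +-identityʳ _ ⟨
    ∑ N (λ m → c * (δ (k ℕ.+ m) * B k m)) + 0#
      -- A vanishing term is appended, so that N terms remain after the shift on the right.
      ≈⟨ +-congˡ (trans (*-congˡ (trans (*-congʳ (δ-zero _ (ℕ.m≤n+m N k))) (zeroˡ _))) (zeroʳ c)) ⟨
    ∑ (suc N) (λ m → c * (δ (k ℕ.+ m) * B k m))
      ≈⟨ go (suc N) ⟩
    -- The term `F′ 0` is zero because `I 0` is, and `F′ (suc m)` is the m-th term of `Γ δ (suc k)`.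
    ∑ (suc N) F′ + G (suc N)
      ≈⟨ +-congʳ (∑-shift N F′) ⟩
    (c′ * (δ (k ℕ.+ 0) * (0# * _)) + ∑ N (λ m → F′ (suc m))) + G (suc N)
      ≈⟨ +-congʳ (trans (+-cong (solve 3 (λ c d i → c :* (d :* (con (+ 0) :* i)) := con (+ 0)) refl c′ _ _)
           (∑-cong N (λ m → *-congˡ (*-cong (reflexive (≡.cong δ (ℕ.+-suc k m)))
             (*-congˡ (reflexive (≡.cong (λ j → I (5 ℕ.+ j)) (index m))))))))
           (+-identityˡ _)) ⟩
    ∑ N (λ m → c′ * (δ (suc k ℕ.+ m) * B (suc k) m)) + G (suc N)
      ≈⟨ +-congʳ (∑-*ˡ N c′ _) ⟩
    c′ * Γ δ (suc k) + G (suc N) ∎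
    where
    F′ : ℕ → Carrier
    F′ m = c′ * (δ (k ℕ.+ m) * (I m * I (5 ℕ.+ (k ℕ.+ k ℕ.+ m))))

    index : ∀ m → k ℕ.+ k ℕ.+ suc m ≡ k ℕ.+ suc k ℕ.+ m
    index m = ≡.trans (ℕ.+-suc (k ℕ.+ k) m) (≡.cong (ℕ._+ m) (≡.sym (ℕ.+-suc k k)))

    go : ∀ n → ∑ n (λ m → c * (δ (k ℕ.+ m) * B k m)) ≈ ∑ n F′ + G n
    go zero    = trans (sym G0) (sym (+-identityˡ _))
    go (suc n) = begin
      ∑ n _ + _                        ≈⟨ +-congʳ (go n) ⟩
      (∑ n F′ + G n) + _               ≈⟨ solve 3 (λ s g a → (s :+ g) :+ a := s :+ (a :+ g)) refl _ _ _ ⟩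
      ∑ n F′ + (_ + G n)               ≈⟨ +-congˡ (step n) ⟩
      ∑ n F′ + (F′ n + G (suc n))      ≈⟨ +-assoc _ _ _ ⟨
      ∑ (suc n) F′ + G (suc n)         ∎

  Γ-zero : ∀ {δ} → (∀ n → N ℕ.≤ n → δ n ≈ 0#) → ∀ k → N ℕ.≤ k → Γ δ k ≈ 0#
  Γ-zero δ-zero k le = ∑-0 N (λ m → trans (*-congʳ (δ-zero _ (ℕ.≤-trans le (ℕ.m≤m+n k m)))) (zeroˡ _))

  kkm : ∀ k m → b ^ (k ℕ.+ k ℕ.+ m) ≈ b ^ k * (b ^ k * b ^ m)
  kkm k m = trans (b^+ (k ℕ.+ k) m (b^+ k k refl refl) refl) (*-assoc _ _ _)

  -- Creative telescoping for sums whose left-hand terms are one step ahead of the certificate;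
  -- `f N` being zero pays for the additional term.
  sum-recurrence : ∀ c c′ {f h g : ℕ → Carrier} → f N ≈ 0# → c * f 0 ≈ g 0 →
    (∀ m → c * f (suc m) + g m ≈ c′ * h m + g (suc m)) → c * ∑ N f ≈ c′ * ∑ N h + g N
  sum-recurrence c c′ {f} {h} {g} fN base step = begin
    c * ∑ N f                              ≈⟨ ∑-*ˡ N c f ⟨
    ∑ N (λ m → c * f m)                    ≈⟨ +-identityʳ _ ⟨
    ∑ N (λ m → c * f m) + 0#               ≈⟨ +-congˡ (trans (*-congˡ fN) (zeroʳ c)) ⟨
    ∑ (suc N) (λ m → c * f m)              ≈⟨ ∑-telescope base step N ⟩
    ∑ N (λ m → c′ * h m) + g N             ≈⟨ +-congʳ (∑-*ˡ N c′ h) ⟩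
    c′ * ∑ N h + g N                       ∎

  -- For N = 0 the sum is empty, and `f N ≈ 0#` then says that `f 0` is zero as well.
  ∑-first : ∀ {f : ℕ → Carrier} → f N ≈ 0# → (∀ m → f (suc m) ≈ 0#) → ∑ N f ≈ f 0
  ∑-first {f} fN f0 = begin
    ∑ N f              ≈⟨ +-identityʳ _ ⟨
    ∑ N f + 0#         ≈⟨ +-congˡ fN ⟨
    ∑ (suc N) f        ≈⟨ ∑-vanish 1 (suc N) (ℕ.s≤s ℕ.z≤n) (λ { (suc m) _ → f0 m }) ⟩
    0# + f 0           ≈⟨ +-identityˡ _ ⟩
    f 0                ∎

  module Euler where
    E : Carrier → Carrier
    E x = ∑ N (λ m → x ^ m * I (suc m))

    -- Replacing x by xb changes the m-th term by xᵐ(1 - bᵐ)/(b; b)ₘ = xᵐ/(b; b)ₘ₋₁, and these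
    -- differences add up to x E(x).
    E-step : ∀ {x} → Nilp x → (1# - x) * E x ≈ E (x * b)
    E-step {x} nx = begin
      (1# - x) * E x                                 ≈⟨ solve 2 (λ x e → (con (+ 1) :- x) :* e := e :- x :* e) refl x (E x) ⟩
      E x - x * E x                                  ≈⟨ +-congˡ (-‿cong shifted) ⟨
      E x - ∑ N (λ m → x ^ m * I m)                  ≈⟨ +-congʳ split ⟩
      (E (x * b) + ∑ N (λ m → x ^ m * I m)) - ∑ N (λ m → x ^ m * I m)
        ≈⟨ solve 2 (λ a s → (a :+ s) :- s := a) refl _ _ ⟩
      E (x * b)                                      ∎
      where
      shifted : ∑ N (λ m → x ^ m * I m) ≈ x * E x
      shifted = begin
        ∑ N (λ m → x ^ m * I m)                           ≈⟨ +-identityʳ _ ⟨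
        ∑ N (λ m → x ^ m * I m) + 0#                      ≈⟨ +-congˡ (trans (*-congʳ nx) (zeroˡ _)) ⟨
        ∑ (suc N) (λ m → x ^ m * I m)                     ≈⟨ ∑-shift N _ ⟩
        1# * 0# + ∑ N (λ m → x ^ suc m * I (suc m))       ≈⟨ trans (+-congʳ (zeroʳ 1#)) (+-identityˡ _) ⟩
        ∑ N (λ m → x ^ suc m * I (suc m))                 ≈⟨ ∑-cong N (λ m → *-assoc _ _ _) ⟩
        ∑ N (λ m → x * (x ^ m * I (suc m)))               ≈⟨ ∑-*ˡ N x _ ⟩
        x * E x                                           ∎
      split : E x ≈ E (x * b) + ∑ N (λ m → x ^ m * I m)
      split = trans (∑-cong N (λ m → trans
        (solve 3 (λ x b i → x :* i := x :* b :* i :+ x :* ((con (+ 1) :- b) :* i)) refl (x ^ m) (b ^ m) (I (suc m)))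
        (+-cong (*-congʳ (sym (^-distrib-* x b m))) (*-congˡ (sym (I-step m)))))) (∑-+ N _ _)

    E-iterate : ∀ {x} → Nilp x → ∀ k → P x b k * E x ≈ E (x * b ^ k)
    E-iterate nx zero    = trans (*-identityˡ _) (∑-cong N (λ m → *-congʳ (^-congˡ m (sym (*-identityʳ _)))))
    E-iterate {x} nx (suc k) = begin
      P x b k * (1# - x * b ^ k) * E x       ≈⟨ solve 3 (λ p f e → p :* f :* e := f :* (p :* e)) refl _ _ _ ⟩
      (1# - x * b ^ k) * (P x b k * E x)     ≈⟨ *-congˡ (E-iterate nx k) ⟩
      (1# - x * b ^ k) * E (x * b ^ k)       ≈⟨ E-step (nilp-*ˡ _ nx) ⟩
      E (x * b ^ k * b)                      ≈⟨ ∑-cong N (λ m → *-congʳ (^-congˡ m (solve 3 (λ x c b → x :* c :* b := x :* (b :* c)) refl x (b ^ k) b))) ⟩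
      E (x * (b * b ^ k))                    ∎

    -- Iterating `E-step` moves the argument to `x * b ^ N`, which is zero, where only the constant
    -- term is left.
    euler : ∀ {x} → Nilp x → P x b N * E x ≈ 1#
    euler {x} nx = begin
      P x b N * E x          ≈⟨ E-iterate nx N ⟩
      E (x * b ^ N)          ≈⟨ ∑-cong N (λ m → *-congʳ (^-congˡ m (trans (*-congˡ b-nilp) (zeroʳ x)))) ⟩
      E 0#                   ≈⟨ ∑-first (trans (*-congʳ (nilp-0 nx)) (zeroˡ _)) (λ m → trans (*-congʳ (0^ m)) (zeroˡ _)) ⟩
      1# * 1#                ≈⟨ *-identityˡ 1# ⟩
      1#                     ∎

-- Evaluation of the sums Γ for each family

module Families {a ℓ : Level} (R : CommutativeRing a ℓ) (N : ℕ)
              (q : CommutativeRing.Carrier R) (q-nilp : Nilpotent.Nilp R N q) where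
  open CommutativeRing R
  open IntegerCoefficients R
  open FiniteSums R
  open Nilpotent R N
  open import Algebra.Properties.Ring ring using (-0#≈0#)
  open import Algebra.Properties.CommutativeSemiring.Exp commutativeSemiring
  open import Relation.Binary.Reasoning.Setoid setoid

  Q : Carrier
  Q = q * q

  Q-nilp : Nilp Q
  Q-nilp = nilp-*ˡ q q-nilp

  neg-nilp : ∀ {x} → Nilp x → Nilp (- x)
  neg-nilp {x} n = nilp-≈ (solve 1 (λ x → (:- con (+ 1)) :* x := :- x) refl x) (nilp-*ʳ (- 1#) n)

  Q^ : ∀ n → Q ^ n ≈ q ^ n * q ^ n
  Q^ n = ^-distrib-* q q n

  module Bq = Bailey R N q q-nilp
  module BQ = Bailey R N Q Q-nilp
  module Cq = Certificates R N q q-nilp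
  module CQ = Certificates R N Q Q-nilp

  private
    o : ∀ {n} → Polynomial n
    o = con (+ 1)

  beyond : ∀ k → N ℕ.≤ suc (k ℕ.+ suc N)
  beyond k = ℕ.m≤n⇒m≤1+n (ℕ.≤-trans (ℕ.n≤1+n N) (ℕ.m≤n+m (suc N) k))

  q^-zero : ∀ n → N ℕ.≤ n → q ^ suc n ≈ 0#
  q^-zero n N≤n = nilp-≥ (suc n) (ℕ.m≤n⇒m≤1+n N≤n) q-nilp

  Q^-zero : ∀ n → N ℕ.≤ n → Q ^ suc n ≈ 0#
  Q^-zero n N≤n = nilp-≥ (suc n) (ℕ.m≤n⇒m≤1+n N≤n) Q-nilp

  module G2 where
    open Bq
    open Cq

    δ : ℕ → Carrier
    δ n = q ^ suc n * P (- q) Q (suc n)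

    δ-zero : ∀ n → N ℕ.≤ n → δ n ≈ 0#
    δ-zero n le = trans (*-congʳ (q^-zero n le)) (zeroˡ _)

    -- The coefficient of the next sum is zero: after multiplication by 1 + q^(2k+3) the summand is
    -- itself a difference in m, and the sum is closed.
    Γ-value : ∀ k → (1# + q * (q * (q * (q ^ k * q ^ k)))) * Γ δ k ≈
                    q ^ suc k * (P (- q) Q N * (V q q N * V q q N))
    Γ-value k = begin
      (1# + q * (q * (q * (y * y)))) * Γ δ k
        ≈⟨ Γ-recurrence δ _ 0# k G δ-zero (solve 3 (λ a b c → a :* (b :* (con (+ 0) :* c)) := con (+ 0)) refl _ _ _) step ⟩
      0# * Γ δ (suc k) + G (suc N)
        ≈⟨ trans (+-congʳ (zeroˡ _)) (+-identityˡ _) ⟩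
      G (suc N)
        ≈⟨ *-congˡ (*-cong (P-stable Q-nilp _ (beyond k))
             (*-congˡ (V-stable q-nilp _ (ℕ.m≤n⇒m≤1+n (beyond (k ℕ.+ k)))))) ⟩
      q ^ suc k * (P (- q) Q N * (V q q N * V q q N)) ∎
      where
      y = q ^ k
      -- The factor `I m` makes `G 0` vanish, and `G (suc N)` has reached its stable value, the
      -- right-hand side of the claim.
      G : ℕ → Carrier
      G m = q ^ suc k * (P (- q) Q (suc (k ℕ.+ m)) * (I m * I (3 ℕ.+ (k ℕ.+ k ℕ.+ m))))
      step : ∀ m → (1# + q * (q * (q * (y * y)))) * (δ (k ℕ.+ m) * B k m) + G m ≈
                   0# * (δ (k ℕ.+ m) * (I m * I (5 ℕ.+ (k ℕ.+ k ℕ.+ m)))) + G (suc m)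
      step m = solveBy 7 11 (q ∷ x ∷ y ∷ p ∷ A ∷ C ∷ A₅ ∷ [])
        (λ q x y p A C A₅ → q ∷ y ∷ p ∷ A ∷ C ∷ A₅ ∷ q :* (y :* x) ∷
          p :* (o :- (:- q) :* ((q :* (y :* x)) :* (q :* (y :* x)))) ∷ (o :- x) :* C ∷
          (o :- q :* (q :* (q :* (y :* (y :* x))))) :* A ∷ A ∷ [])
        (refl ∷ refl ∷ refl ∷ refl ∷ refl ∷ refl ∷ *-congˡ km ∷
         trans (reflexive (≡.cong (λ j → P (- q) Q (suc j)) (ℕ.+-suc k m)))
           (*-congˡ (1--cong (*-congˡ (trans (Q^ (suc (k ℕ.+ m))) (*-cong (*-congˡ km) (*-congˡ km)))))) ∷
         I-step m ∷ I-step′ (3 ℕ.+ (k ℕ.+ k ℕ.+ m)) (*-congˡ (*-congˡ (*-congˡ (kkm k m)))) ∷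
         reflexive (≡.cong (λ j → I (3 ℕ.+ j)) (ℕ.+-suc (k ℕ.+ k) m)) ∷ [])
        (λ q y p A C A₅ w p′ c a a′ →
          (o :+ q :* (q :* (q :* (y :* y)))) :* ((w :* p) :* (C :* A)) :+ (q :* y) :* (p :* (c :* a)) :=
          con (+ 0) :* ((w :* p) :* (c :* A₅)) :+ (q :* y) :* (p′ :* (C :* a′)))
        refl
        where
        x = q ^ m
        km : q ^ (k ℕ.+ m) ≈ y * x
        km = ^-homo-* q k m
        p = P (- q) Q (suc (k ℕ.+ m))
        C = I (suc m)
        A = I (4 ℕ.+ (k ℕ.+ k ℕ.+ m))
        A₅ = I (5 ℕ.+ (k ℕ.+ k ℕ.+ m))

  -- For L9, L7 and L12 the sum Γ is a multiple of a partial theta function; its first-order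
  -- recurrence is all that is used.
  module L9 where
    open Bq
    open Cq

    δ : ℕ → Carrier
    δ n = q ^ suc n * P Q Q (suc n)

    δ-zero : ∀ n → N ℕ.≤ n → δ n ≈ 0#
    δ-zero n le = trans (*-congʳ (q^-zero n le)) (zeroˡ _)

    Γ-relation : ∀ k → 1# * Γ δ k ≈ - (q * (q * (q * (q * (q ^ k * q ^ k))))) * Γ δ (suc k) +
                                    q ^ suc k * (P Q Q N * (V q q N * V q q N))
    Γ-relation k = trans
      (Γ-recurrence δ 1# c′ k G δ-zero
        (solve 3 (λ a b c → a :* (b :* (con (+ 0) :* c)) := con (+ 0)) refl _ _ _) step)
      (+-congˡ (*-congˡ (*-cong (P-stable Q-nilp _ (beyond k))
             (*-congˡ (V-stable q-nilp _ (ℕ.m≤n⇒m≤o+n 2 (beyond (k ℕ.+ k))))))))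
      where
      y = q ^ k
      c′ = - (q * (q * (q * (q * (y * y)))))
      G : ℕ → Carrier
      G m = q ^ suc k * (P Q Q (suc (k ℕ.+ m)) * (I m * I (4 ℕ.+ (k ℕ.+ k ℕ.+ m))))
      step : ∀ m → 1# * (δ (k ℕ.+ m) * B k m) + G m ≈
                   c′ * (δ (k ℕ.+ m) * (I m * I (5 ℕ.+ (k ℕ.+ k ℕ.+ m)))) + G (suc m)
      step m = solveBy 6 10 (q ∷ x ∷ y ∷ p ∷ A ∷ C ∷ [])
        (λ q x y p A C → q ∷ y ∷ p ∷ A ∷ C ∷ q :* (y :* x) ∷
          p :* (o :- (q :* q) :* ((q :* (y :* x)) :* (q :* (y :* x)))) ∷ (o :- x) :* C ∷
          (o :- q :* (q :* (q :* (q :* (y :* (y :* x)))))) :* A ∷ A ∷ [])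
        (refl ∷ refl ∷ refl ∷ refl ∷ refl ∷ *-congˡ km ∷
         trans (reflexive (≡.cong (λ j → P Q Q (suc j)) (ℕ.+-suc k m)))
           (*-congˡ (1--cong (*-congˡ (trans (Q^ (suc (k ℕ.+ m))) (*-cong (*-congˡ km) (*-congˡ km)))))) ∷
         I-step m ∷ I-step′ (4 ℕ.+ (k ℕ.+ k ℕ.+ m)) (*-congˡ (*-congˡ (*-congˡ (*-congˡ (kkm k m))))) ∷
         reflexive (≡.cong (λ j → I (4 ℕ.+ j)) (ℕ.+-suc (k ℕ.+ k) m)) ∷ [])
        (λ q y p A C w p′ c a a′ →
          o :* ((w :* p) :* (C :* a)) :+ (q :* y) :* (p :* (c :* a)) :=
          (:- (q :* (q :* (q :* (q :* (y :* y)))))) :* ((w :* p) :* (c :* A)) :+ (q :* y) :* (p′ :* (C :* a′)))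
        refl
        where
        x = q ^ m
        km : q ^ (k ℕ.+ m) ≈ y * x
        km = ^-homo-* q k m
        p = P Q Q (suc (k ℕ.+ m))
        C = I (suc m)
        A = I (5 ℕ.+ (k ℕ.+ k ℕ.+ m))

  q^double : ∀ n → q ^ (n ℕ.+ n) ≈ Q ^ n
  q^double n = trans (^-homo-* q n n) (sym (Q^ n))

  P-double-suc : ∀ k m {z} → Q ^ (k ℕ.+ m) ≈ z →
    P q q (suc (k ℕ.+ suc m) ℕ.+ suc (k ℕ.+ suc m)) ≈
    P q q (suc (k ℕ.+ m) ℕ.+ suc (k ℕ.+ m)) * (1# - q * (Q * z)) * (1# - q * (q * (Q * z)))
  P-double-suc k m {z} e = trans
    (reflexive (≡.trans (≡.cong (λ j → P q q (suc j ℕ.+ suc j)) (ℕ.+-suc k m))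
      (≡.cong (λ j → P q q (suc j)) (ℕ.+-suc n n))))
    (*-cong (*-congˡ (1--cong (*-congˡ dbl))) (1--cong (*-congˡ (*-congˡ dbl))))
    where
    n = suc (k ℕ.+ m)
    dbl : q ^ (n ℕ.+ n) ≈ Q * z
    dbl = trans (q^double n) (*-congˡ e)

  module L7 where
    open BQ
    open CQ

    δ : ℕ → Carrier
    δ n = Q ^ suc n * P q q (suc n ℕ.+ suc n)

    δ-zero : ∀ n → N ℕ.≤ n → δ n ≈ 0#
    δ-zero n le = trans (*-congʳ (Q^-zero n le)) (zeroˡ _)

    -- The factor 1 - q^(2k+3) accompanies `Γ δ k`, and its successor accompanies `Γ δ (suc k)`;
    -- normalising by it leaves a first-order recurrence with monomial coefficient.
    Γ-relation : ∀ k →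
      (1# - q * (Q * Q ^ k)) * Γ δ k ≈
      (q * (Q * (Q * (Q * (Q ^ k * Q ^ k))))) * (1# - q * (Q * (Q * Q ^ k))) * Γ δ (suc k) +
      (Q ^ suc k * (1# + Q * (Q * Q ^ k))) * (P q q N * (V Q Q N * V Q Q N))
    Γ-relation k = trans
      (Γ-recurrence δ c c′ k G δ-zero
        (solve 3 (λ a b c → a :* (b :* (con (+ 0) :* c)) := con (+ 0)) refl _ _ _) step)
      (+-congˡ (*-congˡ (*-cong (P-stable q-nilp _ (ℕ.≤-trans (beyond k) (ℕ.m≤m+n (suc (k ℕ.+ suc N)) _)))
             (*-congˡ (V-stable Q-nilp _ (ℕ.m≤n⇒m≤o+n 2 (beyond (k ℕ.+ k))))))))
      where
      y = Q ^ k
      c = 1# - q * (Q * y)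
      c′ = (q * (Q * (Q * (Q * (y * y))))) * (1# - q * (Q * (Q * y)))
      G : ℕ → Carrier
      G m = (Q ^ suc k * (1# + Q * (Q * y))) *
            (P q q (suc (k ℕ.+ m) ℕ.+ suc (k ℕ.+ m)) * (I m * I (4 ℕ.+ (k ℕ.+ k ℕ.+ m))))
      step : ∀ m → c * (δ (k ℕ.+ m) * B k m) + G m ≈
                   c′ * (δ (k ℕ.+ m) * (I m * I (5 ℕ.+ (k ℕ.+ k ℕ.+ m)))) + G (suc m)
      step m = solveBy 6 10 (q ∷ x ∷ y ∷ p ∷ A ∷ C ∷ [])
        (λ q x y p A C → let Q = q :* q in q ∷ y ∷ p ∷ A ∷ C ∷ Q :* (y :* x) ∷
          p :* (o :- q :* (Q :* (y :* x))) :* (o :- q :* (q :* (Q :* (y :* x)))) ∷ (o :- x) :* C ∷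
          (o :- Q :* (Q :* (Q :* (Q :* (y :* (y :* x)))))) :* A ∷ A ∷ [])
        (refl ∷ refl ∷ refl ∷ refl ∷ refl ∷ *-congˡ km ∷ P-double-suc k m km ∷
         I-step m ∷ I-step′ (4 ℕ.+ (k ℕ.+ k ℕ.+ m)) (*-congˡ (*-congˡ (*-congˡ (*-congˡ (kkm k m))))) ∷
         reflexive (≡.cong (λ j → I (4 ℕ.+ j)) (ℕ.+-suc (k ℕ.+ k) m)) ∷ [])
        (λ q y p A C w p′ c a a′ → let Q = q :* q in
          (o :- q :* (Q :* y)) :* ((w :* p) :* (C :* a)) :+ ((Q :* y) :* (o :+ Q :* (Q :* y))) :* (p :* (c :* a)) :=
          ((q :* (Q :* (Q :* (Q :* (y :* y))))) :* (o :- q :* (Q :* (Q :* y)))) :* ((w :* p) :* (c :* A)) :+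
          ((Q :* y) :* (o :+ Q :* (Q :* y))) :* (p′ :* (C :* a′)))
        refl
        where
        x = Q ^ m
        km : Q ^ (k ℕ.+ m) ≈ y * x
        km = ^-homo-* Q k m
        p = P q q (suc (k ℕ.+ m) ℕ.+ suc (k ℕ.+ m))
        C = I (suc m)
        A = I (5 ℕ.+ (k ℕ.+ k ℕ.+ m))

  module L12 where
    open BQ
    open CQ

    v : ℕ → Carrier
    v n = V (- q) Q n

    v-step : ∀ n {z} → Q ^ n ≈ z → v n ≈ (1# + q * z) * v (suc n)
    v-step n {z} e = sym (begin
      (1# + q * z) * (v n * geo (- q * Q ^ n))
        ≈⟨ *-congʳ (trans (solve 2 (λ q z → o :+ q :* z := o :- (:- q) :* z) refl q z) (1--cong (*-congˡ (sym e)))) ⟩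
      (1# - - q * Q ^ n) * (v n * geo (- q * Q ^ n))
        ≈⟨ solve 3 (λ a b c → a :* (b :* c) := b :* (a :* c)) refl _ _ _ ⟩
      v n * ((1# - - q * Q ^ n) * geo (- q * Q ^ n))
        ≈⟨ *-congˡ (geo-inverse (nilp-*ˡ _ (neg-nilp q-nilp))) ⟩
      v n * 1#
        ≈⟨ *-identityʳ _ ⟩
      v n ∎)

    p₂ : ℕ → Carrier
    p₂ n = P Q Q (n ℕ.+ n)

    p₂-suc : ∀ n {z} → Q ^ n ≈ z → p₂ (suc n) ≈ p₂ n * (1# - Q * (z * z)) * (1# - Q * (Q * (z * z)))
    p₂-suc n {z} e = trans (reflexive (≡.cong (P Q Q) (≡.cong suc (ℕ.+-suc n n))))
      (*-cong (*-congˡ (1--cong (*-congˡ dbl))) (1--cong (*-congˡ (*-congˡ dbl))))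
      where
      dbl : Q ^ (n ℕ.+ n) ≈ z * z
      dbl = trans (^-homo-* Q n n) (*-cong e e)

    -- The products in the summand start at -q^(2n+1) and -q^(2n+3), hence the unequal indices of
    -- `v`. The factor `p₂` compensates for the denominator of β.
    δ : ℕ → Carrier
    δ n = Q ^ suc n * (p₂ (suc n) * (v (suc n) * v (suc (suc n))))

    δ-zero : ∀ n → N ℕ.≤ n → δ n ≈ 0#
    δ-zero n le = trans (*-congʳ (Q^-zero n le)) (zeroˡ _)

    Γ-relation : ∀ k →
      (1# - q * (Q * Q ^ k)) * Γ δ k ≈
      (q * (Q * Q ^ k)) * (1# - q * (Q * (Q * Q ^ k))) * Γ δ (suc k) +
      Q ^ suc k * (P Q Q N * (V (- q) Q N * V (- q) Q N) * (V Q Q N * V Q Q N))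
    Γ-relation k = trans
      (Γ-recurrence δ c c′ k G δ-zero
        (solve 3 (λ a b c → a :* (b :* (con (+ 0) :* c)) := con (+ 0)) refl _ _ _) step)
      (+-congˡ (*-congˡ (*-cong (*-cong (P-stable Q-nilp _ (ℕ.≤-trans (beyond k) (ℕ.m≤m+n (suc (k ℕ.+ suc N)) _)))
         (*-cong (V-stable Q-nilp _ (beyond k)) (V-stable Q-nilp _ (beyond k))))
             (*-congˡ (V-stable Q-nilp _ (ℕ.m≤n⇒m≤o+n 2 (beyond (k ℕ.+ k))))))))
      where
      y = Q ^ k
      c = 1# - q * (Q * y)
      c′ = (q * (Q * y)) * (1# - q * (Q * (Q * y)))
      G : ℕ → Carrier
      G m = Q ^ suc k *
            (p₂ (suc (k ℕ.+ m)) * (v (suc (k ℕ.+ m)) * v (suc (k ℕ.+ m))) * (I m * I (4 ℕ.+ (k ℕ.+ k ℕ.+ m))))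
      step : ∀ m → c * (δ (k ℕ.+ m) * B k m) + G m ≈
                   c′ * (δ (k ℕ.+ m) * (I m * I (5 ℕ.+ (k ℕ.+ k ℕ.+ m)))) + G (suc m)
      step m = solveBy 7 13 (q ∷ x ∷ y ∷ p ∷ A ∷ C ∷ W ∷ [])
        (λ q x y p A C W → let Q = q :* q in q ∷ y ∷ p ∷ A ∷ C ∷ Q :* (y :* x) ∷
          p :* (o :- Q :* ((Q :* (y :* x)) :* (Q :* (y :* x)))) :* (o :- Q :* (Q :* ((Q :* (y :* x)) :* (Q :* (y :* x))))) ∷
          (o :- x) :* C ∷
          (o :- Q :* (Q :* (Q :* (Q :* (y :* (y :* x)))))) :* A ∷ A ∷
          W ∷ (o :+ q :* (Q :* (y :* x))) :* W ∷ W ∷ [])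
        (refl ∷ refl ∷ refl ∷ refl ∷ refl ∷ *-congˡ km ∷
         trans (reflexive (≡.cong (λ j → p₂ (suc j)) (ℕ.+-suc k m))) (p₂-suc (suc (k ℕ.+ m)) (*-congˡ km)) ∷
         I-step m ∷ I-step′ (4 ℕ.+ (k ℕ.+ k ℕ.+ m)) (*-congˡ (*-congˡ (*-congˡ (*-congˡ (kkm k m))))) ∷
         reflexive (≡.cong (λ j → I (4 ℕ.+ j)) (ℕ.+-suc (k ℕ.+ k) m)) ∷
         refl ∷ v-step (suc (k ℕ.+ m)) (*-congˡ km) ∷ reflexive (≡.cong (λ j → v (suc j)) (ℕ.+-suc k m)) ∷ [])
        (λ q y p A C w p′ c a a′ W v₀ W′ → let Q = q :* q in
          (o :- q :* (Q :* y)) :* ((w :* (p :* (v₀ :* W))) :* (C :* a)) :+ (Q :* y) :* (p :* (v₀ :* v₀) :* (c :* a)) :=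
          ((q :* (Q :* y)) :* (o :- q :* (Q :* (Q :* y)))) :* ((w :* (p :* (v₀ :* W))) :* (c :* A)) :+
          (Q :* y) :* (p′ :* (W′ :* W′) :* (C :* a′)))
        refl
        where
        x = Q ^ m
        km : Q ^ (k ℕ.+ m) ≈ y * x
        km = ^-homo-* Q k m
        p = p₂ (suc (k ℕ.+ m))
        W = v (suc (suc (k ℕ.+ m)))
        C = I (suc m)
        A = I (5 ℕ.+ (k ℕ.+ k ℕ.+ m))

  module G1 where
    open BQ
    open CQ
    open Euler

    f : ℕ → ℕ → Carrier
    f k m = q ^ m * (P q q (suc (k ℕ.+ m) ℕ.+ suc (k ℕ.+ m)) * B k m)

    f-recurrence : ∀ k → (1# - q * (Q * Q ^ k)) * ∑ N (f k) ≈ (1# - q * (Q * (Q * Q ^ k))) * ∑ N (f (suc k))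
    f-recurrence k = trans
      (sum-recurrence c₀ c₁ {g = cert} (trans (*-congʳ q-nilp) (zeroˡ _)) base step)
      (trans (+-congˡ (trans (*-congˡ (trans (*-congʳ q-nilp) (zeroˡ _))) (zeroʳ _))) (+-identityʳ _))
      where
      y = Q ^ k
      c₀ = 1# - q * (Q * y)
      c₁ = 1# - q * (Q * (Q * y))
      p₂ : ℕ → Carrier
      p₂ n = P q q (suc n ℕ.+ suc n)
      -- At m = 0 this is `c₀ * f k 0`, so the telescoping starts; at m = N the factor `q ^ m` is
      -- zero, so nothing is left at the end.
      cert : ℕ → Carrier
      cert m = (1# + Q * (Q * y)) * (q ^ m * (p₂ (suc (k ℕ.+ m)) *
              (I (suc m) * I (5 ℕ.+ (k ℕ.+ k ℕ.+ m)))))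
      base : c₀ * f k 0 ≈ cert 0
      base = solveBy 5 7 (q ∷ y ∷ p₂ (k ℕ.+ 0) ∷ I (5 ℕ.+ (k ℕ.+ k ℕ.+ 0)) ∷ I 1 ∷ [])
        (λ q y p A i → let Q = q :* q in q ∷ y ∷ p ∷ A ∷ i ∷
           p :* (o :- q :* (Q :* y)) :* (o :- q :* (q :* (Q :* y))) ∷
           (o :- Q :* (Q :* (Q :* (Q :* (y :* y))))) :* A ∷ [])
        (refl ∷ refl ∷ refl ∷ refl ∷ refl ∷ trans (reflexive (≡.cong p₂ (≡.sym (ℕ.+-suc k 0))))
            (P-double-suc k 0 (reflexive (≡.cong (Q ^_) (ℕ.+-identityʳ k)))) ∷
          I-step′ (4 ℕ.+ (k ℕ.+ k ℕ.+ 0)) (*-congˡ (*-congˡ (*-congˡ (*-congˡ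
            (trans (reflexive (≡.cong (Q ^_) (ℕ.+-identityʳ (k ℕ.+ k)))) (^-homo-* Q k k)))))) ∷ [])
        (λ q y p A i p′ A′ → let Q = q :* q in
          (o :- q :* (Q :* y)) :* (o :* (p :* (i :* A′))) := (o :+ Q :* (Q :* y)) :* (o :* (p′ :* (i :* A))))
        refl
      step : ∀ m → c₀ * f k (suc m) + cert m ≈ c₁ * f (suc k) m + cert (suc m)
      step m = solveBy 6 14 (q ∷ X ∷ y ∷ p ∷ A ∷ C ∷ [])
        (λ q X y p A C → let Q = q :* q ; x = X :* X
                             A₅ = (o :- Q :* (Q :* (Q :* (Q :* (Q :* (y :* (y :* x))))))) :* A in
          q ∷ X ∷ y ∷ p ∷ p ∷ p ∷ p :* (o :- q :* (Q :* (Q :* (y :* x)))) :* (o :- q :* (q :* (Q :* (Q :* (y :* x))))) ∷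
          C ∷ (o :- Q :* x) :* C ∷ A ∷ A ∷ A ∷ A₅ ∷ A₅ ∷ [])
        (refl ∷ refl ∷ refl ∷ refl ∷ reflexive (≡.cong p₂ (ℕ.+-suc k m)) ∷ refl ∷
         trans (reflexive (≡.cong p₂ (≡.sym (ℕ.+-suc k (suc m)))))
           (trans (P-double-suc k (suc m) km′) (*-congʳ (*-congʳ (reflexive (≡.cong p₂ (ℕ.+-suc k m)))))) ∷
         refl ∷ I-step′ (suc m) (*-congˡ (Q^ m)) ∷ refl ∷
         reflexive (≡.cong (λ j → I (5 ℕ.+ j)) (≡.cong (ℕ._+ m) (ℕ.+-suc k k))) ∷
         reflexive (≡.cong (λ j → I (5 ℕ.+ j)) (ℕ.+-suc (k ℕ.+ k) m)) ∷
         A₅-step ∷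
         trans (reflexive (≡.cong (λ j → I (4 ℕ.+ j)) (ℕ.+-suc (k ℕ.+ k) m))) A₅-step ∷ [])
        (λ q X y p pa pb p′ C c A Ab Ag A₅ A₅a → let Q = q :* q in
          (o :- q :* (Q :* y)) :* ((q :* X) :* (pa :* (C :* A₅a))) :+
          (o :+ Q :* (Q :* y)) :* (X :* (p :* (c :* A₅))) :=
          (o :- q :* (Q :* (Q :* y))) :* (X :* (pb :* (c :* Ab))) :+
          (o :+ Q :* (Q :* y)) :* ((q :* X) :* (p′ :* (C :* Ag))))
        refl
        where
        X = q ^ m
        km′ : Q ^ (k ℕ.+ suc m) ≈ Q * (y * (X * X))
        km′ = trans (reflexive (≡.cong (Q ^_) (ℕ.+-suc k m))) (*-congˡ (trans (^-homo-* Q k m) (*-congˡ (Q^ m))))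
        p = p₂ (suc (k ℕ.+ m))
        A = I (6 ℕ.+ (k ℕ.+ k ℕ.+ m))
        C = I (suc (suc m))
        A₅-step : I (5 ℕ.+ (k ℕ.+ k ℕ.+ m)) ≈ (1# - Q * (Q * (Q * (Q * (Q * (y * (y * (X * X)))))))) * A
        A₅-step = I-step′ (5 ℕ.+ (k ℕ.+ k ℕ.+ m)) (*-congˡ (*-congˡ (*-congˡ (*-congˡ (*-congˡ
          (trans (kkm k m) (*-congˡ (*-congˡ (Q^ m)))))))))

    -- The left-hand side does not depend on k, by `f-recurrence`. For k ≥ N the finite products are
    -- stable, and Euler's sum 1/(q; q²) meets (q; q)/(q²; q²) = (q; q²).
    f-sum : ∀ k → (1# - q * (Q * Q ^ k)) * ∑ N (f k) ≈ 1#
    f-sum = downward N _ far-out (λ k e → trans (f-recurrence k) e)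
      where
      far-out : ∀ k → N ℕ.≤ k → (1# - q * (Q * Q ^ k)) * ∑ N (f k) ≈ 1#
      far-out k le = begin
        (1# - q * (Q * Q ^ k)) * ∑ N (f k)
          ≈⟨ *-cong (trans (1--cong (trans (*-congˡ (trans (*-congˡ (nilp-≥ k le Q-nilp)) (zeroʳ Q))) (zeroʳ q))) 1-0≈1)
               (∑-cong N (λ m → trans (*-congˡ (*-cong
                 (P-stable q-nilp _ (ℕ.≤-trans (ℕ.≤-trans le (ℕ.m≤n⇒m≤1+n (ℕ.m≤m+n k m))) (ℕ.m≤m+n _ _)))
                 (*-congˡ (V-stable Q-nilp _ (ℕ.≤-trans le (ℕ.m≤n⇒m≤o+n 3 (ℕ.≤-trans (ℕ.m≤m+n k k) (ℕ.m≤m+n (k ℕ.+ k) m))))))))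
                 (solve 4 (λ x l i j → x :* (l :* (i :* j)) := (l :* j) :* (x :* i)) refl _ _ _ _))) ⟩
        1# * ∑ N (λ m → P q q N * V Q Q N * (q ^ m * I (suc m)))
          ≈⟨ trans (*-identityˡ _) (∑-*ˡ N _ _) ⟩
        P q q N * V Q Q N * E q
          ≈⟨ *-congʳ (*-congʳ (trans (sym (P-stable q-nilp _ (ℕ.m≤m+n N N))) (P-pairs q q N))) ⟩
        P q Q N * P Q Q N * V Q Q N * E q
          ≈⟨ solve 4 (λ a b c d → a :* b :* c :* d := (a :* d) :* (b :* c)) refl _ _ _ _ ⟩
        (P q Q N * E q) * (P Q Q N * V Q Q N)
          ≈⟨ *-cong (euler q-nilp) (PV Q N Q-nilp) ⟩
        1# * 1#
          ≈⟨ *-identityˡ 1# ⟩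
        1# ∎

    δ : ℕ → Carrier
    δ n = q ^ suc n * P q q (suc n ℕ.+ suc n)

    δ-zero : ∀ n → N ℕ.≤ n → δ n ≈ 0#
    δ-zero n le = trans (*-congʳ (q^-zero n le)) (zeroˡ _)

    Γ-value : ∀ k → (1# - q * (Q * Q ^ k)) * Γ δ k ≈ q ^ suc k
    Γ-value k = begin
      (1# - q * (Q * Q ^ k)) * Γ δ k
        ≈⟨ *-congˡ (trans (∑-cong N (λ m → trans (*-congʳ (*-congʳ (^-homo-* q (suc k) m)))
             (solve 4 (λ a x p c → a :* x :* p :* c := a :* (x :* (p :* c))) refl _ _ _ _))) (∑-*ˡ N _ _)) ⟩
      (1# - q * (Q * Q ^ k)) * (q ^ suc k * ∑ N (f k))
        ≈⟨ solve 3 (λ a c d → a :* (c :* d) := c :* (a :* d)) refl _ _ _ ⟩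
      q ^ suc k * ((1# - q * (Q * Q ^ k)) * ∑ N (f k))
        ≈⟨ *-congˡ (f-sum k) ⟩
      q ^ suc k * 1#
        ≈⟨ *-identityʳ _ ⟩
      q ^ suc k ∎

  module G3 where
    open Bq
    open Cq

    -- The quotient of `s (suc (k + m))` by `s (suc k)`, given directly because no division by
    -- powers of q is available.
    C : ℕ → ℕ → Carrier
    C k zero    = 1#
    C k (suc m) = - (C k m * (q * (q * (q ^ k * q ^ m))))

    C-suc : ∀ k m → C (suc k) m ≈ C k m * q ^ m
    C-suc k zero    = sym (*-identityˡ 1#)
    C-suc k (suc m) = trans (-‿cong (*-congʳ (C-suc k m)))
      (solve 4 (λ c x y q → :- (c :* x :* (q :* (q :* (q :* y :* x)))) :=
                            :- (c :* (q :* (q :* (y :* x)))) :* (q :* x)) refl (C k m) (q ^ m) (q ^ k) q)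

    s-C : ∀ k m → s (suc (k ℕ.+ m)) ≈ s (suc k) * C k m
    s-C k zero    = trans (reflexive (≡.cong (λ j → s (suc j)) (ℕ.+-identityʳ k))) (sym (*-identityʳ _))
    s-C k (suc m) = trans (reflexive (≡.cong (λ j → s (suc j)) (ℕ.+-suc k m)))
      (trans (-‿cong (*-cong (s-C k m) (*-congˡ (*-congˡ (^-homo-* q k m)))))
        (solve 3 (λ s c w → :- (s :* c :* w) := s :* (:- (c :* w))) refl (s (suc k)) (C k m) _))

    C-zero : ∀ k m → N ℕ.≤ k → C k (suc m) ≈ 0#
    C-zero k m le = trans (-‿cong (*-congˡ (*-congˡ (*-congˡ (*-congʳ (nilp-≥ k le q-nilp))))))
      (solve 3 (λ c q x → :- (c :* (q :* (q :* (con (+ 0) :* x)))) := con (+ 0)) refl (C k m) q (q ^ m))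

    C-zero′ : ∀ k m → N ℕ.≤ m → C k m ≈ 0#
    C-zero′ k zero    le = nilp-≥ 0 le q-nilp
    C-zero′ k (suc m) le = trans (solve 4 (λ c q x y → :- (c :* (q :* (q :* (y :* x)))) := :- (c :* (q :* (y :* (q :* x))))) refl (C k m) q (q ^ m) (q ^ k))
      (trans (-‿cong (*-congˡ (*-congˡ (*-congˡ (nilp-≥ (suc m) le q-nilp)))))
        (solve 3 (λ c q x → :- (c :* (q :* (x :* con (+ 0)))) := con (+ 0)) refl (C k m) q (q ^ k)))

    f : ℕ → ℕ → Carrier
    f k m = C k m * (P q q (suc (k ℕ.+ m)) * B k m)

    f-recurrence : ∀ k → 1# * ∑ N (f k) ≈ 1# * ∑ N (f (suc k))
    f-recurrence k = trans
      (sum-recurrence 1# 1# {g = cert} (trans (*-congʳ (C-zero′ k N ℕ.≤-refl)) (zeroˡ _)) base step)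
      (trans (+-congˡ (trans (*-congˡ (trans (*-congʳ q-nilp) (zeroˡ _))) (zeroʳ _))) (+-identityʳ _))
      where
      y = q ^ k
      cert : ℕ → Carrier
      cert m = (1# + q * (q * y)) * (q ^ m * (C k m * (P q q (suc (suc (k ℕ.+ m))) *
              (I (suc m) * I (5 ℕ.+ (k ℕ.+ k ℕ.+ m))))))
      base : 1# * f k 0 ≈ cert 0
      base = solveBy 5 7 (q ∷ y ∷ P q q (suc (k ℕ.+ 0)) ∷ I (5 ℕ.+ (k ℕ.+ k ℕ.+ 0)) ∷ I 1 ∷ [])
        (λ q y p A i → q ∷ y ∷ p ∷ A ∷ i ∷
           p :* (o :- q :* (q :* y)) ∷ (o :- q :* (q :* (q :* (q :* (y :* y))))) :* A ∷ [])
        (refl ∷ refl ∷ refl ∷ refl ∷ refl ∷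
          *-congˡ (1--cong (*-congˡ (*-congˡ (reflexive (≡.cong (q ^_) (ℕ.+-identityʳ k)))))) ∷
          I-step′ (4 ℕ.+ (k ℕ.+ k ℕ.+ 0)) (*-congˡ (*-congˡ (*-congˡ (*-congˡ
            (trans (reflexive (≡.cong (q ^_) (ℕ.+-identityʳ (k ℕ.+ k)))) (^-homo-* q k k)))))) ∷ [])
        (λ q y p A i p′ A′ →
          o :* (o :* (p :* (i :* A′))) := (o :+ q :* (q :* y)) :* (o :* (o :* (p′ :* (i :* A)))))
        refl
      step : ∀ m → 1# * f k (suc m) + cert m ≈ 1# * f (suc k) m + cert (suc m)
      step m = solveBy 7 15 (q ∷ x ∷ y ∷ p ∷ A ∷ D′ ∷ C k m ∷ [])
        (λ q x y p A D C →
          let A₅ = (o :- q :* (q :* (q :* (q :* (q :* (y :* (y :* x))))))) :* A in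
          q ∷ x ∷ y ∷ C ∷ C :* x ∷ p ∷ p ∷ p :* (o :- q :* (q :* (q :* (y :* x)))) ∷
          D ∷ (o :- q :* x) :* D ∷ A ∷ A ∷ A ∷ A₅ ∷ A₅ ∷ [])
        (refl ∷ refl ∷ refl ∷ refl ∷ C-suc k m ∷ refl ∷ reflexive (≡.cong (λ j → P q q (suc j)) (ℕ.+-suc k m)) ∷
         trans (reflexive (≡.cong (λ j → P q q (suc (suc j))) (ℕ.+-suc k m)))
           (*-congˡ (1--cong (*-congˡ (*-congˡ (*-congˡ (^-homo-* q k m)))))) ∷
         refl ∷ I-step (suc m) ∷ refl ∷
         reflexive (≡.cong (λ j → I (5 ℕ.+ j)) (≡.cong (ℕ._+ m) (ℕ.+-suc k k))) ∷
         reflexive (≡.cong (λ j → I (5 ℕ.+ j)) (ℕ.+-suc (k ℕ.+ k) m)) ∷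
         A₅-step ∷
         trans (reflexive (≡.cong (λ j → I (4 ℕ.+ j)) (ℕ.+-suc (k ℕ.+ k) m))) A₅-step ∷ [])
        (λ q x y C Cs p pa p′ D d A Ab Ag A₅ A₅a → let C′ = :- (C :* (q :* (q :* (y :* x)))) in
          o :* (C′ :* (pa :* (D :* A₅a))) :+
          (o :+ q :* (q :* y)) :* (x :* (C :* (p :* (d :* A₅)))) :=
          o :* (Cs :* (p :* (d :* Ab))) :+
          (o :+ q :* (q :* y)) :* ((q :* x) :* (C′ :* (p′ :* (D :* Ag)))))
        refl
        where
        x = q ^ m
        p = P q q (suc (suc (k ℕ.+ m)))
        A = I (6 ℕ.+ (k ℕ.+ k ℕ.+ m))
        D′ = I (suc (suc m))
        A₅-step : I (5 ℕ.+ (k ℕ.+ k ℕ.+ m)) ≈ (1# - q * (q * (q * (q * (q * (y * (y * x))))))) * A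
        A₅-step = I-step′ (5 ℕ.+ (k ℕ.+ k ℕ.+ m)) (*-congˡ (*-congˡ (*-congˡ (*-congˡ (*-congˡ (kkm k m))))))

    -- The sum is independent of k. For k ≥ N every `C k (suc m)` contains the zero factor `q ^ k`,
    -- so only m = 0 remains, with the value (q; q)/(q; q).
    f-sum : ∀ k → 1# * ∑ N (f k) ≈ 1#
    f-sum = downward N _ far-out (λ k e → trans (f-recurrence k) e)
      where
      far-out : ∀ k → N ℕ.≤ k → 1# * ∑ N (f k) ≈ 1#
      far-out k le = begin
        1# * ∑ N (f k)
          ≈⟨ trans (*-identityˡ _) (∑-first (trans (*-congʳ (C-zero′ k N ℕ.≤-refl)) (zeroˡ _))
               (λ m → trans (*-congʳ (C-zero k m le)) (zeroˡ _))) ⟩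
        1# * (P q q (suc (k ℕ.+ 0)) * (1# * I (4 ℕ.+ (k ℕ.+ k ℕ.+ 0))))
          ≈⟨ *-congˡ (*-cong (P-stable q-nilp _ (ℕ.m≤n⇒m≤1+n (ℕ.≤-trans le (ℕ.m≤m+n k 0))))
               (*-congˡ (V-stable q-nilp _ (ℕ.m≤n⇒m≤1+n (ℕ.m≤n⇒m≤1+n (ℕ.m≤n⇒m≤1+n
                 (ℕ.≤-trans le (ℕ.≤-trans (ℕ.m≤m+n k k) (ℕ.m≤m+n (k ℕ.+ k) 0))))))))) ⟩
        1# * (P q q N * (1# * V q q N))
          ≈⟨ trans (*-identityˡ _) (*-congˡ (*-identityˡ _)) ⟩
        P q q N * V q q N
          ≈⟨ PV q N q-nilp ⟩
        1# ∎

    δ : ℕ → Carrier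
    δ n = s (suc n) * P q q (suc n)

    δ-zero : ∀ n → N ℕ.≤ n → δ n ≈ 0#
    δ-zero n le = trans (*-congʳ (trans (-‿cong (trans (*-congˡ (q^-zero n le)) (zeroʳ _))) -0#≈0#)) (zeroˡ _)

    Γ-value : ∀ k → Γ δ k ≈ s (suc k)
    Γ-value k = begin
      Γ δ k                       ≈⟨ ∑-cong N (λ m → trans (*-congʳ (*-congʳ (s-C k m)))
                                       (solve 4 (λ a x p c → a :* x :* p :* c := a :* (x :* (p :* c))) refl _ _ _ _)) ⟩
      ∑ N (λ m → s (suc k) * f k m) ≈⟨ ∑-*ˡ N _ _ ⟩
      s (suc k) * ∑ N (f k)       ≈⟨ *-congˡ (trans (sym (*-identityˡ _)) (f-sum k)) ⟩
      s (suc k) * 1#              ≈⟨ *-identityʳ _ ⟩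
      s (suc k)                   ∎

  module F1 where
    open Bq
    open Cq

    C : ℕ → ℕ → Carrier
    C k zero    = 1#
    C k (suc m) = C k m * (q * (q ^ k * q ^ m))

    C-suc : ∀ k m → C (suc k) m ≈ C k m * q ^ m
    C-suc k zero    = sym (*-identityˡ 1#)
    C-suc k (suc m) = trans (*-congʳ (C-suc k m))
      (solve 4 (λ c x y q → c :* x :* (q :* (q :* y :* x)) :=
                            c :* (q :* (y :* x)) :* (q :* x)) refl (C k m) (q ^ m) (q ^ k) q)

    q^T : ℕ → Carrier
    q^T k = q ^ T k

    q^T-suc : ∀ k → q^T (suc k) ≈ q * q ^ k * q^T k
    q^T-suc k = ^-homo-* q (suc k) (T k)

    q^T-C : ∀ k m → q^T (k ℕ.+ m) ≈ q^T k * C k m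
    q^T-C k zero    = trans (reflexive (≡.cong q^T (ℕ.+-identityʳ k))) (sym (*-identityʳ _))
    q^T-C k (suc m) = trans (reflexive (≡.cong q^T (ℕ.+-suc k m)))
      (trans (q^T-suc (k ℕ.+ m)) (trans (*-cong (*-congˡ (^-homo-* q k m)) (q^T-C k m))
        (solve 3 (λ s c w → w :* (s :* c) := s :* (c :* w)) refl (q^T k) (C k m) _)))

    C-zero : ∀ k m → N ℕ.≤ k → C k (suc m) ≈ 0#
    C-zero k m le = trans (*-congˡ (*-congˡ (*-congʳ (nilp-≥ k le q-nilp))))
      (solve 3 (λ c q x → c :* (q :* (con (+ 0) :* x)) := con (+ 0)) refl (C k m) q (q ^ m))

    C-zero′ : ∀ k m → N ℕ.≤ m → C k m ≈ 0#
    C-zero′ k zero    le = nilp-≥ 0 le q-nilp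
    C-zero′ k (suc m) le = trans (solve 4 (λ c q x y → c :* (q :* (y :* x)) := c :* (y :* (q :* x))) refl (C k m) q (q ^ m) (q ^ k))
      (trans (*-congˡ (*-congˡ (nilp-≥ (suc m) le q-nilp)))
        (solve 2 (λ c x → c :* (x :* con (+ 0)) := con (+ 0)) refl (C k m) (q ^ k)))

    -- With r = k + 1 and n = r + m this is 1/((q)ₙ₋ᵣ (q)ₙ₊ᵣ), the kernel of Bailey pairs relative
    -- to 1. The sum against it has a closed form; the sum against `B` is a combination of two such
    -- sums.
    A : ℕ → ℕ → Carrier
    A k m = I (suc m) * I (3 ℕ.+ (k ℕ.+ k ℕ.+ m))

    p : ℕ → Carrier
    p n = P (- q) q (suc n)

    f : ℕ → ℕ → Carrier
    f k m = C k m * (p (k ℕ.+ m) * A k m)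

    f-recurrence : ∀ k → (1# + q * (q * q ^ k)) * ∑ N (f k) ≈ (1# + q * q ^ k) * ∑ N (f (suc k))
    f-recurrence k = trans
      (sum-recurrence c₀ c₁ {g = cert} (trans (*-congʳ (C-zero′ k N ℕ.≤-refl)) (zeroˡ _)) base step)
      (trans (+-congˡ (trans (*-congˡ (trans (*-congʳ q-nilp) (zeroˡ _))) (zeroʳ _))) (+-identityʳ _))
      where
      y = q ^ k
      c₀ = 1# + q * (q * y)
      c₁ = 1# + q * y
      cert : ℕ → Carrier
      cert m = (1# - q * (q * (q * (y * y)))) * (q ^ m * (C k m * (p (suc (k ℕ.+ m)) *
              (I (suc m) * I (4 ℕ.+ (k ℕ.+ k ℕ.+ m))))))
      base : c₀ * f k 0 ≈ cert 0
      base = solveBy 5 7 (q ∷ y ∷ p (k ℕ.+ 0) ∷ I (4 ℕ.+ (k ℕ.+ k ℕ.+ 0)) ∷ I 1 ∷ [])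
        (λ q y p A i → q ∷ y ∷ p ∷ A ∷ i ∷
           p :* (o :- (:- q) :* (q :* y)) ∷ (o :- q :* (q :* (q :* (y :* y)))) :* A ∷ [])
        (refl ∷ refl ∷ refl ∷ refl ∷ refl ∷
          *-congˡ (1--cong (*-congˡ (*-congˡ (reflexive (≡.cong (q ^_) (ℕ.+-identityʳ k)))))) ∷
          I-step′ (3 ℕ.+ (k ℕ.+ k ℕ.+ 0)) (*-congˡ (*-congˡ (*-congˡ
            (trans (reflexive (≡.cong (q ^_) (ℕ.+-identityʳ (k ℕ.+ k)))) (^-homo-* q k k))))) ∷ [])
        (λ q y p A i p′ A′ →
          (o :+ q :* (q :* y)) :* (o :* (p :* (i :* A′))) := (o :- q :* (q :* (q :* (y :* y)))) :* (o :* (o :* (p′ :* (i :* A)))))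
        refl
      step : ∀ m → c₀ * f k (suc m) + cert m ≈ c₁ * f (suc k) m + cert (suc m)
      step m = solveBy 7 15 (q ∷ x ∷ y ∷ pp ∷ A₅ ∷ D′ ∷ C k m ∷ [])
        (λ q x y p A D C →
          let A₄ = (o :- q :* (q :* (q :* (q :* (y :* (y :* x)))))) :* A in
          q ∷ x ∷ y ∷ C ∷ C :* x ∷ p ∷ p ∷ p :* (o :- (:- q) :* (q :* (q :* (y :* x)))) ∷
          D ∷ (o :- q :* x) :* D ∷ A ∷ A ∷ A ∷ A₄ ∷ A₄ ∷ [])
        (refl ∷ refl ∷ refl ∷ refl ∷ C-suc k m ∷ refl ∷ reflexive (≡.cong p (ℕ.+-suc k m)) ∷
         trans (reflexive (≡.cong (λ j → p (suc j)) (ℕ.+-suc k m)))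
           (*-congˡ (1--cong (*-congˡ (*-congˡ (*-congˡ (^-homo-* q k m)))))) ∷
         refl ∷ I-step (suc m) ∷ refl ∷
         reflexive (≡.cong (λ j → I (4 ℕ.+ j)) (≡.cong (ℕ._+ m) (ℕ.+-suc k k))) ∷
         reflexive (≡.cong (λ j → I (4 ℕ.+ j)) (ℕ.+-suc (k ℕ.+ k) m)) ∷
         A₄-step ∷
         trans (reflexive (≡.cong (λ j → I (3 ℕ.+ j)) (ℕ.+-suc (k ℕ.+ k) m))) A₄-step ∷ [])
        (λ q x y C Cs p pa p′ D d A Ab Ag A₄ A₄a → let C′ = C :* (q :* (y :* x)) in
          (o :+ q :* (q :* y)) :* (C′ :* (pa :* (D :* A₄a))) :+
          (o :- q :* (q :* (q :* (y :* y)))) :* (x :* (C :* (p :* (d :* A₄)))) :=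
          (o :+ q :* y) :* (Cs :* (p :* (d :* Ab))) :+
          (o :- q :* (q :* (q :* (y :* y)))) :* ((q :* x) :* (C′ :* (p′ :* (D :* Ag)))))
        refl
        where
        x = q ^ m
        pp = p (suc (k ℕ.+ m))
        A₅ = I (5 ℕ.+ (k ℕ.+ k ℕ.+ m))
        D′ = I (suc (suc m))
        A₄-step : I (4 ℕ.+ (k ℕ.+ k ℕ.+ m)) ≈ (1# - q * (q * (q * (q * (y * (y * x)))))) * A₅
        A₄-step = I-step′ (4 ℕ.+ (k ℕ.+ k ℕ.+ m)) (*-congˡ (*-congˡ (*-congˡ (*-congˡ (kkm k m)))))

    K : Carrier
    K = P (- q) q N * V q q N

    -- By `f-recurrence` the quotient by 1 + q^(k+1) is constant in k. For k ≥ N only m = 0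
    -- contributes, and this gives `K`.
    f-sum : ∀ k → ∑ N (f k) ≈ (1# + q * q ^ k) * K
    f-sum = downward N _ far-out near
      where
      far-out : ∀ k → N ℕ.≤ k → ∑ N (f k) ≈ (1# + q * q ^ k) * K
      far-out k le = begin
        ∑ N (f k)
          ≈⟨ ∑-first (trans (*-congʳ (C-zero′ k N ℕ.≤-refl)) (zeroˡ _))
               (λ m → trans (*-congʳ (C-zero k m le)) (zeroˡ _)) ⟩
        1# * (p (k ℕ.+ 0) * (1# * I (3 ℕ.+ (k ℕ.+ k ℕ.+ 0))))
          ≈⟨ *-congˡ (*-cong (P-stable q-nilp _ (ℕ.m≤n⇒m≤1+n (ℕ.≤-trans le (ℕ.m≤m+n k 0))))
               (*-congˡ (V-stable q-nilp _ (ℕ.m≤n⇒m≤1+n (ℕ.m≤n⇒m≤1+n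
                 (ℕ.≤-trans le (ℕ.≤-trans (ℕ.m≤m+n k k) (ℕ.m≤m+n (k ℕ.+ k) 0)))))))) ⟩
        1# * (P (- q) q N * (1# * V q q N))
          ≈⟨ solve 3 (λ p v q → o :* (p :* (o :* v)) := (o :+ q :* con (+ 0)) :* (p :* v)) refl _ _ q ⟩
        (1# + q * 0#) * K
          ≈⟨ *-congʳ (+-congˡ (*-congˡ (nilp-≥ k le q-nilp))) ⟨
        (1# + q * q ^ k) * K ∎

      near : ∀ k → ∑ N (f (suc k)) ≈ (1# + q * (q * q ^ k)) * K → ∑ N (f k) ≈ (1# + q * q ^ k) * K
      -- The factor 1 + q^(k+2) on the left of the recurrence is a unit, as q is nilpotent.
      near k e = cancelˡ (trans (*-congʳ (solve 1 (λ x → o :+ x := o :- (:- x)) refl _))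
          (geo-inverse (neg-nilp (nilp-*ˡ (q * q ^ k) q-nilp))))
        (trans (f-recurrence k) (trans (*-congˡ e) (solve 3 (λ a c k → a :* (c :* k) := c :* (a :* k)) refl _ _ _)))

    δ : ℕ → Carrier
    δ n = q^T n * p n

    δ-zero : ∀ n → N ℕ.≤ n → δ n ≈ 0#
    δ-zero n le = trans (*-congʳ (nilp-≥ (T n) (ℕ.≤-trans le (T-≥ n)) q-nilp)) (zeroˡ _)

    ΣA : ∀ k → ∑ N (λ m → δ (k ℕ.+ m) * A k m) ≈ q^T k * ((1# + q * q ^ k) * K)
    ΣA k = begin
      ∑ N (λ m → δ (k ℕ.+ m) * A k m)   ≈⟨ ∑-cong N (λ m → trans (*-congʳ (*-congʳ (q^T-C k m)))
                                            (solve 4 (λ a x p c → a :* x :* p :* c := a :* (x :* (p :* c))) refl _ _ _ _)) ⟩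
      ∑ N (λ m → q^T k * f k m)          ≈⟨ ∑-*ˡ N _ _ ⟩
      q^T k * ∑ N (f k)                  ≈⟨ *-congˡ (f-sum k) ⟩
      q^T k * ((1# + q * q ^ k) * K)     ∎

    -- With z = q^(2k+3) and x = qᵐ, the identity 1 - z = (1 - zx) - z(1 - x) splits `B k m` into
    -- `A k m` and a multiple of `A (suc k) (m - 1)`.
    Γ-value : ∀ k → (1# - q * (q * (q * (q ^ k * q ^ k)))) * Γ δ k ≈
      q^T k * ((1# + q * q ^ k) * K) -
      q * (q * (q * (q ^ k * q ^ k))) * (q^T (suc k) * ((1# + q * (q * q ^ k)) * K))
    Γ-value k = begin
      (1# - z) * Γ δ k
        ≈⟨ ∑-*ˡ N _ _ ⟨
      ∑ N (λ m → (1# - z) * (δ (k ℕ.+ m) * B k m))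
        ≈⟨ ∑-cong N split ⟩
      ∑ N (λ m → δ (k ℕ.+ m) * A k m + - z * A′ m)
        ≈⟨ trans (∑-+ N _ _) (+-congˡ (∑-*ˡ N _ _)) ⟩
      ∑ N (λ m → δ (k ℕ.+ m) * A k m) + - z * ∑ N A′
        ≈⟨ +-cong (ΣA k) (*-congˡ (trans shift (ΣA (suc k)))) ⟩
      q^T k * ((1# + q * q ^ k) * K) + - z * (q^T (suc k) * ((1# + q * (q * q ^ k)) * K))
        ≈⟨ +-congˡ (solve 2 (λ z w → (:- z) :* w := :- (z :* w)) refl z _) ⟩
      q^T k * ((1# + q * q ^ k) * K) - z * (q^T (suc k) * ((1# + q * (q * q ^ k)) * K)) ∎
      where
      y = q ^ k
      z = q * (q * (q * (y * y)))
      A′ : ℕ → Carrier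
      A′ m = δ (k ℕ.+ m) * (I m * I (4 ℕ.+ (k ℕ.+ k ℕ.+ m)))
      split : ∀ m → (1# - z) * (δ (k ℕ.+ m) * B k m) ≈ δ (k ℕ.+ m) * A k m + - z * A′ m
      split m = solveBy 6 7 (q ∷ q ^ m ∷ y ∷ δ (k ℕ.+ m) ∷ I (suc m) ∷ I (4 ℕ.+ (k ℕ.+ k ℕ.+ m)) ∷ [])
        (λ q x y d i j → q ∷ y ∷ d ∷ i ∷ (o :- x) :* i ∷ j ∷ (o :- q :* (q :* (q :* (y :* (y :* x))))) :* j ∷ [])
        (refl ∷ refl ∷ refl ∷ refl ∷ I-step m ∷ refl ∷
         I-step′ (3 ℕ.+ (k ℕ.+ k ℕ.+ m)) (*-congˡ (*-congˡ (*-congˡ (kkm k m)))) ∷ [])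
        (λ q y d i i₀ j j₀ → let z = q :* (q :* (q :* (y :* y))) in
          (o :- z) :* (d :* (i :* j)) := d :* (i :* j₀) :+ (:- z) :* (d :* (i₀ :* j)))
        refl
      shift : ∑ N A′ ≈ ∑ N (λ m → δ (suc k ℕ.+ m) * A (suc k) m)
      shift = begin
        ∑ N A′                               ≈⟨ +-identityʳ _ ⟨
        ∑ N A′ + 0#                          ≈⟨ +-congˡ (trans (*-congʳ (δ-zero _ (ℕ.m≤n+m N k))) (zeroˡ _)) ⟨
        ∑ (suc N) A′                         ≈⟨ ∑-shift N A′ ⟩
        A′ 0 + ∑ N (λ m → A′ (suc m))        ≈⟨ +-cong (solve 2 (λ d i → d :* (con (+ 0) :* i) := con (+ 0)) refl _ _)
                                                  (∑-cong N (λ m → *-cong (reflexive (≡.cong δ (ℕ.+-suc k m)))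
                                                    (*-congˡ (reflexive (≡.cong (λ j → I (4 ℕ.+ j)) (index m)))))) ⟩
        0# + ∑ N (λ m → δ (suc k ℕ.+ m) * A (suc k) m) ≈⟨ +-identityˡ _ ⟩
        ∑ N (λ m → δ (suc k ℕ.+ m) * A (suc k) m) ∎
        where
        index : ∀ m → k ℕ.+ k ℕ.+ suc m ≡ k ℕ.+ suc k ℕ.+ m
        index m = ≡.trans (ℕ.+-suc (k ℕ.+ k) m) (≡.cong (ℕ._+ m) (≡.sym (ℕ.+-suc k k)))

-- The generating functions as Bailey sums

private
  4n+2 : ∀ n → 4 ℕ.* suc n ℕ.+ 2 ≡ suc (suc n ℕ.+ suc n) ℕ.+ suc (suc n ℕ.+ suc n)
  4n+2 = ℕ-solver.solve-∀

module Sums {a ℓ : Level} (R : CommutativeRing a ℓ) (N : ℕ)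
            (q : CommutativeRing.Carrier R) (q-nilp : Nilpotent.Nilp R N q) where
  open CommutativeRing R
  open IntegerCoefficients R
  open FiniteSums R
  open Nilpotent R N
  open Families R N q q-nilp
  open import Algebra.Properties.CommutativeSemiring.Exp commutativeSemiring
  open import Relation.Binary.Reasoning.Setoid setoid

  private
    o : ∀ {n} → Polynomial n
    o = con (+ 1)

  L J L₂ J₂ : Carrier
  L  = P q q N
  J  = V q q N
  L₂ = P Q Q N
  J₂ = V Q Q N

  LJ : L * J ≈ 1#
  LJ = PV q N q-nilp

  L₂J₂ : L₂ * J₂ ≈ 1#
  L₂J₂ = PV Q N Q-nilp

  W W₂ : Carrier
  W  = J * J * J
  W₂ = J₂ * J₂ * J₂

  -- The infinite product `A` common to all summands leaves the sum over n, and after the Bailey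
  -- transform it joins Γ, with which it simplifies.
  ∑-pull : ∀ (A : Carrier) {δ β α Γ : ℕ → Carrier} {t : ℕ → Carrier} →
           (∀ n → t n ≈ A * (δ n * β n)) → ∑ N (λ n → δ n * β n) ≈ ∑ N (λ k → α k * Γ k) →
           ∑ N t ≈ ∑ N (λ k → α k * (A * Γ k))
  ∑-pull A {δ} {β} {α} {Γ} {t} e₁ e₂ = begin
    ∑ N t                            ≈⟨ ∑-cong N e₁ ⟩
    ∑ N (λ n → A * (δ n * β n))      ≈⟨ ∑-*ˡ N A _ ⟩
    A * ∑ N (λ n → δ n * β n)        ≈⟨ *-congˡ e₂ ⟩
    A * ∑ N (λ k → α k * Γ k)        ≈⟨ ∑-*ˡ N A _ ⟨
    ∑ N (λ k → A * (α k * Γ k))      ≈⟨ ∑-cong N (λ k → solve 3 (λ x y z → x :* (y :* z) := y :* (x :* z)) refl _ _ _) ⟩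
    ∑ N (λ k → α k * (A * Γ k))      ∎

  geo-solve : ∀ {x X Y} → Nilp x → (1# - x) * X ≈ Y → X ≈ geo x * Y
  geo-solve {x} {X} {Y} nx e = begin
    X                        ≈⟨ *-identityˡ X ⟨
    1# * X                   ≈⟨ *-congʳ (geo-inverse nx) ⟨
    (1# - x) * geo x * X     ≈⟨ solve 3 (λ a b c → a :* b :* c := b :* (a :* c)) refl _ _ _ ⟩
    geo x * ((1# - x) * X)   ≈⟨ *-congˡ e ⟩
    geo x * Y                ∎

  q^odd : ∀ n → q ^ (2 ℕ.* n ℕ.+ 1) ≈ q * q ^ (n ℕ.+ n)
  q^odd n = reflexive (≡.cong (q ^_) (≡.trans (ℕ.+-comm (2 ℕ.* n) 1) (≡.cong (λ j → suc (n ℕ.+ j)) (ℕ.+-identityʳ n))))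

  q^odd′ : ∀ n → q ^ (2 ℕ.* n ℕ.+ 1) ≈ q * Q ^ n
  q^odd′ n = trans (q^odd n) (*-congˡ (q^double n))

  q^even : ∀ n → q ^ (2 ℕ.* suc n) ≈ Q * Q ^ n
  q^even n = trans (reflexive (≡.cong (λ j → q ^ (suc n ℕ.+ j)) (ℕ.+-identityʳ (suc n)))) (q^double (suc n))

  P-odd : ∀ n → P (q ^ (2 ℕ.* n ℕ.+ 1)) q N ≈ L * V q q (n ℕ.+ n)
  P-odd n = trans (P-cong N (q^odd n) refl) (P-tail′ q-nilp q-nilp (n ℕ.+ n))

  V-suc : ∀ n → V (q ^ suc n) q N ≈ J * P q q n
  V-suc n = V-tail′ q-nilp q-nilp n

  V-even : ∀ n → V (q ^ (2 ℕ.* suc n)) Q N ≈ J₂ * P Q Q n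
  V-even n = trans (V-cong N (q^even n) refl) (V-tail′ Q-nilp Q-nilp n)

  neg-odd : ∀ n → - (q ^ (2 ℕ.* n ℕ.+ 1)) ≈ - q * Q ^ n
  neg-odd n = trans (-‿cong (q^odd′ n)) (solve 2 (λ q z → :- (q :* z) := (:- q) :* z) refl q _)

  neg-odd-q : ∀ n → - (q ^ (2 ℕ.* n ℕ.+ 1)) ≈ - q * q ^ (n ℕ.+ n)
  neg-odd-q n = trans (-‿cong (q^odd n)) (solve 2 (λ q z → :- (q :* z) := (:- q) :* z) refl q _)

  -q-nilp : Nilp (- q)
  -q-nilp = neg-nilp q-nilp

  P-square : ∀ k → P Q Q k ≈ P q q k * P (- q) q k
  P-square k = trans (∏-cong k (λ j → trans (1--cong (*-congˡ (Q^ j)))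
    (solve 2 (λ q x → o :- (q :* q) :* (x :* x) := (o :- q :* x) :* (o :- (:- q) :* x)) refl q (q ^ j)))) (∏-* k _ _)

  L-pairs : P q Q N * L₂ ≈ L
  L-pairs = trans (sym (P-pairs q q N)) (P-stable q-nilp _ (ℕ.m≤m+n N N))

  J-pairs : V q Q N * J₂ ≈ J
  J-pairs = trans (sym (V-pairs q q N)) (V-stable q-nilp _ (ℕ.m≤m+n N N))

  1+ : ∀ x → 1# - - x ≈ 1# + x
  1+ = solve 1 (λ x → o :- (:- x) := o :+ x) refl

  module G2-sum where
    open G2
    open Bq using (α; β; Γ; bailey-sum)

    term : ℕ → Carrier
    term n = q ^ suc n * P (q ^ (2 ℕ.* suc n ℕ.+ 1)) q N * V (q ^ suc n) q N * V (q ^ suc n) q N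
             * V (- (q ^ (2 ℕ.* suc n ℕ.+ 1))) Q N

    v : Carrier
    v = V (- q) Q N

    term-δβ : ∀ n → term n ≈ J * v * (δ n * β n)
    term-δβ n = trans
      (*-cong (*-cong (*-cong (*-congˡ (P-odd (suc n))) (V-suc n)) (V-suc n))
        (trans (V-cong N (neg-odd (suc n)) refl) (V-tail′ -q-nilp Q-nilp (suc n))))
      (trans (solve 8 (λ x l v₂ j p v P J → x :* (l :* v₂) :* (j :* p) :* (j :* p) :* (v :* P) :=
          (l :* j) :* (j :* v :* ((x :* P) :* (p :* p :* v₂)))) refl _ _ _ J _ v _ J)
        (trans (*-congʳ LJ) (*-identityˡ _)))

    value : ∑ N term ≈ ∑ N (λ k → α k * (geo (- (q * (q * (q * (q ^ k * q ^ k))))) * (q ^ suc k * W)))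
    value = trans (∑-pull (J * v) {α = α} {Γ = Γ δ} term-δβ (bailey-sum δ δ-zero)) (∑-cong N (λ k → *-congˡ (step k)))
      where
      step : ∀ k → J * v * Γ δ k ≈ geo (- (q * (q * (q * (q ^ k * q ^ k))))) * (q ^ suc k * W)
      step k = trans (*-congˡ (geo-solve (neg-nilp (nilp-*ˡ _ q-nilp)) (trans (*-congʳ (1+ _)) (Γ-value k))))
        (trans (solve 5 (λ j v g y p → j :* v :* (g :* (y :* (p :* (j :* j)))) := (p :* v) :* (g :* (y :* (j :* j :* j)))) refl J v _ _ _)
          (trans (*-congʳ (PV Q N -q-nilp)) (*-identityˡ _)))

  module L9-sum where
    open L9
    open Bq using (α; β; Γ; bailey-sum)

    term : ℕ → Carrier
    term n = q ^ suc n * P (q ^ (2 ℕ.* suc n ℕ.+ 1)) Q N * V (q ^ suc n) q N * V (q ^ suc n) q N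

    A : Carrier
    A = P q Q N * J * J

    term-δβ : ∀ n → term n ≈ A * (δ n * β n)
    term-δβ n = trans
      (*-cong (*-cong (*-congˡ (trans (P-cong N (q^odd′ (suc n)) refl) (trans (P-tail′ q-nilp Q-nilp (suc n)) (*-congˡ odd-part)))) (V-suc n)) (V-suc n))
      (solve 6 (λ x a p₂ v₂ j p → x :* (a :* (p₂ :* v₂)) :* (j :* p) :* (j :* p) :=
          a :* j :* j :* ((x :* p₂) :* (p :* p :* v₂))) refl _ _ _ _ _ _)
      where
      -- This creates the denominator (q; q)₂ₙ₊₂ of β and leaves (q²; q²)ₙ₊₁ to δ.
      odd-part : V q Q (suc n) ≈ P Q Q (suc n) * V q q (suc n ℕ.+ suc n)
      odd-part = sym (trans (*-congˡ (V-pairs q q (suc n)))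
        (trans (solve 3 (λ p a b → p :* (a :* b) := (p :* b) :* a) refl _ _ _)
          (trans (*-congʳ (PV Q (suc n) Q-nilp)) (*-identityˡ _))))

    Y : ℕ → Carrier
    Y k = A * Γ δ k

    value : ∑ N term ≈ ∑ N (λ k → α k * Y k)
    value = ∑-pull A {α = α} {Γ = Γ δ} term-δβ (bailey-sum δ δ-zero)

    Y-zero : ∀ k → N ℕ.≤ k → Y k ≈ 0#
    Y-zero k le = trans (*-congˡ (Cq.Γ-zero δ-zero k le)) (zeroʳ A)

    -- The two numerators (q; q²) and (q²; q²) combine to (q; q), which cancels one of the four
    -- factors `J` and leaves `W`.
    Y-relation : ∀ k → Y k ≈ q ^ suc k * W + - (q * (q * (q * (q * (q ^ k * q ^ k))))) * Y (suc k)
    Y-relation k = trans (*-congˡ (trans (sym (*-identityˡ _)) (Γ-relation k)))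
      (trans (solve 6 (λ a j g c y l → (a :* j :* j) :* (c :* g :+ y :* (l :* (j :* j))) :=
          (a :* l) :* (y :* (j :* j) :* (j :* j)) :+ c :* ((a :* j :* j) :* g)) refl _ _ _ _ _ _)
        (+-congʳ (trans (*-congʳ L-pairs) (trans (solve 3 (λ l j y → l :* (y :* (j :* j) :* (j :* j)) := (l :* j) :* (y :* (j :* j :* j))) refl L J _)
          (trans (*-congʳ LJ) (*-identityˡ _))))))

  module L7-sum where
    open L7
    open BQ using (α; β; Γ; bailey-sum)

    term : ℕ → Carrier
    term n = q ^ (2 ℕ.* suc n) * P (- (q ^ (2 ℕ.* suc n ℕ.+ 1))) q N * V (q ^ (2 ℕ.* suc n)) Q N * V (q ^ (2 ℕ.* suc n)) Q N

    A : Carrier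
    A = P (- q) q N * J₂ * J₂

    term-δβ : ∀ n → term n ≈ A * (δ n * β n)
    term-δβ n = trans
      (*-cong (*-cong (*-cong (q^even n) (trans (P-cong N (neg-odd-q (suc n)) refl)
          (trans (P-tail′ -q-nilp q-nilp (suc n ℕ.+ suc n)) (*-congˡ even-part)))) (V-even n)) (V-even n))
      (solve 6 (λ x a p₂ v₂ j p → x :* (a :* (p₂ :* v₂)) :* (j :* p) :* (j :* p) :=
          a :* j :* j :* ((x :* p₂) :* (p :* p :* v₂))) refl _ _ _ _ _ _)
      where
      m = suc n ℕ.+ suc n
      even-part : V (- q) q m ≈ P q q m * V Q Q m
      even-part = inverse-unique (PV q m -q-nilp)
        (trans (solve 3 (λ a b c → a :* (b :* c) := (b :* a) :* c) refl _ _ _)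
          (trans (*-congʳ (sym (P-square m))) (PV Q m Q-nilp)))

    Y : ℕ → Carrier
    Y k = A * ((1# - q * (Q * Q ^ k)) * Γ δ k)

    value : ∑ N term ≈ ∑ N (λ k → α k * (geo (q * (Q * Q ^ k)) * Y k))
    value = trans (∑-pull A {α = α} {Γ = Γ δ} term-δβ (bailey-sum δ δ-zero))
      (∑-cong N (λ k → *-congˡ (trans (*-congˡ (geo-solve (nilp-*ˡ _ q-nilp) refl))
        (solve 3 (λ a b c → a :* (b :* c) := b :* (a :* c)) refl _ _ _))))

    Y-zero : ∀ k → N ℕ.≤ k → Y k ≈ 0#
    Y-zero k le = trans (*-congˡ (trans (*-congˡ (CQ.Γ-zero δ-zero k le)) (zeroʳ _))) (zeroʳ A)

    Y-relation : ∀ k → Y k ≈ (Q ^ suc k * (1# + Q * (Q * Q ^ k))) * W₂ +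
                             (q * (Q * (Q * (Q * (Q ^ k * Q ^ k))))) * Y (suc k)
    Y-relation k = trans (*-congˡ (Γ-relation k))
      (trans (solve 7 (λ a j g c d y l → (a :* j :* j) :* (c :* d :* g :+ y :* (l :* (j :* j))) :=
          (l :* a) :* (y :* (j :* j) :* (j :* j)) :+ c :* ((a :* j :* j) :* (d :* g))) refl _ _ _ _ _ _ _)
        (+-congʳ (trans (*-congʳ (sym (P-square N))) (trans (solve 3 (λ l j y → l :* (y :* (j :* j) :* (j :* j)) := (l :* j) :* (y :* (j :* j :* j))) refl L₂ J₂ _)
          (trans (*-congʳ L₂J₂) (*-identityˡ _))))))

  module L12-sum where
    open L12
    open BQ using (α; β; Γ; bailey-sum)

    term : ℕ → Carrier
    term n = q ^ (2 ℕ.* suc n) * P (- (q ^ (2 ℕ.* suc n ℕ.+ 1))) Q N * P (- (q ^ (2 ℕ.* suc n ℕ.+ 3))) Q N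
             * V (q ^ (2 ℕ.* suc n)) Q N * V (q ^ (2 ℕ.* suc n)) Q N

    M A : Carrier
    M = P (- q) Q N
    A = M * M * J₂ * J₂

    term-δβ : ∀ n → term n ≈ A * (δ n * β n)
    term-δβ n = trans
      (*-cong (*-cong (*-cong (*-cong (q^even n) (trans (P-cong N (neg-odd (suc n)) refl) (P-tail′ -q-nilp Q-nilp (suc n))))
          (trans (P-cong N (trans (-‿cong (reflexive (≡.cong (q ^_) exponent))) (neg-odd (suc (suc n)))) refl) (P-tail′ -q-nilp Q-nilp (suc (suc n)))))
          (V-even n)) (V-even n))
      -- The summand lacks (q²; q²)₂ₙ₊₂ with base q². A product equal to 1 is inserted: its
      -- numerator becomes part of δ, its denominator part of β.
      (trans (sym (*-identityˡ _)) (trans (*-congʳ (sym (PV Q (suc n ℕ.+ suc n) Q-nilp)))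
      (solve 8 (λ x a p₂ v₂ j p w w′ → (p₂ :* v₂) :* (x :* (a :* w) :* (a :* w′) :* (j :* p) :* (j :* p)) :=
          a :* a :* j :* j :* ((x :* (p₂ :* (w :* w′))) :* (p :* p :* v₂))) refl _ _ _ _ _ _ _ _)))
      where
      exponent : 2 ℕ.* suc n ℕ.+ 3 ≡ 2 ℕ.* suc (suc n) ℕ.+ 1
      exponent = ≡.trans (≡.sym (ℕ.+-assoc (2 ℕ.* suc n) 2 1)) (≡.cong (ℕ._+ 1)
        (≡.trans (ℕ.+-comm (2 ℕ.* suc n) 2) (≡.sym (ℕ.*-suc 2 (suc n)))))

    Y : ℕ → Carrier
    Y k = A * ((1# - q * (Q * Q ^ k)) * Γ δ k)

    value : ∑ N term ≈ ∑ N (λ k → α k * (geo (q * (Q * Q ^ k)) * Y k))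
    value = trans (∑-pull A {α = α} {Γ = Γ δ} term-δβ (bailey-sum δ δ-zero))
      (∑-cong N (λ k → *-congˡ (trans (*-congˡ (geo-solve (nilp-*ˡ _ q-nilp) refl))
        (solve 3 (λ a b c → a :* (b :* c) := b :* (a :* c)) refl _ _ _))))

    Y-zero : ∀ k → N ℕ.≤ k → Y k ≈ 0#
    Y-zero k le = trans (*-congˡ (trans (*-congˡ (CQ.Γ-zero δ-zero k le)) (zeroʳ _))) (zeroʳ A)

    Y-relation : ∀ k → Y k ≈ Q ^ suc k * W₂ + (q * (Q * Q ^ k)) * Y (suc k)
    Y-relation k = trans (*-congˡ (Γ-relation k))
      (trans (solve 8 (λ a j g c d y l w → (a :* a :* j :* j) :* (c :* d :* g :+ y :* (l :* (w :* w) :* (j :* j))) :=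
          (l :* j) :* (a :* w) :* (a :* w) :* (y :* (j :* j :* j)) :+ c :* ((a :* a :* j :* j) :* (d :* g))) refl M J₂ _ _ _ _ L₂ _)
        (+-congʳ (trans (*-congʳ (trans (*-cong (trans (*-cong L₂J₂ MW) (*-identityˡ 1#)) MW) (*-identityˡ 1#))) (*-identityˡ _))))
      where
      MW : M * V (- q) Q N ≈ 1#
      MW = PV Q N -q-nilp

  module G1-sum where
    open G1
    open BQ using (α; β; Γ; bailey-sum)

    term : ℕ → Carrier
    term n = q ^ suc n * P (q ^ (4 ℕ.* suc n ℕ.+ 2)) Q N * V (q ^ (2 ℕ.* suc n)) Q N * V (q ^ (2 ℕ.* suc n)) Q N
             * V (q ^ (2 ℕ.* suc n ℕ.+ 1)) Q N * V (q ^ (2 ℕ.* suc n ℕ.+ 2)) Q N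

    A : Carrier
    A = V q Q N * J₂ * J₂

    term-δβ : ∀ n → term n ≈ A * (δ n * β n)
    term-δβ n = trans
      (*-cong (*-cong (*-cong (*-cong (*-congˡ (trans (P-cong N q^4n+2 refl) (P-tail′ Q-nilp Q-nilp m))) (V-even n)) (V-even n))
         (trans (V-cong N (q^odd′ (suc n)) refl) (V-tail′ q-nilp Q-nilp (suc n))))
         (trans (V-cong N q^2n+2 refl) (V-tail′ Q-nilp Q-nilp (suc n))))
      (trans (solve 9 (λ x l v₂ j p v pₒ jj pₑ →
          x :* (l :* v₂) :* (j :* p) :* (j :* p) :* (v :* pₒ) :* (j :* pₑ) :=
          (l :* j) :* (v :* j :* j :* ((x :* (pₒ :* pₑ)) :* (p :* p :* v₂)))) refl _ L₂ _ J₂ _ _ _ J₂ _)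
        (trans (*-cong L₂J₂ (*-congˡ (*-congʳ (*-congˡ (sym (P-pairs q q (suc n))))))) (*-identityˡ _)))
      where
      m = suc n ℕ.+ suc n
      q^4n+2 : q ^ (4 ℕ.* suc n ℕ.+ 2) ≈ Q * Q ^ m
      q^4n+2 = trans (reflexive (≡.cong (q ^_) (4n+2 n))) (q^double (suc m))
      q^2n+2 : q ^ (2 ℕ.* suc n ℕ.+ 2) ≈ Q * Q ^ suc n
      q^2n+2 = trans (reflexive (≡.cong (q ^_) (≡.trans (ℕ.+-comm (2 ℕ.* suc n) 2) (≡.sym (ℕ.*-suc 2 (suc n)))))) (q^even (suc n))

    module Gq = Jacobi.Gauss R N Q Q-nilp q refl

    φ : Carrier
    φ = ∑ (suc N) (λ k → Gq.bilateral k * Gq.σ k)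

    -- By Gauss φ is (q; q²)² (q²; q²). Extracting it from 1/((q; q²)(q²; q²)²) leaves the cube
    -- 1/(q; q)³, which can be handled modulo 3.
    A-φ : A ≈ φ * W
    A-φ = sym (trans (*-cong Gq.gauss refl) (trans (*-congˡ (*-cong (*-cong (sym J-pairs) (sym J-pairs)) (sym J-pairs)))
      (trans (solve 4 (λ p l v j → (p :* p :* l) :* (v :* j :* (v :* j) :* (v :* j)) :=
        (p :* v) :* (p :* v) :* (l :* j) :* (v :* j :* j)) refl (P q Q N) L₂ (V q Q N) J₂)
      (trans (*-congʳ (trans (*-cong (trans (*-cong pv pv) (*-identityˡ 1#)) L₂J₂) (*-identityˡ 1#))) (*-identityˡ _)))))
      where pv = PV Q N q-nilp

    value : ∑ N term ≈ ∑ N (λ k → α k * (geo (q * (Q * Q ^ k)) * (q ^ suc k * (φ * W))))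
    value = trans (∑-pull A {α = α} {Γ = Γ δ} term-δβ (bailey-sum δ δ-zero))
      (∑-cong N (λ k → *-congˡ (trans (*-cong A-φ (geo-solve (nilp-*ˡ _ q-nilp) (Γ-value k)))
        (solve 3 (λ a b c → a :* (b :* c) := b :* (c :* a)) refl _ _ _))))

  module G3-sum where
    open G3
    open Bq using (α; β; Γ; bailey-sum; s)

    -- the factor (−1)ⁿ qⁿ⁽ⁿ⁺¹⁾ᐟ² is s n
    term : ℕ → Carrier
    term n = s (suc n) * P (q ^ (2 ℕ.* suc n ℕ.+ 1)) q N * V (q ^ suc n) q N * V (q ^ suc n) q N
             * V (q ^ (suc n ℕ.+ 1)) q N

    term-δβ : ∀ n → term n ≈ J * J * (δ n * β n)
    term-δβ n = trans
      (*-cong (*-cong (*-cong (*-congˡ (P-odd (suc n))) (V-suc n)) (V-suc n))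
        (trans (V-cong N (reflexive (≡.cong (q ^_) (ℕ.+-comm (suc n) 1))) refl) (V-suc (suc n))))
      (trans (solve 6 (λ x l v₂ j p P → x :* (l :* v₂) :* (j :* p) :* (j :* p) :* (j :* P) :=
          (l :* j) :* (j :* j :* ((x :* P) :* (p :* p :* v₂)))) refl _ _ _ J _ _)
        (trans (*-congʳ LJ) (*-identityˡ _)))

    value : ∑ N term ≈ ∑ N (λ k → α k * (J * J * s (suc k)))
    value = trans (∑-pull (J * J) {α = α} {Γ = Γ δ} term-δβ (bailey-sum δ δ-zero))
      (∑-cong N (λ k → *-congˡ (*-congˡ (Γ-value k))))

  module F1-sum where
    open F1
    open Bq using (α; β; Γ; bailey-sum; s; #)

    term : ℕ → Carrier
    term n = q^T n * P (q ^ (2 ℕ.* suc n ℕ.+ 1)) q N * V (q ^ suc n) q N * V (q ^ suc n) q N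
             * V (- (q ^ (suc n ℕ.+ 1))) q N

    v : Carrier
    v = V (- q) q N

    term-δβ : ∀ n → term n ≈ J * v * (δ n * β n)
    term-δβ n = trans
      (*-cong (*-cong (*-cong (*-congˡ (P-odd (suc n))) (V-suc n)) (V-suc n))
        (trans (V-cong N (trans (-‿cong (reflexive (≡.cong (q ^_) (ℕ.+-comm (suc n) 1))))
          (solve 2 (λ q z → :- (q :* z) := (:- q) :* z) refl q _)) refl) (V-tail′ -q-nilp q-nilp (suc n))))
      (trans (solve 8 (λ x l v₂ j p v P J → x :* (l :* v₂) :* (j :* p) :* (j :* p) :* (v :* P) :=
          (l :* j) :* (j :* v :* ((x :* P) :* (p :* p :* v₂)))) refl _ _ _ J _ v _ J)
        (trans (*-congʳ LJ) (*-identityˡ _)))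

    -- No division occurs: the factor 1 - q^(2k+3) of `α k` is the very one by which `Γ-value` is
    -- multiplied.
    value : ∑ N term ≈ ∑ N (λ k → # (T (suc k)) * (s k * (J * J * (q^T k * (1# + q * q ^ k) -
              q * (q * (q * (q ^ k * q ^ k))) * (q^T (suc k) * (1# + q * (q * q ^ k)))))))
    value = trans (∑-pull (J * v) {α = α} {Γ = Γ δ} term-δβ (bailey-sum δ δ-zero)) (∑-cong N step)
      where
      pv : P (- q) q N * v ≈ 1#
      pv = PV q N -q-nilp
      step : ∀ k → α k * (J * v * Γ δ k) ≈ # (T (suc k)) * (s k * (J * J * (q^T k * (1# + q * q ^ k) -
              q * (q * (q * (q ^ k * q ^ k))) * (q^T (suc k) * (1# + q * (q * q ^ k))))))
      step k = trans (solve 6 (λ t s e j v g → (t :* (s :* e)) :* (j :* v :* g) := t :* (s :* (j :* v :* (e :* g)))) refl _ _ _ J v _)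
        (trans (*-congˡ (*-congˡ (*-congˡ (Γ-value k))))
        (trans (*-congˡ (*-congˡ (solve 8 (λ j v p x y z x′ y′ →
            j :* v :* (x :* (y :* (p :* j)) :- z :* (x′ :* (y′ :* (p :* j)))) :=
            (p :* v) :* (j :* j :* (x :* y :- z :* (x′ :* y′)))) refl J v (P (- q) q N) _ _ _ _ _)))
        (*-congˡ (*-congˡ (trans (*-congʳ pv) (*-identityˡ _))))))

-- Power series

sumTo-cong : ∀ n {h k : ℕ → ℤ} → (∀ j → j ℕ.≤ n → h j ≡ k j) → sumTo n h ≡ sumTo n k
sumTo-cong zero    e = e 0 ℕ.z≤n
sumTo-cong (suc n) e = ≡.cong₂ ℤ._+_ (sumTo-cong n (λ j j≤n → e j (ℕ.m≤n⇒m≤1+n j≤n))) (e (suc n) ℕ.≤-refl)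

sumTo-first : ∀ n (h : ℕ → ℤ) → sumTo (suc n) h ≡ h 0 ℤ.+ sumTo n (λ k → h (suc k))
sumTo-first zero    h = ≡.refl
sumTo-first (suc n) h = ≡.trans (≡.cong (ℤ._+ h (suc (suc n))) (sumTo-first n h)) (ℤ.+-assoc (h 0) _ _)

sumTo-+ : ∀ n (h k : ℕ → ℤ) → sumTo n (λ j → h j ℤ.+ k j) ≡ sumTo n h ℤ.+ sumTo n k
sumTo-+ zero    h k = ≡.refl
sumTo-+ (suc n) h k = ≡.trans (≡.cong (ℤ._+ (h (suc n) ℤ.+ k (suc n))) (sumTo-+ n h k)) (swap (sumTo n h) (sumTo n k) (h (suc n)) (k (suc n)))
  where
  swap : ∀ a b c d → (a ℤ.+ b) ℤ.+ (c ℤ.+ d) ≡ (a ℤ.+ c) ℤ.+ (b ℤ.+ d)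
  swap = ℤ-solver.solve-∀

sumTo-*ˡ : ∀ n c (h : ℕ → ℤ) → sumTo n (λ j → c ℤ.* h j) ≡ c ℤ.* sumTo n h
sumTo-*ˡ zero    c h = ≡.refl
sumTo-*ˡ (suc n) c h = ≡.trans (≡.cong (ℤ._+ (c ℤ.* h (suc n))) (sumTo-*ˡ n c h)) (≡.sym (ℤ.*-distribˡ-+ c _ _))

sumTo-0 : ∀ n {h : ℕ → ℤ} → (∀ j → j ℕ.≤ n → h j ≡ + 0) → sumTo n h ≡ + 0
sumTo-0 n e = ≡.trans (sumTo-cong n e) (zeros n)
  where
  zeros : ∀ n → sumTo n (λ _ → + 0) ≡ + 0
  zeros zero    = ≡.refl
  zeros (suc n) = ≡.trans (ℤ.+-identityʳ _) (zeros n)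

sumTo-reverse : ∀ n (h : ℕ → ℤ) → sumTo n (λ k → h (n ℕ.∸ k)) ≡ sumTo n h
sumTo-reverse zero    h = ≡.refl
sumTo-reverse (suc n) h = ≡.trans (sumTo-first n _)
  (≡.trans (≡.cong (ℤ._+_ (h (suc n))) (sumTo-reverse n h)) (ℤ.+-comm (h (suc n)) _))

sumTo-∣ : ∀ {d} n {h : ℕ → ℤ} → (∀ j → j ℕ.≤ n → d ∣ˢ h j) → d ∣ˢ sumTo n h
sumTo-∣ zero    e = e 0 ℕ.z≤n
sumTo-∣ (suc n) e = ∣m∣n⇒∣m+n (sumTo-∣ n (λ j j≤n → e j (ℕ.m≤n⇒m≤1+n j≤n))) (e (suc n) ℕ.≤-refl)

tail : PS → PS
tail f n = f (suc n)

⊛-suc : ∀ f g n → (f ⊛ g) (suc n) ≡ f 0 ℤ.* g (suc n) ℤ.+ (tail f ⊛ g) n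
⊛-suc f g n = sumTo-first n _

⊛-comm : ∀ f g n → (f ⊛ g) n ≡ (g ⊛ f) n
⊛-comm f g n = ≡.trans (≡.sym (sumTo-reverse n (λ k → f k ℤ.* g (n ℕ.∸ k))))
  (sumTo-cong n (λ k k≤n → ≡.trans (≡.cong (λ j → f (n ℕ.∸ k) ℤ.* g j) (ℕ.m∸[m∸n]≡n k≤n)) (ℤ.*-comm _ (g k))))

⊛-distribʳ : ∀ f g h n → ((f ⊕ g) ⊛ h) n ≡ ((f ⊛ h) ⊕ (g ⊛ h)) n
⊛-distribʳ f g h n = ≡.trans (sumTo-cong n (λ k _ → ℤ.*-distribʳ-+ (h (n ℕ.∸ k)) (f k) (g k))) (sumTo-+ n _ _)

⊛-scale : ∀ c f g n → ((λ k → c ℤ.* f k) ⊛ g) n ≡ c ℤ.* (f ⊛ g) n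
⊛-scale c f g n = ≡.trans (sumTo-cong n (λ k _ → ℤ.*-assoc c (f k) _)) (sumTo-*ˡ n c _)

⊛-congˡ : ∀ {f g} h → (∀ n → f n ≡ g n) → ∀ n → (f ⊛ h) n ≡ (g ⊛ h) n
⊛-congˡ h e n = sumTo-cong n (λ k _ → ≡.cong (ℤ._* h (n ℕ.∸ k)) (e k))

-- Induction on the degree, stripping the constant coefficient of the first factor.
⊛-assoc : ∀ f g h n → ((f ⊛ g) ⊛ h) n ≡ (f ⊛ (g ⊛ h)) n
⊛-assoc f g h zero    = ℤ.*-assoc (f 0) (g 0) (h 0)
⊛-assoc f g h (suc n) = begin
  ((f ⊛ g) ⊛ h) (suc n)
    ≡⟨ ⊛-suc (f ⊛ g) h n ⟩
  f 0 ℤ.* g 0 ℤ.* h (suc n) ℤ.+ (tail (f ⊛ g) ⊛ h) n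
    ≡⟨ ≡.cong (ℤ._+_ (f 0 ℤ.* g 0 ℤ.* h (suc n))) (≡.trans (⊛-congˡ h (⊛-suc f g) n)
         (≡.trans (⊛-distribʳ (λ k → f 0 ℤ.* tail g k) (tail f ⊛ g) h n)
           (≡.cong₂ ℤ._+_ (⊛-scale (f 0) (tail g) h n) (⊛-assoc (tail f) g h n)))) ⟩
  f 0 ℤ.* g 0 ℤ.* h (suc n) ℤ.+ (f 0 ℤ.* (tail g ⊛ h) n ℤ.+ (tail f ⊛ (g ⊛ h)) n)
    ≡⟨ regroup (f 0) (g 0) (h (suc n)) _ _ ⟩
  f 0 ℤ.* (g 0 ℤ.* h (suc n) ℤ.+ (tail g ⊛ h) n) ℤ.+ (tail f ⊛ (g ⊛ h)) n
    ≡⟨ ≡.cong (λ x → f 0 ℤ.* x ℤ.+ (tail f ⊛ (g ⊛ h)) n) (⊛-suc g h n) ⟨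
  f 0 ℤ.* (g ⊛ h) (suc n) ℤ.+ (tail f ⊛ (g ⊛ h)) n
    ≡⟨ ⊛-suc f (g ⊛ h) n ⟨
  (f ⊛ (g ⊛ h)) (suc n) ∎
  where
  open ≡-Reasoning
  regroup : ∀ a b c d e → a ℤ.* b ℤ.* c ℤ.+ (a ℤ.* d ℤ.+ e) ≡ a ℤ.* (b ℤ.* c ℤ.+ d) ℤ.+ e
  regroup = ℤ-solver.solve-∀

⊛-identityˡ : ∀ f n → (one ⊛ f) n ≡ f n
⊛-identityˡ f zero    = ℤ.*-identityˡ (f 0)
⊛-identityˡ f (suc n) = ≡.trans (⊛-suc one f n)
  (≡.trans (≡.cong₂ ℤ._+_ (ℤ.*-identityˡ (f (suc n))) (sumTo-0 n (λ k _ → ℤ.*-zeroˡ (f (n ℕ.∸ k))))) (ℤ.+-identityʳ _))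

-- Opaque, because the ring solver would otherwise unfold the coefficient sums.
opaque
  add mul : PS → PS → PS
  add = _⊕_
  mul = _⊛_

  negate : PS → PS
  negate f n = ℤ.- f n

  nil unit : PS
  nil _ = + 0
  unit  = one

opaque
  unfolding add

  add-def : ∀ f g n → add f g n ≡ f n ℤ.+ g n
  add-def f g n = ≡.refl

  mul-def : ∀ f g n → mul f g n ≡ (f ⊛ g) n
  mul-def f g n = ≡.refl

  negate-def : ∀ f n → negate f n ≡ ℤ.- f n
  negate-def f n = ≡.refl

  nil-def : ∀ n → nil n ≡ + 0
  nil-def n = ≡.refl

  unit-def : ∀ n → unit n ≡ one n
  unit-def n = ≡.refl

-- The ring ℤ[[q]] / (d, q^N).
module Truncated (d : ℤ) (N : ℕ) where

  infix 4 _≈_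
  -- As a record the congruence is injective in f and g, so the two series can be inferred from its
  -- type.
  record _≈_ (f g : PS) : Set where
    constructor congruent
    field coefficients : ∀ m → m ℕ.< N → d ∣ˢ f m ℤ.- g m
  open _≈_ public

  ≡⇒≈ : ∀ {f g} → (∀ m → f m ≡ g m) → f ≈ g
  ≡⇒≈ {f} {g} e = congruent (λ m _ → divides (+ 0) (≡.trans (≡.cong (ℤ._- g m) (e m)) (ℤ.+-inverseʳ (g m))))

  ≡⇒≈< : ∀ {f g} → (∀ m → m ℕ.< N → f m ≡ g m) → f ≈ g
  ≡⇒≈< {f} {g} e = congruent (λ m m<N → divides (+ 0) (≡.trans (≡.cong (ℤ._- g m) (e m m<N)) (ℤ.+-inverseʳ (g m))))

  private
    swap : ∀ a b → ℤ.- (a ℤ.- b) ≡ b ℤ.- a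
    swap = ℤ-solver.solve-∀

    join : ∀ a b c → (a ℤ.- b) ℤ.+ (b ℤ.- c) ≡ a ℤ.- c
    join = ℤ-solver.solve-∀

    sum : ∀ a b c e → (a ℤ.- b) ℤ.+ (c ℤ.- e) ≡ (a ℤ.+ c) ℤ.- (b ℤ.+ e)
    sum = ℤ-solver.solve-∀

    neg : ∀ a b → ℤ.- (a ℤ.- b) ≡ (ℤ.- a) ℤ.- (ℤ.- b)
    neg = ℤ-solver.solve-∀

    prod : ∀ a b c e → a ℤ.* (c ℤ.- e) ℤ.+ e ℤ.* (a ℤ.- b) ≡ a ℤ.* c ℤ.- b ℤ.* e
    prod = ℤ-solver.solve-∀

  open import Algebra.Structures _≈_ using (IsCommutativeRing)

  opaque
    unfolding add

    equiv-sym : ∀ {f g} → f ≈ g → g ≈ f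
    equiv-sym {f} {g} e = congruent (λ m m<N → ≡.subst (d ∣ˢ_) (swap (f m) (g m)) (∣m⇒∣-m (coefficients e m m<N)))
    equiv-trans : ∀ {f g h} → f ≈ g → g ≈ h → f ≈ h
    equiv-trans {f} {g} {h} e e′ = congruent (λ m m<N → ≡.subst (d ∣ˢ_) (join (f m) (g m) (h m))
      (∣m∣n⇒∣m+n (coefficients e m m<N) (coefficients e′ m m<N)))
    ⊕-cong : ∀ {f g h k} → f ≈ g → h ≈ k → add f h ≈ add g k
    ⊕-cong {f} {g} {h} {k} e e′ = congruent (λ m m<N → ≡.subst (d ∣ˢ_) (sum (f m) (g m) (h m) (k m))
      (∣m∣n⇒∣m+n (coefficients e m m<N) (coefficients e′ m m<N)))
    neg-cong : ∀ {f g} → f ≈ g → negate f ≈ negate g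
    neg-cong {f} {g} e = congruent (λ m m<N → ≡.subst (d ∣ˢ_) (neg (f m) (g m)) (∣m⇒∣-m (coefficients e m m<N)))
    sumTo-− : ∀ n (h k : ℕ → ℤ) → sumTo n (λ j → h j ℤ.- k j) ≡ sumTo n h ℤ.- sumTo n k
    sumTo-− zero    h k = ≡.refl
    sumTo-− (suc n) h k = ≡.trans (≡.cong (ℤ._+ (h (suc n) ℤ.- k (suc n))) (sumTo-− n h k)) (sum (sumTo n h) (sumTo n k) (h (suc n)) (k (suc n)))
    ⊛-cong : ∀ {f g h k} → f ≈ g → h ≈ k → mul f h ≈ mul g k
    ⊛-cong {f} {g} {h} {k} e e′ = congruent (λ m m<N → ≡.subst (d ∣ˢ_)
      (≡.trans (sumTo-cong m (λ j _ → prod (f j) (g j) (h (m ℕ.∸ j)) (k (m ℕ.∸ j)))) (sumTo-− m _ _))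
      (sumTo-∣ m (λ j j≤m → ∣m∣n⇒∣m+n
        (∣n⇒∣m*n (f j) (coefficients e′ (m ℕ.∸ j) (ℕ.≤-<-trans (ℕ.m∸n≤m m j) m<N)))
        (∣n⇒∣m*n (k (m ℕ.∸ j)) (coefficients e j (ℕ.≤-<-trans j≤m m<N))))))
    isCommutativeRing : IsCommutativeRing add mul negate nil unit
    isCommutativeRing = record
      { isRing = record
        { +-isAbelianGroup = record
          { isGroup = record
            { isMonoid = record
              { isSemigroup = record
                { isMagma = record
                  { isEquivalence = record { refl = ≡⇒≈ (λ _ → ≡.refl) ; sym = equiv-sym ; trans = equiv-trans }
                  ; ∙-cong = ⊕-cong }
                ; assoc = λ f g h → ≡⇒≈ (λ m → ℤ.+-assoc (f m) (g m) (h m)) }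
              ; identity = (λ f → ≡⇒≈ (λ m → ℤ.+-identityˡ (f m))) , (λ f → ≡⇒≈ (λ m → ℤ.+-identityʳ (f m))) }
            ; inverse = (λ f → ≡⇒≈ (λ m → ℤ.+-inverseˡ (f m))) , (λ f → ≡⇒≈ (λ m → ℤ.+-inverseʳ (f m)))
            ; ⁻¹-cong = neg-cong }
          ; comm = λ f g → ≡⇒≈ (λ m → ℤ.+-comm (f m) (g m)) }
        ; *-cong = ⊛-cong
        ; *-assoc = λ f g h → ≡⇒≈ (⊛-assoc f g h)
        ; *-identity = (λ f → ≡⇒≈ (⊛-identityˡ f)) ,
                       (λ f → ≡⇒≈ (λ m → ≡.trans (⊛-comm f one m) (⊛-identityˡ f m)))
        ; distrib = (λ f g h → ≡⇒≈ (λ m → ≡.trans (⊛-comm f (g ⊕ h) m)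
                      (≡.trans (⊛-distribʳ g h f m) (≡.cong₂ ℤ._+_ (⊛-comm g f m) (⊛-comm h f m))))) ,
                    (λ f g h → ≡⇒≈ (⊛-distribʳ g h f)) }
      ; *-comm = λ f g → ≡⇒≈ (⊛-comm f g) }

  ring : CommutativeRing 0ℓ 0ℓ
  ring = record
    { Carrier = PS ; _≈_ = _≈_ ; _+_ = add ; _*_ = mul ; -_ = negate
    ; 0# = nil ; 1# = unit ; isCommutativeRing = isCommutativeRing }

-- The generating functions modulo d and q^N

mono-on : ∀ c e → mono c e e ≡ c
mono-on c e with e ℕ.≟ e
... | yes _  = ≡.refl
... | no e≢e = contradiction ≡.refl e≢e

mono-off : ∀ c {e n} → e ≢ n → mono c e n ≡ + 0
mono-off c {e} {n} e≢n with e ℕ.≟ n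
... | yes e≡n = contradiction e≡n e≢n
... | no _    = ≡.refl

mono-suc : ∀ c e n → mono c (suc e) (suc n) ≡ mono c e n
mono-suc c e n with e ℕ.≟ n
... | yes ≡.refl = mono-on c (suc e)
... | no e≢n     = mono-off c (λ { ≡.refl → e≢n ≡.refl })

record Low (k : ℕ) (f : PS) : Set where
  field vanish : ∀ m → m ℕ.< k → f m ≡ + 0
open Low

low-mono : ∀ c {k e} → k ℕ.≤ e → Low k (mono c e)
low-mono c k≤e .vanish m m<k = mono-off c (ℕ.>⇒≢ (ℕ.<-≤-trans m<k k≤e))

low-⊛ : ∀ {k f} g → Low k f → Low k (f ⊛ g)
low-⊛ g l .vanish m m<k = sumTo-0 m (λ j j≤m → ≡.trans (≡.cong (ℤ._* g (m ℕ.∸ j)) (vanish l j (ℕ.≤-<-trans j≤m m<k))) (ℤ.*-zeroˡ (g (m ℕ.∸ j))))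

-- Congruence to 1 modulo q^(k+1), so that multiplication by F preserves the coefficients up to
-- degree k.
record OneMod (k : ℕ) (F : PS) : Set where
  field
    constant : F 0 ≡ + 1
    higher   : ∀ i → i ℕ.< k → F (suc i) ≡ + 0
open OneMod

one-mod-⊛ : ∀ {k F} f → OneMod k F → ∀ m → m ℕ.≤ k → (f ⊛ F) m ≡ f m
one-mod-⊛ {k} {F} f u zero    _   = ≡.trans (≡.cong (f 0 ℤ.*_) (constant u)) (ℤ.*-identityʳ (f 0))
one-mod-⊛ {k} {F} f u (suc m) m<k = ≡.trans (⊛-comm f F (suc m)) (≡.trans (⊛-suc F f m)
  (≡.trans (≡.cong₂ ℤ._+_ (≡.trans (≡.cong (ℤ._* f (suc m)) (constant u)) (ℤ.*-identityˡ (f (suc m))))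
    (sumTo-0 m (λ j j≤m → ≡.trans (≡.cong (ℤ._* f (m ℕ.∸ j)) (higher u j (ℕ.≤-<-trans j≤m m<k))) (ℤ.*-zeroˡ (f (m ℕ.∸ j))))))
    (ℤ.+-identityʳ _)))

-- The factors from index m + 1 on are 1 up to degree m. The diagonal definition of `infProd`
-- therefore agrees with any longer finite product.
finProd-stable : ∀ {F : ℕ → PS} → (∀ j → OneMod j (F j)) → ∀ m j → finProd (suc m ℕ.+ j) F m ≡ finProd (suc m) F m
finProd-stable {F} u m zero    = ≡.cong (λ k → finProd k F m) (ℕ.+-identityʳ (suc m))
finProd-stable {F} u m (suc j) = ≡.trans (≡.cong (λ k → finProd k F m) (ℕ.+-suc (suc m) j))
  (≡.trans (one-mod-⊛ (finProd (suc m ℕ.+ j) F) (u (suc m ℕ.+ j)) m (ℕ.m≤n⇒m≤1+n (ℕ.m≤m+n m j))) (finProd-stable u m j))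

sumTo-stable : ∀ {h : ℕ → ℤ} m → (∀ k → m ℕ.< k → h k ≡ + 0) → ∀ j → sumTo (m ℕ.+ j) h ≡ sumTo m h
sumTo-stable {h} m e zero    = ≡.cong (λ k → sumTo k h) (ℕ.+-identityʳ m)
sumTo-stable {h} m e (suc j) = ≡.trans (≡.cong (λ k → sumTo k h) (ℕ.+-suc m j))
  (≡.trans (≡.cong₂ ℤ._+_ (sumTo-stable m e j) (e _ (ℕ.s≤s (ℕ.m≤m+n m j)))) (ℤ.+-identityʳ _))

linear-≥ : ∀ a b j → 1 ℕ.≤ a → 1 ℕ.≤ b → suc j ℕ.≤ a ℕ.+ b ℕ.* j
linear-≥ a b j 1≤a 1≤b = ℕ.+-mono-≤ 1≤a (ℕ.≤-trans (ℕ.≤-reflexive (≡.sym (ℕ.*-identityˡ j))) (ℕ.*-monoˡ-≤ j 1≤b))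

poch-factor : ∀ x e {j} → j ℕ.< e → OneMod j (one ⊖ mono x e)
poch-factor x (suc e) {j} j<e .constant = ≡.refl
poch-factor x (suc e) {j} j<e .higher i i<j =
  ≡.cong (λ z → + 0 ℤ.- z) (mono-off x (ℕ.>⇒≢ (ℕ.≤-<-trans i<j j<e)))

e*0-mono : ∀ c e n → mono c (e ℕ.* 0) n ≡ mono c 0 n
e*0-mono c e n = ≡.cong (λ k → mono c k n) (ℕ.*-zeroʳ e)

geom-factor : ∀ x e {j} → j ℕ.< e → OneMod j (geom x e)
geom-factor x e {j} j<e .constant = e*0-mono (+ 1) e 0
geom-factor x e {j} j<e .higher i i<j = sumTo-0 (suc i) λ where
  zero    _ → e*0-mono (+ 1) e (suc i)
  (suc k) _ → mono-off (x ℤ.^ suc k) (ℕ.>⇒≢ (ℕ.≤-<-trans i<j (ℕ.<-≤-trans j<e (ℕ.m≤m*n e (suc k)))))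

triangular : ∀ n → n ℕ.* (n ℕ.+ 1) ℕ./ 2 ≡ T n
triangular n = ≡.trans (≡.cong (ℕ._/ 2) (twice n)) (ℕ.m*n/n≡m (T n) 2)
  where
  step : ∀ n → suc n ℕ.* (suc n ℕ.+ 1) ≡ n ℕ.* (n ℕ.+ 1) ℕ.+ suc n ℕ.* 2
  step = ℕ-solver.solve-∀
  twice : ∀ n → n ℕ.* (n ℕ.+ 1) ≡ T n ℕ.* 2
  twice zero    = ≡.refl
  twice (suc n) = ≡.trans (step n) (≡.trans (≡.cong (ℕ._+ suc n ℕ.* 2) (twice n))
    (≡.trans (ℕ.+-comm (T n ℕ.* 2) (suc n ℕ.* 2)) (≡.sym (ℕ.*-distribʳ-+ 2 (suc n) (T n)))))

module Link (d : ℤ) (N : ℕ) where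
  open Truncated d N
  open CommutativeRing ring hiding (_≈_; ring)
  open FiniteSums ring
  open Nilpotent ring N
  open import Algebra.Properties.CommutativeSemiring.Exp commutativeSemiring
  open IntegerCoefficients ring using (solve; _:*_; _:=_; :-_; con)
  open import Relation.Binary.Reasoning.Setoid setoid

  q : PS
  q = mono (+ 1) 1

  κ : ℤ → PS
  κ c = mono c 0

  q-shift : ∀ f n → (q ⊛ f) (suc n) ≡ f n
  q-shift f n = ≡.trans (⊛-suc q f n) (≡.trans (≡.cong₂ ℤ._+_ (ℤ.*-zeroˡ (f (suc n)))
    (≡.trans (⊛-congˡ f (mono-suc (+ 1) 0) n) (⊛-identityˡ f n))) (ℤ.+-identityˡ (f n)))

  ⊛-* : ∀ {f g f′ g′} → f ≈ f′ → g ≈ g′ → f ⊛ g ≈ f′ * g′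
  ⊛-* {f} {g} e e′ = trans (≡⇒≈ (λ m → ≡.sym (mul-def f g m))) (*-cong e e′)

  one≈1 : one ≈ 1#
  one≈1 = ≡⇒≈ (λ m → ≡.sym (unit-def m))

  mono-q : ∀ c e → mono c e ≈ κ c * q ^ e
  mono-q c zero    = sym (*-identityʳ (κ c))
  mono-q c (suc e) = trans (≡⇒≈ shifted) (trans (*-congˡ (mono-q c e))
    (solve 3 (λ q k x → q :* (k :* x) := k :* (q :* x)) refl q (κ c) (q ^ e)))
    where
    shifted : ∀ m → mono c (suc e) m ≡ (q * mono c e) m
    shifted zero    = ≡.sym (≡.trans (mul-def q (mono c e) 0) (ℤ.*-zeroˡ (mono c e 0)))
    shifted (suc m) = ≡.trans (mono-suc c e m) (≡.sym (≡.trans (mul-def q (mono c e) (suc m)) (q-shift (mono c e) m)))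

  q-nilp : Nilp q
  q-nilp = trans (sym (trans (mono-q (+ 1) N) (trans (*-congʳ one≈1) (*-identityˡ _))))
    (≡⇒≈< (λ m m<N → ≡.trans (mono-off (+ 1) (ℕ.>⇒≢ m<N)) (≡.sym (nil-def m))))

  κ-* : ∀ c e → κ (c ℤ.* e) ≈ κ c * κ e
  κ-* c e = trans (≡⇒≈ pointwise) (⊛-* refl refl)
    where
    pointwise : ∀ m → κ (c ℤ.* e) m ≡ (κ c ⊛ κ e) m
    pointwise zero    = ≡.refl
    pointwise (suc m) = ≡.sym (≡.trans (⊛-suc (κ c) (κ e) m)
      (≡.cong₂ ℤ._+_ (ℤ.*-zeroʳ c) (sumTo-0 m (λ j _ → ℤ.*-zeroˡ (κ e (m ℕ.∸ j))))))

  κ-neg : κ -1ℤ ≈ - 1#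
  κ-neg = trans (≡⇒≈ λ { m → ≡.trans (pointwise m) (≡.sym (negate-def one m)) }) (-‿cong one≈1)
    where
    pointwise : ∀ m → κ -1ℤ m ≡ ℤ.- one m
    pointwise zero    = ≡.refl
    pointwise (suc m) = ≡.refl

  mono-1 : ∀ e → mono (+ 1) e ≈ q ^ e
  mono-1 e = trans (mono-q (+ 1) e) (trans (*-congʳ one≈1) (*-identityˡ _))

  -- On the left the number of terms varies with the degree m. Terms of index above m start in
  -- degree above m, so one common length N serves all m < N.
  sumTo-∑ : ∀ {F : ℕ → PS} → (∀ k → Low k (F k)) → (λ m → sumTo m (λ k → F k m)) ≈ ∑ N F
  sumTo-∑ {F} low = ≡⇒≈< agree
    where
    pointwise : ∀ n m → sumTo n (λ k → F k m) ≡ ∑ (suc n) F m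
    pointwise zero    m = ≡.sym (≡.trans (add-def nil (F 0) m) (≡.trans (≡.cong (ℤ._+ F 0 m) (nil-def m)) (ℤ.+-identityˡ (F 0 m))))
    pointwise (suc n) m = ≡.trans (≡.cong (ℤ._+ F (suc n) m) (pointwise n m)) (≡.sym (add-def (∑ (suc n) F) (F (suc n)) m))
    agree : ∀ m → m ℕ.< N → sumTo m (λ k → F k m) ≡ ∑ N F m
    agree m m<N = ≡.trans (≡.sym (sumTo-stable m (λ k m<k → vanish (low k) m m<k) (N ℕ.∸ suc m)))
      (≡.trans (pointwise (m ℕ.+ (N ℕ.∸ suc m)) m) (≡.cong (λ n → ∑ n F m) (ℕ.m+[n∸m]≡n m<N)))

  -- The use of `foldl` reproduces the left-nested products of the definitions, so the generating
  -- functions match by computation. The bound on `e` provides the order of each term that `sumTo-∑`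
  -- needs.
  ∑-of-products : (c : ℕ → ℤ) (e : ℕ → ℕ) (gs : ℕ → List PS) → (∀ n → n ℕ.≤ e (suc n)) →
    {x : ℕ → PS} {hs : ℕ → List PS} →
    (∀ n → mono (c (suc n)) (e (suc n)) ≈ x n) → (∀ n → List.Pointwise _≈_ (gs (suc n)) (hs n)) →
    sumFrom1 (λ n → foldl _⊛_ (mono (c n) (e n)) (gs n)) ≈ ∑ N (λ n → foldl _*_ (x n) (hs n))
  ∑-of-products c e gs n≤e {x} {hs} ex egs =
    trans (sumTo-∑ {λ n → foldl _⊛_ (mono (c (suc n)) (e (suc n))) (gs (suc n))}
             (λ n → low-foldl (gs (suc n)) (low-mono (c (suc n)) (n≤e n))))
          (∑-cong N (λ n → foldl-≈ (ex n) (egs n)))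
    where
    low-foldl : ∀ {k f} gs → Low k f → Low k (foldl _⊛_ f gs)
    low-foldl         []       l = l
    low-foldl {k} {f} (g ∷ gs) l = low-foldl {k} {f ⊛ g} gs (low-⊛ {k} {f} g l)
    foldl-≈ : ∀ {f y gs hs} → f ≈ y → List.Pointwise _≈_ gs hs → foldl _⊛_ f gs ≈ foldl _*_ y hs
    foldl-≈ e []       = e
    foldl-≈ {f} {y} {g ∷ gs} {h ∷ hs} e (p ∷ ps) = foldl-≈ {f ⊛ g} {y * h} (⊛-* {f} {g} e p) ps

  infProd-∏ : ∀ {F : ℕ → PS} {f : ℕ → PS} → (∀ j → OneMod j (F j)) → (∀ j → F j ≈ f j) → infProd F ≈ ∏ N f
  infProd-∏ {F} {f} u e = trans (≡⇒≈< (λ m m<N → ≡.trans (≡.sym (finProd-stable u m (N ℕ.∸ suc m)))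
      (≡.cong (λ n → finProd n F m) (ℕ.m+[n∸m]≡n m<N)))) (finite N)
    where
    finite : ∀ n → finProd n F ≈ ∏ n f
    finite zero    = one≈1
    finite (suc n) = ⊛-* (finite n) (e n)

  mono-linear : ∀ x a b j → mono x (a ℕ.+ b ℕ.* j) ≈ κ x * q ^ a * (q ^ b) ^ j
  mono-linear x a b j = trans (mono-q x _) (trans (*-congˡ (trans (^-homo-* q a (b ℕ.* j)) (*-congˡ (sym (^-assocʳ q b j)))))
    (sym (*-assoc _ _ _)))

  geom-geo : ∀ x {e} → 1 ℕ.≤ e → geom x e ≈ geo (κ x * q ^ e)
  geom-geo x {e} 1≤e = trans (sumTo-∑ (λ k → low-mono (x ℤ.^ k)
      (ℕ.≤-trans (ℕ.≤-reflexive (≡.sym (ℕ.*-identityˡ k))) (ℕ.*-monoˡ-≤ k 1≤e)))) (∑-cong N power)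
    where
    κ-^ : ∀ k → κ (x ℤ.^ k) ≈ κ x ^ k
    κ-^ zero    = one≈1
    κ-^ (suc k) = trans (κ-* x (x ℤ.^ k)) (*-congˡ (κ-^ k))
    power : ∀ k → mono (x ℤ.^ k) (e ℕ.* k) ≈ (κ x * q ^ e) ^ k
    power k = trans (mono-q _ _) (trans (*-cong (κ-^ k) (sym (^-assocʳ q e k))) (sym (^-distrib-* (κ x) (q ^ e) k)))

  poch-P : ∀ x a b → 1 ℕ.≤ a → 1 ℕ.≤ b → poch x a b ≈ P (κ x * q ^ a) (q ^ b) N
  poch-P x a b 1≤a 1≤b = infProd-∏ (λ j → poch-factor x _ (linear-≥ a b j 1≤a 1≤b))
    (λ j → trans (≡⇒≈ (λ m → ≡.sym (≡.trans (add-def one _ m) (≡.cong (λ z → one m ℤ.+ z) (negate-def _ m)))))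
      (+-cong one≈1 (-‿cong (mono-linear x a b j))))

  invPoch-V : ∀ x a b → 1 ℕ.≤ a → 1 ℕ.≤ b → invPoch x a b ≈ V (κ x * q ^ a) (q ^ b) N
  invPoch-V x a b 1≤a 1≤b = infProd-∏ (λ j → geom-factor x _ (linear-≥ a b j 1≤a 1≤b))
    (λ j → trans (geom-geo x (ℕ.≤-trans (ℕ.s≤s ℕ.z≤n) (linear-≥ a b j 1≤a 1≤b)))
      (geo-cong (trans (*-congˡ (trans (^-homo-* q a (b ℕ.* j)) (*-congˡ (sym (^-assocʳ q b j))))) (sym (*-assoc _ _ _)))))

  open Families ring N q q-nilp using (Q)
  open Sums ring N q q-nilp

  q¹ : q ^ 1 ≈ q
  q¹ = *-identityʳ q

  q² : q ^ 2 ≈ Q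
  q² = *-congˡ (*-identityʳ q)

  κ₊ : ∀ x → κ (+ 1) * x ≈ x
  κ₊ x = trans (*-congʳ one≈1) (*-identityˡ x)

  κ₋ : ∀ x → κ -1ℤ * x ≈ - x
  κ₋ x = trans (*-congʳ κ-neg) (solve 1 (λ x → (:- con (+ 1)) :* x := :- x) refl x)

  1≤suc : ∀ {n} → 1 ℕ.≤ suc n
  1≤suc = ℕ.s≤s ℕ.z≤n

  1≤+ : ∀ n {k} → 1 ℕ.≤ k → 1 ℕ.≤ n ℕ.+ k
  1≤+ n le = ℕ.≤-trans le (ℕ.m≤n+m _ n)

  poch₊₁ : ∀ a → 1 ℕ.≤ a → poch (+ 1) a 1 ≈ P (q ^ a) q N
  poch₊₁ a le = trans (poch-P (+ 1) a 1 le 1≤suc) (P-cong N (κ₊ _) q¹)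

  poch₊₂ : ∀ a → 1 ℕ.≤ a → poch (+ 1) a 2 ≈ P (q ^ a) Q N
  poch₊₂ a le = trans (poch-P (+ 1) a 2 le 1≤suc) (P-cong N (κ₊ _) q²)

  poch₋₁ : ∀ a → 1 ℕ.≤ a → poch -1ℤ a 1 ≈ P (- (q ^ a)) q N
  poch₋₁ a le = trans (poch-P -1ℤ a 1 le 1≤suc) (P-cong N (κ₋ _) q¹)

  poch₋₂ : ∀ a → 1 ℕ.≤ a → poch -1ℤ a 2 ≈ P (- (q ^ a)) Q N
  poch₋₂ a le = trans (poch-P -1ℤ a 2 le 1≤suc) (P-cong N (κ₋ _) q²)

  inv₊₁ : ∀ a → 1 ℕ.≤ a → invPoch (+ 1) a 1 ≈ V (q ^ a) q N
  inv₊₁ a le = trans (invPoch-V (+ 1) a 1 le 1≤suc) (V-cong N (κ₊ _) q¹)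

  inv₊₂ : ∀ a → 1 ℕ.≤ a → invPoch (+ 1) a 2 ≈ V (q ^ a) Q N
  inv₊₂ a le = trans (invPoch-V (+ 1) a 2 le 1≤suc) (V-cong N (κ₊ _) q²)

  inv₋₁ : ∀ a → 1 ℕ.≤ a → invPoch -1ℤ a 1 ≈ V (- (q ^ a)) q N
  inv₋₁ a le = trans (invPoch-V -1ℤ a 1 le 1≤suc) (V-cong N (κ₋ _) q¹)

  inv₋₂ : ∀ a → 1 ℕ.≤ a → invPoch -1ℤ a 2 ≈ V (- (q ^ a)) Q N
  inv₋₂ a le = trans (invPoch-V -1ℤ a 2 le 1≤suc) (V-cong N (κ₋ _) q²)

  2*suc : ∀ n → suc n ℕ.≤ 2 ℕ.* suc n
  2*suc n = ℕ.m≤m+n (suc n) _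

  open Bailey ring N q q-nilp using (s)

  sign-s : ∀ n → mono (-1ℤ ℤ.^ n) (n ℕ.* (n ℕ.+ 1) ℕ./ 2) ≈ s n
  sign-s n = trans (reflexive (≡.cong (mono (-1ℤ ℤ.^ n)) (triangular n))) (trans (mono-q (-1ℤ ℤ.^ n) (T n)) (go n))
    where
    go : ∀ n → κ (-1ℤ ℤ.^ n) * q ^ T n ≈ s n
    go zero    = trans (*-congʳ one≈1) (*-identityˡ 1#)
    go (suc n) = trans (*-cong (trans (κ-* -1ℤ (-1ℤ ℤ.^ n)) (κ₋ _)) (^-homo-* q (suc n) (T n)))
      (trans (solve 3 (λ k x t → (:- k) :* (x :* t) := :- ((k :* t) :* x)) refl _ _ _) (-‿cong (*-congʳ (go n))))

  genG1≈ : genG1 ≈ ∑ N G1-sum.term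
  genG1≈ = ∑-of-products (λ _ → + 1) (λ n → n)
    (λ n → poch (+ 1) (4 ℕ.* n ℕ.+ 2) 2 ∷ invPoch (+ 1) (2 ℕ.* n) 2 ∷ invPoch (+ 1) (2 ℕ.* n) 2 ∷
           invPoch (+ 1) (2 ℕ.* n ℕ.+ 1) 2 ∷ invPoch (+ 1) (2 ℕ.* n ℕ.+ 2) 2 ∷ [])
    ℕ.n≤1+n (λ n → mono-1 (suc n))
    (λ n → poch₊₂ (4 ℕ.* suc n ℕ.+ 2) (1≤+ (4 ℕ.* suc n) 1≤suc) ∷ inv₊₂ (2 ℕ.* suc n) 1≤suc ∷ inv₊₂ (2 ℕ.* suc n) 1≤suc ∷
           inv₊₂ (2 ℕ.* suc n ℕ.+ 1) 1≤suc ∷ inv₊₂ (2 ℕ.* suc n ℕ.+ 2) 1≤suc ∷ [])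

  genG2≈ : genG2 ≈ ∑ N G2-sum.term
  genG2≈ = ∑-of-products (λ _ → + 1) (λ n → n)
    (λ n → poch (+ 1) (2 ℕ.* n ℕ.+ 1) 1 ∷ invPoch (+ 1) n 1 ∷ invPoch (+ 1) n 1 ∷ invPoch -1ℤ (2 ℕ.* n ℕ.+ 1) 2 ∷ [])
    ℕ.n≤1+n (λ n → mono-1 (suc n))
    (λ n → poch₊₁ (2 ℕ.* suc n ℕ.+ 1) 1≤suc ∷ inv₊₁ (suc n) 1≤suc ∷ inv₊₁ (suc n) 1≤suc ∷ inv₋₂ (2 ℕ.* suc n ℕ.+ 1) 1≤suc ∷ [])

  genF1≈ : genF1 ≈ ∑ N F1-sum.term
  genF1≈ = ∑-of-products (λ _ → + 1) (λ n → n ℕ.* (n ℕ.∸ 1) ℕ./ 2)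
    (λ n → poch (+ 1) (2 ℕ.* n ℕ.+ 1) 1 ∷ invPoch (+ 1) n 1 ∷ invPoch (+ 1) n 1 ∷ invPoch -1ℤ (n ℕ.+ 1) 1 ∷ [])
    (λ n → ℕ.≤-trans (T-≥ n) (ℕ.≤-reflexive (≡.sym (tri n))))
    (λ n → trans (reflexive (≡.cong (mono (+ 1)) (tri n))) (mono-1 (T n)))
    (λ n → poch₊₁ (2 ℕ.* suc n ℕ.+ 1) 1≤suc ∷ inv₊₁ (suc n) 1≤suc ∷ inv₊₁ (suc n) 1≤suc ∷ inv₋₁ (suc n ℕ.+ 1) 1≤suc ∷ [])
    where
    tri : ∀ n → suc n ℕ.* n ℕ./ 2 ≡ T n
    tri n = ≡.trans (≡.cong (ℕ._/ 2) (≡.trans (ℕ.*-comm (suc n) n) (≡.cong (n ℕ.*_) (ℕ.+-comm 1 n)))) (triangular n)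

  genG3≈ : genG3 ≈ ∑ N G3-sum.term
  genG3≈ = ∑-of-products (λ n → -1ℤ ℤ.^ n) (λ n → n ℕ.* (n ℕ.+ 1) ℕ./ 2)
    (λ n → poch (+ 1) (2 ℕ.* n ℕ.+ 1) 1 ∷ invPoch (+ 1) n 1 ∷ invPoch (+ 1) n 1 ∷ invPoch (+ 1) (n ℕ.+ 1) 1 ∷ [])
    (λ n → ℕ.≤-trans (ℕ.≤-trans (ℕ.n≤1+n n) (T-≥ (suc n))) (ℕ.≤-reflexive (≡.sym (triangular (suc n)))))
    (λ n → sign-s (suc n))
    (λ n → poch₊₁ (2 ℕ.* suc n ℕ.+ 1) 1≤suc ∷ inv₊₁ (suc n) 1≤suc ∷ inv₊₁ (suc n) 1≤suc ∷ inv₊₁ (suc n ℕ.+ 1) 1≤suc ∷ [])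

  genL7≈ : genL7 ≈ ∑ N L7-sum.term
  genL7≈ = ∑-of-products (λ _ → + 1) (λ n → 2 ℕ.* n)
    (λ n → poch -1ℤ (2 ℕ.* n ℕ.+ 1) 1 ∷ invPoch (+ 1) (2 ℕ.* n) 2 ∷ invPoch (+ 1) (2 ℕ.* n) 2 ∷ [])
    (λ n → ℕ.≤-trans (ℕ.n≤1+n n) (2*suc n)) (λ n → mono-1 (2 ℕ.* suc n))
    (λ n → poch₋₁ (2 ℕ.* suc n ℕ.+ 1) 1≤suc ∷ inv₊₂ (2 ℕ.* suc n) 1≤suc ∷ inv₊₂ (2 ℕ.* suc n) 1≤suc ∷ [])

  genL9≈ : genL9 ≈ ∑ N L9-sum.term
  genL9≈ = ∑-of-products (λ _ → + 1) (λ n → n)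
    (λ n → poch (+ 1) (2 ℕ.* n ℕ.+ 1) 2 ∷ invPoch (+ 1) n 1 ∷ invPoch (+ 1) n 1 ∷ [])
    ℕ.n≤1+n (λ n → mono-1 (suc n))
    (λ n → poch₊₂ (2 ℕ.* suc n ℕ.+ 1) 1≤suc ∷ inv₊₁ (suc n) 1≤suc ∷ inv₊₁ (suc n) 1≤suc ∷ [])

  genL12≈ : genL12 ≈ ∑ N L12-sum.term
  genL12≈ = ∑-of-products (λ _ → + 1) (λ n → 2 ℕ.* n)
    (λ n → poch -1ℤ (2 ℕ.* n ℕ.+ 1) 2 ∷ poch -1ℤ (2 ℕ.* n ℕ.+ 3) 2 ∷ invPoch (+ 1) (2 ℕ.* n) 2 ∷ invPoch (+ 1) (2 ℕ.* n) 2 ∷ [])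
    (λ n → ℕ.≤-trans (ℕ.n≤1+n n) (2*suc n)) (λ n → mono-1 (2 ℕ.* suc n))
    (λ n → poch₋₂ (2 ℕ.* suc n ℕ.+ 1) 1≤suc ∷ poch₋₂ (2 ℕ.* suc n ℕ.+ 3) 1≤suc ∷ inv₊₂ (2 ℕ.* suc n) 1≤suc ∷ inv₊₂ (2 ℕ.* suc n) 1≤suc ∷ [])

-- Frobenius, and the theta series in F1

module Frobenius {a ℓ : Level} (R : CommutativeRing a ℓ) (N : ℕ) where
  open CommutativeRing R
  open IntegerCoefficients R
  open Nilpotent R N
  open import Algebra.Properties.CommutativeSemiring.Exp commutativeSemiring
  open import Relation.Binary.Reasoning.Setoid setoid

  1^ : ∀ n → 1# ^ n ≈ 1#
  1^ zero    = refl
  1^ (suc n) = trans (*-identityˡ _) (1^ n)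

  module _ (p : ℕ) (frobenius : ∀ x → (1# - x) ^ p ≈ 1# - x ^ p) where

    P-frobenius : ∀ a b k → P a b k ^ p ≈ P (a ^ p) (b ^ p) k
    P-frobenius a b zero    = 1^ p
    P-frobenius a b (suc k) = begin
      (P a b k * (1# - a * b ^ k)) ^ p             ≈⟨ ^-distrib-* _ _ p ⟩
      P a b k ^ p * (1# - a * b ^ k) ^ p           ≈⟨ *-cong (P-frobenius a b k) (frobenius _) ⟩
      P (a ^ p) (b ^ p) k * (1# - (a * b ^ k) ^ p) ≈⟨ *-congˡ (1--cong (trans (^-distrib-* a (b ^ k) p) (*-congˡ swap))) ⟩
      P (a ^ p) (b ^ p) k * (1# - a ^ p * (b ^ p) ^ k) ∎
      where
      swap : (b ^ k) ^ p ≈ (b ^ p) ^ k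
      swap = trans (^-assocʳ b k p) (trans (reflexive (≡.cong (b ^_) (ℕ.*-comm k p))) (sym (^-assocʳ b p k)))

    V-frobenius : ∀ {a} b k → Nilp a → Nilp (a ^ p) → V a b k ^ p ≈ V (a ^ p) (b ^ p) k
    V-frobenius {a} b k na nap = inverse-unique
      (trans (sym (^-distrib-* (P a b k) (V a b k) p)) (trans (^-congˡ p (PV b k na)) (1^ p)))
      (trans (*-congʳ (P-frobenius a b k)) (PV (b ^ p) k nap))

  frobenius₃ : fromℕ 3 ≈ 0# → ∀ x → (1# - x) ^ 3 ≈ 1# - x ^ 3
  frobenius₃ 3≈0 x = trans
    (solve 1 (λ x → let o = con (+ 1) in (o :- x) :* ((o :- x) :* ((o :- x) :* o)) :=
      (o :- x :* (x :* (x :* o))) :+ con (+ 3) :* (x :* x :- x)) refl x)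
    (trans (+-congˡ (trans (*-congʳ 3≈0) (zeroˡ _))) (+-identityʳ _))

  frobenius₅ : fromℕ 5 ≈ 0# → ∀ x → (1# - x) ^ 5 ≈ 1# - x ^ 5
  frobenius₅ 5≈0 x = trans
    (solve 1 (λ x → let o = con (+ 1) in (o :- x) :* ((o :- x) :* ((o :- x) :* ((o :- x) :* ((o :- x) :* o)))) :=
      (o :- x :* (x :* (x :* (x :* (x :* o))))) :+ con (+ 5) :* (:- x :+ con (+ 2) :* (x :* x) :- con (+ 2) :* (x :* (x :* x)) :+ x :* (x :* (x :* x)))) refl x)
    (trans (+-congˡ (trans (*-congʳ 5≈0) (zeroˡ _))) (+-identityʳ _))

module Signs {a ℓ : Level} (R : CommutativeRing a ℓ) (N : ℕ)
             (q : CommutativeRing.Carrier R) (q-nilp : Nilpotent.Nilp R N q) where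
  open CommutativeRing R
  open IntegerCoefficients R
  open FiniteSums R
  open Nilpotent R N
  open Families R N q q-nilp
  open Sums R N q q-nilp
  open import Algebra.Properties.Ring ring using (-0#≈0#)
  open import Algebra.Properties.CommutativeSemiring.Exp commutativeSemiring
  open import Relation.Binary.Reasoning.Setoid setoid

  sgn : ℕ → Carrier
  sgn zero    = 1#
  sgn (suc k) = - sgn k

  s-sgn : ∀ b (nb : Nilp b) k → Bailey.s R N b nb k ≈ sgn k * b ^ T k
  s-sgn b nb zero    = sym (*-identityˡ 1#)
  s-sgn b nb (suc k) = trans (-‿cong (*-congʳ (s-sgn b nb k)))
    (trans (solve 3 (λ e t x → :- (e :* t :* x) := (:- e) :* (x :* t)) refl _ _ _)
      (*-congˡ (sym (^-homo-* b (suc k) (T k)))))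

  open Jacobi.Gauss R N Q Q-nilp q refl using (σ; bilateral; gauss; σ-zero) public

  square-suc : ∀ k → suc k ℕ.* suc k ≡ suc (k ℕ.+ k) ℕ.+ k ℕ.* k
  square-suc = ℕ-solver.solve-∀

  q^square-suc : ∀ k → q ^ (suc k ℕ.* suc k) ≈ q * Q ^ k * q ^ (k ℕ.* k)
  q^square-suc k = trans (reflexive (≡.cong (q ^_) (square-suc k)))
    (trans (^-homo-* q (suc (k ℕ.+ k)) (k ℕ.* k)) (*-congʳ (*-congˡ (q^double k))))

  σ-sgn : ∀ k → σ k ≈ sgn k * q ^ (k ℕ.* k)
  σ-sgn zero    = sym (*-identityˡ 1#)
  σ-sgn (suc k) = trans (-‿cong (*-congʳ (σ-sgn k)))
    (trans (solve 3 (λ e t x → :- (e :* t :* x) := (:- e) :* (x :* t)) refl _ _ _)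
      (*-congˡ (sym (q^square-suc k))))

  module F1-decomposition where
    open Bailey R N q q-nilp using (s; #; #-+)

    -- In `Ω` the weight of q^(r²), r = k + 1, is 2r² + 2, zero modulo 5 for r² ≡ 4. It arises as
    -- `φ + 2 Z`, and the φ so borrowed becomes an even series when multiplied by 1/(q; q)².
    φ Z Ω X′ : Carrier
    φ  = ∑ (suc N) (λ k → bilateral k * σ k)
    Z  = ∑ N (λ k → # (suc k ℕ.* suc k) * σ (suc k))
    Ω  = 1# + ∑ N (λ k → # (suc k ℕ.* suc k ℕ.+ suc k ℕ.* suc k ℕ.+ 2) * σ (suc k))

    -- the terms of the sum for F1 that do not have square exponents
    rest : ℕ → Carrier
    rest k = q ^ T k - q * (q * (q * (q ^ k * q ^ k))) * (q ^ T (suc k) * (q * (q * q ^ k)))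

    X′ = ∑ N (λ k → # (T (suc k)) * (s k * rest k))

    X : Carrier
    X = ∑ N (λ k → # (T (suc k)) * (s k * (q ^ T k * (1# + q * q ^ k) -
              q * (q * (q * (q ^ k * q ^ k))) * (q ^ T (suc k) * (1# + q * (q * q ^ k))))))

    -- The exponents add up to a square: 2 T(k) + k + 1 = (k + 1)².
    s-T-square : ∀ k → s k * (q ^ T k * (q * q ^ k)) ≈ - σ (suc k)
    s-T-square k = trans (*-congʳ (s-sgn q q-nilp k))
      (trans (solve 4 (λ e t x q → (e :* t) :* (t :* (q :* x)) := :- ((:- e) :* ((q :* x) :* (t :* t)))) refl (sgn k) (q ^ T k) (q ^ k) q)
        (-‿cong (trans (*-congˡ (sym power)) (sym (σ-sgn (suc k))))))
      where
      double-T : ∀ k → T k ℕ.+ T k ≡ k ℕ.* suc k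
      double-T zero    = ≡.refl
      double-T (suc k) = ≡.trans (arith k (T k)) (≡.trans (≡.cong (λ j → suc k ℕ.+ suc k ℕ.+ j) (double-T k)) (arith′ k))
        where
        arith : ∀ k t → (suc k ℕ.+ t) ℕ.+ (suc k ℕ.+ t) ≡ suc k ℕ.+ suc k ℕ.+ (t ℕ.+ t)
        arith = ℕ-solver.solve-∀
        arith′ : ∀ k → suc k ℕ.+ suc k ℕ.+ k ℕ.* suc k ≡ suc k ℕ.* suc (suc k)
        arith′ = ℕ-solver.solve-∀
      power : q ^ (suc k ℕ.* suc k) ≈ (q * q ^ k) * (q ^ T k * q ^ T k)
      power = trans (^-homo-* q (suc k) (k ℕ.* suc k))
        (*-congˡ (trans (reflexive (≡.cong (q ^_) (≡.sym (double-T k)))) (^-homo-* q (T k) (T k))))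

    s-T-square′ : ∀ k → s k * (q * (q * (q * (q ^ k * q ^ k))) * q ^ T (suc k)) ≈ σ (suc (suc k))
    s-T-square′ k = trans (solve 4 (λ s q y t → s :* (q :* (q :* (q :* (y :* y))) :* t) := :- ((:- (s :* (q :* y))) :* (t :* (q :* (q :* y))))) refl (s k) q (q ^ k) (q ^ T (suc k)))
      (trans (-‿cong (s-T-square (suc k))) (solve 1 (λ x → :- (:- x) := x) refl _))

    -- Two consecutive triangular numbers add up to a square, so summation by parts gives r² as the
    -- weight of `σ r`.
    abel-squares : ∀ K → ∑ K (λ k → # (T (suc k)) * (- σ (suc k) - σ (suc (suc k)))) ≈
                   - ∑ K (λ k → # (suc k ℕ.* suc k) * σ (suc k)) - # (T K) * σ (suc K)
    abel-squares zero    = solve 1 (λ x → con (+ 0) := :- con (+ 0) :- con (+ 0) :* x) refl _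
    abel-squares (suc K) = trans (+-congʳ (abel-squares K))
      (solveBy 5 6 (Z′ ∷ # (T K) ∷ # (T (suc K)) ∷ σ (suc K) ∷ σ (suc (suc K)) ∷ [])
        (λ z t t₁ x y → z ∷ t ∷ t₁ ∷ x ∷ y ∷ (t :+ t₁) ∷ [])
        (refl ∷ refl ∷ refl ∷ refl ∷ refl ∷ trans (reflexive (≡.cong # (square K))) (#-+ (T K) (T (suc K))) ∷ [])
        (λ z t t₁ x y r → (:- z :- t :* x) :+ t₁ :* (:- x :- y) := :- (z :+ r :* x) :- t₁ :* y)
        refl)
      where
      Z′ = ∑ K (λ k → # (suc k ℕ.* suc k) * σ (suc k))
      square : ∀ k → suc k ℕ.* suc k ≡ T k ℕ.+ T (suc k)
      square zero    = ≡.refl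
      square (suc k) = ≡.trans (arith k) (≡.trans (≡.cong (ℕ._+ (k ℕ.+ k ℕ.+ 3)) (square k)) (arith′ k (T k)))
        where
        arith : ∀ k → suc (suc k) ℕ.* suc (suc k) ≡ suc k ℕ.* suc k ℕ.+ (k ℕ.+ k ℕ.+ 3)
        arith = ℕ-solver.solve-∀
        arith′ : ∀ k t → (t ℕ.+ (suc k ℕ.+ t)) ℕ.+ (k ℕ.+ k ℕ.+ 3) ≡ (suc k ℕ.+ t) ℕ.+ (suc (suc k) ℕ.+ (suc k ℕ.+ t))
        arith′ = ℕ-solver.solve-∀

    X-split : X ≈ X′ - Z
    X-split = begin
      X
        ≈⟨ ∑-cong N (λ k → trans
             (solve 7 (λ t s e w z e′ w′ → let o = con (+ 1) in
               t :* (s :* (e :* (o :+ w) :- z :* (e′ :* (o :+ w′)))) :=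
               t :* (s :* (e :- z :* (e′ :* w′))) :+ t :* (s :* (e :* w) :- s :* (z :* e′))) refl _ (s k) (q ^ T k) _ _ (q ^ T (suc k)) _)
             (+-congˡ (*-congˡ (+-cong (s-T-square k) (-‿cong (s-T-square′ k)))))) ⟩
      ∑ N (λ k → # (T (suc k)) * (s k * rest k) + # (T (suc k)) * (- σ (suc k) - σ (suc (suc k))))
        ≈⟨ ∑-+ N _ _ ⟩
      X′ + ∑ N (λ k → # (T (suc k)) * (- σ (suc k) - σ (suc (suc k))))
        ≈⟨ +-congˡ (abel-squares N) ⟩
      X′ + (- Z - # (T N) * σ (suc N))
        ≈⟨ +-congˡ (trans (+-congˡ (trans (-‿cong (trans (*-congˡ (σ-zero (suc N) ℕ.≤-refl)) (zeroʳ _))) -0#≈0#)) (+-identityʳ _)) ⟩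
      X′ - Z ∎

    φ+2Z : φ + (Z + Z) ≈ Ω
    φ+2Z = begin
      φ + (Z + Z)
        ≈⟨ +-congʳ (trans (∑-shift N _) (+-congʳ (*-identityˡ 1#))) ⟩
      (1# + ∑ N (λ k → (1# + 1#) * σ (suc k))) + (Z + Z)
        ≈⟨ +-assoc _ _ _ ⟩
      1# + (∑ N (λ k → (1# + 1#) * σ (suc k)) + (Z + Z))
        ≈⟨ +-congˡ (trans (+-congˡ (sym (∑-+ N _ _))) (trans (sym (∑-+ N _ _)) (∑-cong N (λ k →
             trans (solve 2 (λ r x → let o = con (+ 1) in (o :+ o) :* x :+ (r :* x :+ r :* x) := ((r :+ r) :+ (o :+ o)) :* x) refl (# (suc k ℕ.* suc k)) (σ (suc k)))
               (*-congʳ (sym (trans (#-+ (suc k ℕ.* suc k ℕ.+ suc k ℕ.* suc k) 2) (+-congʳ (#-+ (suc k ℕ.* suc k) (suc k ℕ.* suc k)))))))))) ⟩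
      Ω ∎

    J²φ : J * J * φ ≈ J₂
    J²φ = trans (*-cong (*-cong (sym J-pairs) (sym J-pairs)) gauss)
      (trans (solve 4 (λ p l v j → (v :* j) :* (v :* j) :* (p :* p :* l) := (p :* v) :* (p :* v) :* (l :* j) :* j) refl (P q Q N) L₂ (V q Q N) J₂)
        (trans (*-congʳ (trans (*-cong (trans (*-cong pv pv) (*-identityˡ 1#)) L₂J₂) (*-identityˡ 1#))) (*-identityˡ _)))
      where pv = PV Q N q-nilp

    -- Only the even series J₂ contributes in degrees 4 modulo 5.
    doubled-sum : ∑ N F1-sum.term + ∑ N F1-sum.term ≈ J * J * (X′ + X′ - Ω) + J₂
    doubled-sum = begin
      ∑ N F1-sum.term + ∑ N F1-sum.term
        ≈⟨ +-cong single single ⟩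
      J * J * (X′ - Z) + J * J * (X′ - Z)
        ≈⟨ solve 4 (λ j x z f → j :* j :* (x :- z) :+ j :* j :* (x :- z) := j :* j :* (x :+ x :- (f :+ (z :+ z))) :+ j :* j :* f) refl J X′ Z φ ⟩
      J * J * (X′ + X′ - (φ + (Z + Z))) + J * J * φ
        ≈⟨ +-cong (*-congˡ (+-congˡ (-‿cong φ+2Z))) J²φ ⟩
      J * J * (X′ + X′ - Ω) + J₂ ∎
      where
      single : ∑ N F1-sum.term ≈ J * J * (X′ - Z)
      single = trans F1-sum.value (trans (∑-cong N (λ k → solve 4 (λ t s j e → t :* (s :* (j :* j :* e)) := j :* j :* (t :* (s :* e))) refl _ _ J _))
        (trans (∑-*ˡ N (J * J) _) (*-congˡ X-split)))

-- Residues of exponents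

-- The alternative `A` does not mention the index. In the application it locates the residue of the
-- total degree, and any one term can supply it.
sumTo-∣-or : ∀ {d} {A : Set} n {h : ℕ → ℤ} → (∀ j → j ℕ.≤ n → d ∣ˢ h j ⊎ A) → d ∣ˢ sumTo n h ⊎ A
sumTo-∣-or zero    e = e 0 ℕ.z≤n
sumTo-∣-or (suc n) e with sumTo-∣-or n (λ j j≤n → e j (ℕ.m≤n⇒m≤1+n j≤n)) | e (suc n) ℕ.≤-refl
... | inj₁ x | inj₁ y = inj₁ (∣m∣n⇒∣m+n x y)
... | inj₂ a | _      = inj₂ a
... | inj₁ _ | inj₂ a = inj₂ a

module Degrees (d : ℤ) (N M : ℕ) .{{_ : ℕ.NonZero M}} where
  open Truncated d N
  open Link d N using (q; mono-1; κ; one≈1)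
  open CommutativeRing ring hiding (_≈_; ring)
  open IntegerCoefficients ring using (fromℕ)
  open FiniteSums ring
  open Nilpotent ring N
  open import Algebra.Properties.CommutativeSemiring.Exp commutativeSemiring
  open import Algebra.Properties.Semiring.Mult.TCOptimised semiring using (1+×)

  record Deg (rs : List ℕ) (f : PS) : Set where
    field support : ∀ m → m ℕ.< N → d ∣ˢ f m ⊎ m % M ∈ rs
  open Deg public

  sums : List ℕ → List ℕ → List ℕ
  sums = cartesianProductWith (λ r u → (r ℕ.+ u) % M)

  subset? : ∀ (rs xs : List ℕ) → Dec (All (_∈ xs) rs)
  subset? rs xs = all? (_∈? xs) rs

  private
    d∣-cong : ∀ {i j} → i ≡ j → d ∣ˢ i → d ∣ˢ j
    d∣-cong ≡.refl x = x

    0∣ : ∀ {i} → i ≡ + 0 → d ∣ˢ i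
    0∣ ≡.refl = divides (+ 0) ≡.refl

    restore : ∀ i j → (i ℤ.- j) ℤ.+ j ≡ i
    restore i j = ≡.trans (ℤ.+-assoc i (ℤ.- j) j) (≡.trans (≡.cong (λ z → i ℤ.+ z) (ℤ.+-inverseˡ j)) (ℤ.+-identityʳ i))

  deg-≈ : ∀ {rs f g} → f ≈ g → Deg rs g → Deg rs f
  deg-≈ {f = f} {g} e D .support m m<N with support D m m<N
  ... | inj₁ x = inj₁ (d∣-cong (restore (f m) (g m)) (∣m∣n⇒∣m+n (coefficients e m m<N) x))
  ... | inj₂ y = inj₂ y

  -- Residue sets are lists of numerals, so the inclusion `w` evaluates to the unit type and is
  -- found by the type checker.
  deg-weaken : ∀ {rs xs f} {w : True (subset? rs xs)} → Deg rs f → Deg xs f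
  deg-weaken {rs} {xs} {_} {w} D .support m m<N with support D m m<N
  ... | inj₁ x = inj₁ x
  ... | inj₂ y = inj₂ (All.lookup (toWitness w) y)

  deg-widenʳ : ∀ {r xs f} → Deg (r ∷ []) f → Deg (r ∷ xs) f
  deg-widenʳ D .support m m<N with support D m m<N
  ... | inj₁ x        = inj₁ x
  ... | inj₂ (here e) = inj₂ (here e)

  deg-widenˡ : ∀ {r xs f} → Deg xs f → Deg (r ∷ xs) f
  deg-widenˡ D .support m m<N with support D m m<N
  ... | inj₁ x = inj₁ x
  ... | inj₂ y = inj₂ (there y)

  deg-0 : ∀ {rs f} → f ≈ 0# → Deg rs f
  deg-0 {rs} {f} e = deg-≈ e (record { support = λ m _ → inj₁ (0∣ (nil-def m)) })

  deg-+ : ∀ {rs f g} → Deg rs f → Deg rs g → Deg rs (f + g)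
  deg-+ {rs} {f} {g} D E .support m m<N with support D m m<N | support E m m<N
  ... | inj₁ x | inj₁ y = inj₁ (d∣-cong (≡.sym (add-def f g m)) (∣m∣n⇒∣m+n x y))
  ... | inj₂ a | _      = inj₂ a
  ... | inj₁ _ | inj₂ a = inj₂ a

  deg-neg : ∀ {rs f} → Deg rs f → Deg rs (- f)
  deg-neg {rs} {f} D .support m m<N with support D m m<N
  ... | inj₁ x = inj₁ (d∣-cong (≡.sym (negate-def f m)) (∣m⇒∣-m x))
  ... | inj₂ a = inj₂ a

  -- A term of the convolution is divisible by d unless the residues of both j and m - j are listed,
  -- and those add up to the residue of m.
  deg-* : ∀ {rs us f g} → Deg rs f → Deg us g → Deg (sums rs us) (f * g)
  deg-* {rs} {us} {f} {g} D E .support m m<N with sumTo-∣-or m terms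
    where
    terms : ∀ j → j ℕ.≤ m → d ∣ˢ f j ℤ.* g (m ℕ.∸ j) ⊎ m % M ∈ sums rs us
    terms j j≤m with support D j (ℕ.≤-<-trans j≤m m<N) | support E (m ℕ.∸ j) (ℕ.≤-<-trans (ℕ.m∸n≤m m j) m<N)
    ... | inj₁ x | _      = inj₁ (∣m⇒∣m*n (g (m ℕ.∸ j)) x)
    ... | inj₂ _ | inj₁ y = inj₁ (∣n⇒∣m*n (f j) y)
    ... | inj₂ a | inj₂ b = inj₂ (≡.subst (_∈ sums rs us)
        (≡.trans (≡.sym (ℕ.%-distribˡ-+ j (m ℕ.∸ j) M)) (≡.cong (_% M) (ℕ.m+[n∸m]≡n j≤m)))
        (∈-cartesianProductWith⁺ _ a b))
  ... | inj₁ x = inj₁ (d∣-cong (≡.sym (mul-def f g m)) x)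
  ... | inj₂ a = inj₂ a

  deg-pow : ∀ k {r} → k % M ≡ r → Deg (r ∷ []) (q ^ k)
  deg-pow k e = deg-≈ (sym (mono-1 k)) (record { support = go })
    where
    go : ∀ m → m ℕ.< N → d ∣ˢ mono (+ 1) k m ⊎ m % M ∈ _
    go m _ with k ℕ.≟ m
    ... | yes ≡.refl = inj₂ (here e)
    ... | no _       = inj₁ (divides (+ 0) ≡.refl)

  deg-∑ : ∀ {rs} n {f : ℕ → PS} → (∀ k → Deg rs (f k)) → Deg rs (∑ n f)
  deg-∑ zero    D = deg-0 refl
  deg-∑ (suc n) D = deg-+ (deg-∑ n D) (D n)

  coefficient : ∀ {rs f} c {_ : False (c ∈? rs)} → Deg rs f → ∀ m → m ℕ.< N → m % M ≡ c → d ∣ˢ f m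
  coefficient c {¬c} D m m<N e with support D m m<N
  ... | inj₁ x = x
  ... | inj₂ y = contradiction (≡.subst (_∈ _) e y) (toWitnessFalse ¬c)

  deg-κ : ∀ c → Deg (0 % M ∷ []) (κ c)
  deg-κ c .support zero    _ = inj₂ (here ≡.refl)
  deg-κ c .support (suc m) _ = inj₁ (divides (+ 0) ≡.refl)

  #-κ : ∀ n → fromℕ n ≈ κ (+ n)
  #-κ zero    = ≡⇒≈ λ { zero → nil-def 0 ; (suc m) → nil-def (suc m) }
  #-κ (suc n) = trans (1+× n 1#) (trans (+-cong (sym one≈1) (#-κ n)) (≡⇒≈ λ
    { zero → add-def one (κ (+ n)) 0 ; (suc m) → add-def one (κ (+ n)) (suc m) }))

  #-zero : ∀ n → d ∣ˢ + n → fromℕ n ≈ 0#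
  #-zero n d∣n = trans (#-κ n) (congruent λ
    { zero    _ → d∣-cong (≡.sym (≡.trans (≡.cong (λ z → + n ℤ.- z) (nil-def 0)) (ℤ.+-identityʳ (+ n)))) d∣n
    ; (suc m) _ → 0∣ (≡.cong (λ z → + 0 ℤ.- z) (nil-def (suc m))) })

  deg-# : ∀ n → Deg (0 % M ∷ []) (fromℕ n)
  deg-# n = deg-≈ (#-κ n) (deg-κ (+ n))

  deg-1 : Deg (0 % M ∷ []) 1#
  deg-1 = deg-≈ (sym one≈1) (deg-κ (+ 1))

  -- For a variable modulus `0 % M` does not compute. The inclusion is a parameter, filled in where
  -- M is a numeral.
  module _ {z : True (subset? (sums (0 % M ∷ []) (0 % M ∷ [])) (0 % M ∷ []))} where
    deg-00 : ∀ {f g} → Deg (0 % M ∷ []) f → Deg (0 % M ∷ []) g → Deg (0 % M ∷ []) (f * g)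
    deg-00 D E = deg-weaken {w = z} (deg-* D E)

    deg-0^ : ∀ {f} k → Deg (0 % M ∷ []) f → Deg (0 % M ∷ []) (f ^ k)
    deg-0^ zero    D = deg-1
    deg-0^ (suc k) D = deg-00 D (deg-0^ k D)

    deg-geo : ∀ {f} → Deg (0 % M ∷ []) f → Deg (0 % M ∷ []) (geo f)
    deg-geo D = deg-∑ N (λ k → deg-0^ k D)

    deg-V : ∀ {a b} k → Deg (0 % M ∷ []) a → Deg (0 % M ∷ []) b → Deg (0 % M ∷ []) (V a b k)
    deg-V zero    A B = deg-1
    deg-V (suc k) A B = deg-00 (deg-V k A B) (deg-geo (deg-00 A (deg-0^ k B)))

module Residues (M : ℕ) .{{_ : ℕ.NonZero M}} where

  +-residue : ∀ m n {r t} → m % M ≡ r → n % M ≡ t → (m ℕ.+ n) % M ≡ (r ℕ.+ t) % M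
  +-residue m n e f = ≡.trans (ℕ.%-distribˡ-+ m n M) (≡.cong₂ (λ r t → (r ℕ.+ t) % M) e f)

  *-residue : ∀ m n {r t} → m % M ≡ r → n % M ≡ t → (m ℕ.* n) % M ≡ (r ℕ.* t) % M
  *-residue m n e f = ≡.trans (ℕ.%-distribˡ-* m n M) (≡.cong₂ (λ r t → (r ℕ.* t) % M) e f)

  -- For odd M the triangular numbers are periodic modulo M with period M. The hypothesis `shift` is
  -- one period, and the proof removes the k / M periods of k.
  T-residue : (c : ℕ → ℕ) → (∀ k → T (M ℕ.+ k) ≡ T k ℕ.+ c k ℕ.* M) → ∀ k {r} → k % M ≡ r → T k % M ≡ T r % M
  T-residue c shift k ≡.refl = ≡.trans (≡.cong (λ j → T j % M) (ℕ.m≡m%n+[m/n]*n k M)) (go (k / M))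
    where
    go : ∀ j → T (k % M ℕ.+ j ℕ.* M) % M ≡ T (k % M) % M
    go zero    = ≡.cong (λ i → T i % M) (ℕ.+-identityʳ (k % M))
    go (suc j) = ≡.trans (≡.cong (λ i → T i % M) (reorder (k % M) M (j ℕ.* M)))
      (≡.trans (≡.cong (_% M) (shift (k % M ℕ.+ j ℕ.* M)))
        (≡.trans (ℕ.[m+kn]%n≡m%n (T (k % M ℕ.+ j ℕ.* M)) (c (k % M ℕ.+ j ℕ.* M)) M) (go j)))
      where
      reorder : ∀ a b c → a ℕ.+ (b ℕ.+ c) ≡ b ℕ.+ (a ℕ.+ c)
      reorder = ℕ-solver.solve-∀

T-shift₃ : ∀ k → T (3 ℕ.+ k) ≡ T k ℕ.+ (k ℕ.+ 2) ℕ.* 3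
T-shift₃ k = arith k (T k)
  where
  arith : ∀ k t → (3 ℕ.+ k) ℕ.+ ((2 ℕ.+ k) ℕ.+ ((1 ℕ.+ k) ℕ.+ t)) ≡ t ℕ.+ (k ℕ.+ 2) ℕ.* 3
  arith = ℕ-solver.solve-∀

T-shift₅ : ∀ k → T (5 ℕ.+ k) ≡ T k ℕ.+ (k ℕ.+ 3) ℕ.* 5
T-shift₅ k = arith k (T k)
  where
  arith : ∀ k t → (5 ℕ.+ k) ℕ.+ ((4 ℕ.+ k) ℕ.+ ((3 ℕ.+ k) ℕ.+ ((2 ℕ.+ k) ℕ.+ ((1 ℕ.+ k) ℕ.+ t)))) ≡ t ℕ.+ (k ℕ.+ 3) ℕ.* 5
  arith = ℕ-solver.solve-∀

%⇒∣ : ∀ n M .{{_ : ℕ.NonZero M}} → n % M ≡ 0 → + M ∣ˢ + n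
%⇒∣ n M e = ∣ᵤ⇒∣ (ℕ.m%n≡0⇒n∣m n M e)

-- The congruences modulo 3

data Mod₃ (k : ℕ) : Set where
  r0 : k % 3 ≡ 0 → Mod₃ k
  r1 : k % 3 ≡ 1 → Mod₃ k
  r2 : k % 3 ≡ 2 → Mod₃ k

mod₃ : ∀ k → Mod₃ k
mod₃ k = go (k % 3) ≡.refl (ℕ.m%n<n k 3)
  where
  go : ∀ r → k % 3 ≡ r → r ℕ.< 3 → Mod₃ k
  go 0 e _ = r0 e
  go 1 e _ = r1 e
  go 2 e _ = r2 e
  go (suc (suc (suc _))) _ (ℕ.s≤s (ℕ.s≤s (ℕ.s≤s ())))

module Three (N : ℕ) where
  open Truncated (+ 3) N using (ring; _≈_)
  open Link (+ 3) N
  open Degrees (+ 3) N 3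
  open Residues 3
  open CommutativeRing ring hiding (_≈_; ring)
  open IntegerCoefficients ring using (fromℕ)
  open FiniteSums ring using (∑)
  open Nilpotent ring N
  open Families ring N q q-nilp
  open Sums ring N q q-nilp
  open Signs ring N q q-nilp using (sgn; s-sgn; σ-sgn)
  open Frobenius ring N
  open import Algebra.Properties.CommutativeSemiring.Exp commutativeSemiring

  deg-q : Deg (1 ∷ []) q
  deg-q = deg-≈ (sym (*-identityʳ q)) (deg-pow 1 ≡.refl)

  deg-Q : Deg (2 ∷ []) Q
  deg-Q = deg-* deg-q deg-q

  T-res : ∀ k {r} → k % 3 ≡ r → T k % 3 ≡ T r % 3
  T-res = T-residue (λ k → k ℕ.+ 2) T-shift₃

  deg-Q^ : ∀ k {r} → k % 3 ≡ r → Deg ((r ℕ.+ r) % 3 ∷ []) (Q ^ k)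
  deg-Q^ k e = deg-≈ (sym (q^double k)) (deg-pow (k ℕ.+ k) (+-residue k k e e))

  deg-sgn : ∀ k → Deg (0 ∷ []) (sgn k)
  deg-sgn zero    = deg-1
  deg-sgn (suc k) = deg-neg (deg-sgn k)

  suc-res : ∀ k {r} → k % 3 ≡ r → suc k % 3 ≡ suc r % 3
  suc-res k e = +-residue 1 k ≡.refl e

  3≈0 : fromℕ 3 ≈ 0#
  3≈0 = #-zero 3 ∣-refl

  deg-W : Deg (0 ∷ []) W
  deg-W = deg-≈ (trans (trans (*-assoc J J J) (*-congˡ (*-congˡ (sym (*-identityʳ J)))))
      (V-frobenius 3 (frobenius₃ 3≈0) q N q-nilp (nilp-^ 2 q-nilp)))
    (deg-V N (deg-pow 3 ≡.refl) (deg-pow 3 ≡.refl))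

  deg-W₂ : Deg (0 ∷ []) W₂
  deg-W₂ = deg-≈ (trans (trans (*-assoc J₂ J₂ J₂) (*-congˡ (*-congˡ (sym (*-identityʳ J₂)))))
      (V-frobenius 3 (frobenius₃ 3≈0) Q N Q-nilp (nilp-^ 2 Q-nilp)))
    (deg-V N Q³ Q³)
    where
    Q³ : Deg (0 ∷ []) (Q ^ 3)
    Q³ = deg-Q^ 3 ≡.refl

  α-vanishes : ∀ b (nb : Nilp b) k → T (suc k) % 3 ≡ 0 → ∀ x → Bailey.α ring N b nb k * x ≈ 0#
  α-vanishes b nb k e x = trans (*-congʳ (trans (*-congʳ (#-zero (T (suc k)) (%⇒∣ (T (suc k)) 3 e))) (zeroˡ _))) (zeroˡ x)

  deg-q³yy : ∀ k → k % 3 ≡ 0 → Deg (0 ∷ []) (q * (q * (q * (q ^ k * q ^ k))))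
  deg-q³yy k e = deg-* deg-q (deg-* deg-q (deg-* deg-q (deg-* (deg-pow k e) (deg-pow k e))))

  deg-αq : ∀ k → k % 3 ≡ 0 → Deg (0 ∷ []) (Bq.α k)
  deg-αq k e = deg-* (deg-# (T (suc k))) (deg-* (deg-≈ (s-sgn q q-nilp k) (deg-* (deg-sgn k) (deg-pow (T k) (T-res k e))))
    (deg-+ deg-1 (deg-neg (deg-q³yy k e))))

  deg-αQ : ∀ k → k % 3 ≡ 0 → Deg (0 ∷ []) (BQ.α k)
  deg-αQ k e = deg-* (deg-# (T (suc k))) (deg-* (deg-≈ (s-sgn Q Q-nilp k) (deg-* (deg-sgn k) (deg-Q^ (T k) (T-res k e))))
    (deg-+ deg-1 (deg-neg Q³yy)))
    where
    Q³yy : Deg (0 ∷ []) (Q * (Q * (Q * (Q ^ k * Q ^ k))))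
    Q³yy = deg-* deg-Q (deg-* deg-Q (deg-* deg-Q (deg-* (deg-Q^ k e) (deg-Q^ k e))))

  deg-sum : ∀ {rs} b (nb : Nilp b) {x : ℕ → PS} → (∀ k → k % 3 ≡ 0 → Deg rs (Bailey.α ring N b nb k * x k)) →
            Deg rs (∑ N (λ k → Bailey.α ring N b nb k * x k))
  deg-sum {rs} b nb {x} D = deg-∑ N (λ k → case k (mod₃ k))
    where
    case : ∀ k → Mod₃ k → Deg rs (Bailey.α ring N b nb k * x k)
    case k (r0 e) = D k e
    -- In the two remaining cases k + 1 is 2 or 0 modulo 3, and T 2 = 3, T 0 = 0.
    case k (r1 e) = deg-0 (α-vanishes b nb k (T-res (suc k) (suc-res k e)) (x k))
    case k (r2 e) = deg-0 (α-vanishes b nb k (T-res (suc k) (suc-res k e)) (x k))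

  deg-G2 : Deg (1 ∷ []) genG2
  deg-G2 = deg-≈ (trans genG2≈ G2-sum.value) (deg-sum q q-nilp (λ k e →
    deg-* (deg-αq k e) (deg-* (deg-geo (deg-neg (deg-q³yy k e)))
      (deg-* (deg-pow (suc k) (suc-res k e)) deg-W))))

  geo-part : ∀ k → k % 3 ≡ 0 → Deg (0 ∷ []) (geo (q * (Q * Q ^ k)))
  geo-part k e = deg-geo (deg-* deg-q (deg-* deg-Q (deg-Q^ k e)))

  deg-G1 : Deg (1 ∷ 2 ∷ []) genG1
  deg-G1 = deg-≈ (trans genG1≈ G1-sum.value) (deg-sum Q Q-nilp (λ k e →
    deg-* (deg-αQ k e) (deg-* (geo-part k e)
      (deg-* (deg-pow (suc k) (suc-res k e)) (deg-* deg-φ deg-W)))))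
    where
    open G1-sum using (φ; module Gq)
    deg-σ : ∀ k → Deg (0 ∷ 1 ∷ []) (Gq.σ k)
    deg-σ k = deg-≈ (σ-sgn k) (case (mod₃ k))
      where
      case : Mod₃ k → Deg (0 ∷ 1 ∷ []) (sgn k * q ^ (k ℕ.* k))
      case (r0 e) = deg-weaken (deg-* (deg-sgn k) (deg-pow (k ℕ.* k) (*-residue k k e e)))
      case (r1 e) = deg-weaken (deg-* (deg-sgn k) (deg-pow (k ℕ.* k) (*-residue k k e e)))
      case (r2 e) = deg-weaken (deg-* (deg-sgn k) (deg-pow (k ℕ.* k) (*-residue k k e e)))
    deg-bilateral : ∀ k → Deg (0 ∷ []) (Gq.bilateral k)
    deg-bilateral zero    = deg-1
    deg-bilateral (suc k) = deg-+ deg-1 deg-1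
    deg-φ : Deg (0 ∷ 1 ∷ []) φ
    deg-φ = deg-∑ (suc N) (λ k → deg-* (deg-bilateral k) (deg-σ k))

  module _ (set : ℕ → List ℕ) (Y : ℕ → PS) (Y-zero : ∀ k → N ℕ.≤ k → Y k ≈ 0#)
           (step₀ : ∀ k → k % 3 ≡ 0 → Deg (set 1) (Y (suc k)) → Deg (set 0) (Y k))
           (step₁ : ∀ k → k % 3 ≡ 1 → Deg (set 2) (Y (suc k)) → Deg (set 1) (Y k))
           (step₂ : ∀ k → k % 3 ≡ 2 → Deg (set 0) (Y (suc k)) → Deg (set 2) (Y k)) where

    -- The recurrence is followed downwards from k ≥ N, where `Y k` is zero and fits any residue
    -- set; the three steps close up because `set` depends on k modulo 3 only.
    deg-Y : ∀ k → Deg (set (k % 3)) (Y k)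
    deg-Y = downward N (λ k → Deg (set (k % 3)) (Y k)) (λ k le → deg-0 (Y-zero k le)) (λ k → case k (mod₃ k))
      where
      at : ∀ k {r} → k % 3 ≡ r → Deg (set (k % 3)) (Y k) → Deg (set r) (Y k)
      at k ≡.refl D = D
      back : ∀ k {r} → k % 3 ≡ r → Deg (set r) (Y k) → Deg (set (k % 3)) (Y k)
      back k ≡.refl D = D
      case : ∀ k → Mod₃ k → Deg (set (suc k % 3)) (Y (suc k)) → Deg (set (k % 3)) (Y k)
      case k (r0 e) D = back k e (step₀ k e (at (suc k) (suc-res k e) D))
      case k (r1 e) D = back k e (step₁ k e (at (suc k) (suc-res k e) D))
      case k (r2 e) D = back k e (step₂ k e (at (suc k) (suc-res k e) D))

    deg-Y₀ : ∀ k → k % 3 ≡ 0 → Deg (set 0) (Y k)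
    deg-Y₀ k e = ≡.subst (λ r → Deg (set r) (Y k)) e (deg-Y k)

  deg-L9 : Deg (0 ∷ 1 ∷ []) genL9
  deg-L9 = deg-≈ (trans genL9≈ L9-sum.value) (deg-sum q q-nilp (λ k e →
    deg-* (deg-αq k e) (deg-Y₀ set Y Y-zero step₀ step₁ step₂ k e)))
    where
    open L9-sum using (Y; Y-zero; Y-relation)
    -- The sets are stable under the recurrence with q^(k+1) and q^(2k+4): modulo 3 they receive 1
    -- and 1 + {0, 2}, then 2 and 0 + {0, 2}, then 0 and 2 + {0, 1}, for k ≡ 0, 1, 2.
    set : ℕ → List ℕ
    set 0 = 0 ∷ 1 ∷ []
    set _ = 0 ∷ 2 ∷ []
    head : ∀ k {r} → k % 3 ≡ r → Deg _ (q ^ suc k * W)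
    head k e = deg-* (deg-pow (suc k) (suc-res k e)) deg-W
    coeff : ∀ k {r} → k % 3 ≡ r → Deg _ (- (q * (q * (q * (q * (q ^ k * q ^ k))))))
    coeff k e = deg-neg (deg-* deg-q (deg-* deg-q (deg-* deg-q (deg-* deg-q (deg-* (deg-pow k e) (deg-pow k e))))))
    step₀ : ∀ k → k % 3 ≡ 0 → Deg (0 ∷ 2 ∷ []) (Y (suc k)) → Deg (0 ∷ 1 ∷ []) (Y k)
    step₀ k e D = deg-≈ (Y-relation k) (deg-+ (deg-weaken (head k e)) (deg-weaken (deg-* (coeff k e) D)))
    step₁ : ∀ k → k % 3 ≡ 1 → Deg (0 ∷ 2 ∷ []) (Y (suc k)) → Deg (0 ∷ 2 ∷ []) (Y k)
    step₁ k e D = deg-≈ (Y-relation k) (deg-+ (deg-weaken (head k e)) (deg-weaken (deg-* (coeff k e) D)))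
    step₂ : ∀ k → k % 3 ≡ 2 → Deg (0 ∷ 1 ∷ []) (Y (suc k)) → Deg (0 ∷ 2 ∷ []) (Y k)
    step₂ k e D = deg-≈ (Y-relation k) (deg-+ (deg-weaken (head k e)) (deg-weaken (deg-* (coeff k e) D)))

  deg-L7 : Deg (0 ∷ 2 ∷ []) genL7
  deg-L7 = deg-≈ (trans genL7≈ L7-sum.value) (deg-sum Q Q-nilp (λ k e →
    deg-* (deg-αQ k e) (deg-* (geo-part k e) (deg-Y₀ set Y Y-zero step₀ step₁ step₂ k e))))
    where
    open L7-sum using (Y; Y-zero; Y-relation)
    -- The inhomogeneous exponents are 2k + 2 and 4k + 6, and the coefficient has exponent 4k + 7.
    -- For k ≡ 0, 1, 2 this yields {0, 2} with 1 + {1, 2}, {1} with 2 + {0, 2}, and {0, 2} with {0,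
    -- 2}.
    set : ℕ → List ℕ
    set 1 = 1 ∷ 2 ∷ []
    set _ = 0 ∷ 2 ∷ []
    head : ∀ k {r} → k % 3 ≡ r → Deg _ ((Q ^ suc k * (1# + Q * (Q * Q ^ k))) * W₂)
    head k e = deg-* (deg-* (deg-Q^ (suc k) (suc-res k e))
      (deg-+ (deg-widenʳ deg-1) (deg-widenˡ (deg-* deg-Q (deg-* deg-Q (deg-Q^ k e)))))) deg-W₂
    coeff : ∀ k {r} → k % 3 ≡ r → Deg _ (q * (Q * (Q * (Q * (Q ^ k * Q ^ k)))))
    coeff k e = deg-* deg-q (deg-* deg-Q (deg-* deg-Q (deg-* deg-Q (deg-* (deg-Q^ k e) (deg-Q^ k e)))))
    step₀ : ∀ k → k % 3 ≡ 0 → Deg (1 ∷ 2 ∷ []) (Y (suc k)) → Deg (0 ∷ 2 ∷ []) (Y k)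
    step₀ k e D = deg-≈ (Y-relation k) (deg-+ (deg-weaken (head k e)) (deg-weaken (deg-* (coeff k e) D)))
    step₁ : ∀ k → k % 3 ≡ 1 → Deg (0 ∷ 2 ∷ []) (Y (suc k)) → Deg (1 ∷ 2 ∷ []) (Y k)
    step₁ k e D = deg-≈ (Y-relation k) (deg-+ (deg-weaken (head k e)) (deg-weaken (deg-* (coeff k e) D)))
    step₂ : ∀ k → k % 3 ≡ 2 → Deg (0 ∷ 2 ∷ []) (Y (suc k)) → Deg (0 ∷ 2 ∷ []) (Y k)
    step₂ k e D = deg-≈ (Y-relation k) (deg-+ (deg-weaken (head k e)) (deg-weaken (deg-* (coeff k e) D)))

  deg-L12 : Deg (1 ∷ 2 ∷ []) genL12
  deg-L12 = deg-≈ (trans genL12≈ L12-sum.value) (deg-sum Q Q-nilp (λ k e →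
    deg-* (deg-αQ k e) (deg-* (geo-part k e) (deg-Y₀ set Y Y-zero step₀ step₁ step₂ k e))))
    where
    open L12-sum using (Y; Y-zero; Y-relation)
    -- Here the exponents are 2k + 2 and 2k + 3. For k ≡ 0, 1, 2 this yields {2} with {1, 2}, {1}
    -- with 2 + {0, 2}, and {0} with 1 + {1, 2}.
    set : ℕ → List ℕ
    set 2 = 0 ∷ 2 ∷ []
    set _ = 1 ∷ 2 ∷ []
    head : ∀ k {r} → k % 3 ≡ r → Deg _ (Q ^ suc k * W₂)
    head k e = deg-* (deg-Q^ (suc k) (suc-res k e)) deg-W₂
    coeff : ∀ k {r} → k % 3 ≡ r → Deg _ (q * (Q * Q ^ k))
    coeff k e = deg-* deg-q (deg-* deg-Q (deg-Q^ k e))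
    step₀ : ∀ k → k % 3 ≡ 0 → Deg (1 ∷ 2 ∷ []) (Y (suc k)) → Deg (1 ∷ 2 ∷ []) (Y k)
    step₀ k e D = deg-≈ (Y-relation k) (deg-+ (deg-weaken (head k e)) (deg-weaken (deg-* (coeff k e) D)))
    step₁ : ∀ k → k % 3 ≡ 1 → Deg (0 ∷ 2 ∷ []) (Y (suc k)) → Deg (1 ∷ 2 ∷ []) (Y k)
    step₁ k e D = deg-≈ (Y-relation k) (deg-+ (deg-weaken (head k e)) (deg-weaken (deg-* (coeff k e) D)))
    step₂ : ∀ k → k % 3 ≡ 2 → Deg (1 ∷ 2 ∷ []) (Y (suc k)) → Deg (0 ∷ 2 ∷ []) (Y k)
    step₂ k e D = deg-≈ (Y-relation k) (deg-+ (deg-weaken (head k e)) (deg-weaken (deg-* (coeff k e) D)))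

-- The congruences modulo 5

data Mod₅ (k : ℕ) : Set where
  r0 : k % 5 ≡ 0 → Mod₅ k
  r1 : k % 5 ≡ 1 → Mod₅ k
  r2 : k % 5 ≡ 2 → Mod₅ k
  r3 : k % 5 ≡ 3 → Mod₅ k
  r4 : k % 5 ≡ 4 → Mod₅ k

mod₅ : ∀ k → Mod₅ k
mod₅ k = go (k % 5) ≡.refl (ℕ.m%n<n k 5)
  where
  go : ∀ r → k % 5 ≡ r → r ℕ.< 5 → Mod₅ k
  go 0 e _ = r0 e
  go 1 e _ = r1 e
  go 2 e _ = r2 e
  go 3 e _ = r3 e
  go 4 e _ = r4 e
  go (suc (suc (suc (suc (suc _))))) _ (ℕ.s≤s (ℕ.s≤s (ℕ.s≤s (ℕ.s≤s (ℕ.s≤s ())))))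

module Five (N : ℕ) where
  open Truncated (+ 5) N using (ring; _≈_)
  open Link (+ 5) N
  open Degrees (+ 5) N 5
  open Residues 5
  open CommutativeRing ring hiding (_≈_; ring)
  open IntegerCoefficients ring using (fromℕ; solve; _:*_; _:=_)
  open FiniteSums ring using (∑)
  open Nilpotent ring N
  open Families ring N q q-nilp
  open Sums ring N q q-nilp
  open Signs ring N q q-nilp
  open Frobenius ring N
  open Jacobi ring N q q-nilp using (jacobi)
  open Bq using (s; odd)
  open import Algebra.Properties.CommutativeSemiring.Exp commutativeSemiring

  deg-q : Deg (1 ∷ []) q
  deg-q = deg-≈ (sym (*-identityʳ q)) (deg-pow 1 ≡.refl)

  T-res : ∀ k {r} → k % 5 ≡ r → T k % 5 ≡ T r % 5
  T-res = T-residue (λ k → k ℕ.+ 3) T-shift₅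

  suc-res : ∀ k {r} → k % 5 ≡ r → suc k % 5 ≡ suc r % 5
  suc-res k e = +-residue 1 k ≡.refl e

  deg-sgn : ∀ k → Deg (0 ∷ []) (sgn k)
  deg-sgn zero    = deg-1
  deg-sgn (suc k) = deg-neg (deg-sgn k)

  deg-s : ∀ k {r} → k % 5 ≡ r → Deg (sums (0 ∷ []) (T r % 5 ∷ [])) (s k)
  deg-s k e = deg-≈ (s-sgn q q-nilp k) (deg-* (deg-sgn k) (deg-pow (T k) (T-res k e)))

  #-vanishes : ∀ n x → n % 5 ≡ 0 → fromℕ n * x ≈ 0#
  #-vanishes n x e = trans (*-congʳ (#-zero n (%⇒∣ n 5 e))) (zeroˡ x)

  deg-L³ : Deg (0 ∷ 1 ∷ []) (L * L * L)
  deg-L³ = deg-≈ (sym jacobi) (deg-∑ N (λ k → case k (mod₅ k)))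
    where
    case : ∀ k → Mod₅ k → Deg (0 ∷ 1 ∷ []) (odd k * s k)
    case k (r0 e) = deg-weaken (deg-* (deg-# (suc (k ℕ.+ k))) (deg-s k e))
    case k (r1 e) = deg-weaken (deg-* (deg-# (suc (k ℕ.+ k))) (deg-s k e))
    -- The class with T k ≡ 3 (mod 5) drops out, since there 2k + 1 ≡ 0.
    case k (r2 e) = deg-0 (#-vanishes (suc (k ℕ.+ k)) (s k) (+-residue 1 (k ℕ.+ k) ≡.refl (+-residue k k e e)))
    case k (r3 e) = deg-weaken (deg-* (deg-# (suc (k ℕ.+ k))) (deg-s k e))
    case k (r4 e) = deg-weaken (deg-* (deg-# (suc (k ℕ.+ k))) (deg-s k e))

  J² : J * J ≈ L * L * L * V (q ^ 5) (q ^ 5) N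
  J² = sym (trans (*-congˡ (sym (V-frobenius 5 (frobenius₅ (#-zero 5 ∣-refl)) q N q-nilp (nilp-^ 4 q-nilp))))
    (trans (trans (*-congˡ (*-congˡ (*-congˡ (*-congˡ (*-congˡ (*-identityʳ J))))))
       (solve 2 (λ l j → l :* l :* l :* (j :* (j :* (j :* (j :* j)))) := (l :* j) :* (l :* j) :* (l :* j) :* (j :* j)) refl L J))
      (trans (*-congʳ (trans (*-cong (trans (*-cong LJ LJ) (*-identityˡ 1#)) LJ) (*-identityˡ 1#))) (*-identityˡ _))))

  deg-J² : Deg (0 ∷ 1 ∷ []) (J * J)
  deg-J² = deg-≈ J² (deg-* deg-L³ (deg-V N (deg-pow 5 ≡.refl) (deg-pow 5 ≡.refl)))

  deg-z : ∀ k {r} → k % 5 ≡ r → Deg _ (q * (q * (q * (q ^ k * q ^ k))))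
  deg-z k e = deg-* deg-q (deg-* deg-q (deg-* deg-q (deg-* (deg-pow k e) (deg-pow k e))))

  deg-G3 : Deg (0 ∷ 1 ∷ 2 ∷ 4 ∷ []) genG3
  deg-G3 = deg-≈ (trans genG3≈ G3-sum.value) (deg-∑ N (λ k → deg-≈
      (solve 4 (λ t e j x → (t :* e) :* (j :* j :* x) := (j :* j) :* (t :* (e :* x))) refl (fromℕ (T (suc k))) _ J (s (suc k)))
      (deg-weaken (deg-* deg-J² (case k (mod₅ k))))))
    where
    product : ∀ k → PS
    product k = fromℕ (T (suc k)) * (s k * (1# - q * (q * (q * (q ^ k * q ^ k)))) * s (suc k))
    deg-product : ∀ k {r} → k % 5 ≡ r → Deg _ (product k)
    deg-product k e = deg-* (deg-# (T (suc k))) (deg-* (deg-* (deg-s k e)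
      (deg-+ (deg-widenʳ deg-1) (deg-widenˡ (deg-neg (deg-z k e))))) (deg-s (suc k) (suc-res k e)))
    -- The exponents are T(k) + T(k+1) = (k+1)² and (k+1)² + 2k + 3 = (k+2)². A square divisible by
    -- 5 requires k ≡ 4 or k ≡ 3, and then T(k+1) ≡ 0.
    case : ∀ k → Mod₅ k → Deg (1 ∷ 4 ∷ []) (product k)
    case k (r0 e) = deg-weaken (deg-product k e)
    case k (r1 e) = deg-weaken (deg-product k e)
    case k (r2 e) = deg-weaken (deg-product k e)
    case k (r3 e) = deg-0 (#-vanishes (T (suc k)) _ (T-res (suc k) (suc-res k e)))
    case k (r4 e) = deg-0 (#-vanishes (T (suc k)) _ (T-res (suc k) (suc-res k e)))

  open F1-decomposition using (X′; Ω; rest; doubled-sum)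

  deg-X′ : Deg (0 ∷ 1 ∷ 2 ∷ []) X′
  deg-X′ = deg-∑ N (λ k → case k (mod₅ k))
    where
    term : ∀ k → PS
    term k = fromℕ (T (suc k)) * (s k * rest k)
    deg-term : ∀ k {r} → k % 5 ≡ r → Deg _ (term k)
    deg-term k e = deg-* (deg-# (T (suc k))) (deg-* (deg-s k e) (deg-+ (deg-widenʳ (deg-pow (T k) (T-res k e)))
      (deg-widenˡ (deg-neg (deg-* (deg-z k e) (deg-* (deg-pow (T (suc k)) (T-res (suc k) (suc-res k e)))
        (deg-* deg-q (deg-* deg-q (deg-pow k e)))))))))
    -- The exponents are k(k+1) and (k+2)(k+3), and a product of two consecutive integers is 0, 1 or
    -- 2 modulo 5.
    case : ∀ k → Mod₅ k → Deg (0 ∷ 1 ∷ 2 ∷ []) (term k)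
    case k (r0 e) = deg-weaken (deg-term k e)
    case k (r1 e) = deg-weaken (deg-term k e)
    case k (r2 e) = deg-weaken (deg-term k e)
    case k (r3 e) = deg-0 (#-vanishes (T (suc k)) _ (T-res (suc k) (suc-res k e)))
    case k (r4 e) = deg-0 (#-vanishes (T (suc k)) _ (T-res (suc k) (suc-res k e)))

  deg-Ω : Deg (0 ∷ 1 ∷ []) Ω
  deg-Ω = deg-+ (deg-weaken deg-1) (deg-∑ N (λ k → case (suc k) (mod₅ (suc k))))
    where
    c : ℕ → ℕ
    c k = k ℕ.* k ℕ.+ k ℕ.* k ℕ.+ 2
    c-res : ∀ k {r} → k % 5 ≡ r → c k % 5 ≡ _
    c-res k e = +-residue (k ℕ.* k ℕ.+ k ℕ.* k) 2 (+-residue (k ℕ.* k) (k ℕ.* k) (*-residue k k e e) (*-residue k k e e)) ≡.refl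
    deg-σ : ∀ k {r} → k % 5 ≡ r → Deg (sums (0 ∷ []) (sums (0 ∷ []) ((r ℕ.* r) % 5 ∷ []))) (fromℕ (c k) * σ k)
    deg-σ k e = deg-* (deg-# (c k)) (deg-≈ (σ-sgn k) (deg-* (deg-sgn k) (deg-pow (k ℕ.* k) (*-residue k k e e))))
    case : ∀ k → Mod₅ k → Deg (0 ∷ 1 ∷ []) (fromℕ (c k) * σ k)
    case k (r0 e) = deg-weaken (deg-σ k e)
    case k (r1 e) = deg-weaken (deg-σ k e)
    -- For k ≡ 2 or 3 the exponent k² is 4 modulo 5, but the weight 2k² + 2 is zero.
    case k (r2 e) = deg-0 (#-vanishes (c k) (σ k) (c-res k e))
    case k (r3 e) = deg-0 (#-vanishes (c k) (σ k) (c-res k e))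
    case k (r4 e) = deg-weaken (deg-σ k e)

  main-part : PS
  main-part = J * J * (X′ + X′ - Ω)

  deg-main-part : Deg (0 ∷ 1 ∷ 2 ∷ 3 ∷ []) main-part
  deg-main-part = deg-weaken (deg-* deg-J² (deg-+ (deg-+ deg-X′ deg-X′) (deg-neg (deg-weaken deg-Ω))))

  F1-doubled : genF1 + genF1 ≈ main-part + J₂
  F1-doubled = trans (+-cong genF1≈ genF1≈) doubled-sum

  -- A second grading of the same ring, by parity: degrees 10n + 9 are those that are 4 modulo 5 and
  -- odd.
  module Parity = Degrees (+ 5) N 2

  even-J₂ : Parity.Deg (0 ∷ []) J₂
  even-J₂ = Parity.deg-V N Q-even Q-even
    where
    Q-even : Parity.Deg (0 ∷ []) Q
    Q-even = Parity.deg-≈ (*-congˡ (sym (*-identityʳ q))) (Parity.deg-pow 2 ≡.refl)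

-- Extraction of the coefficients in the theorem

open import Data.Nat using (_*_; _+_)
open import Data.Integer.Divisibility using (_∣_)

coeff≥1-∣ : ∀ {d} f m → d ∣ˢ f m → d ∣ coeff≥1 f m
coeff≥1-∣ {d} f ℕ.zero    _ = ∣⇒∣ᵤ {d} {+ 0} (divides (+ 0) ≡.refl)
coeff≥1-∣ {d} f (ℕ.suc m) x = ∣⇒∣ᵤ {d} {f (ℕ.suc m)} x

residue : ∀ M .{{_ : ℕ.NonZero M}} c k m → m ≡ c + k * M → m ℕ.% M ≡ c ℕ.% M
residue M c k m ≡.refl = ℕ.[m+kn]%n≡m%n c k M

-- Truncation at N = m + 1 is the least that retains the coefficient of qᵐ.
module _ (m : ℕ) where
  open Degrees (+ 3) (ℕ.suc m) 3 using (coefficient)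
  open Three (ℕ.suc m)

  G1-zero : m ℕ.% 3 ≡ 0 → + 3 ∣ sptG1 m
  G1-zero e = coeff≥1-∣ genG1 m (coefficient 0 deg-G1 m ℕ.≤-refl e)

  G2-zero : m ℕ.% 3 ≡ 0 → + 3 ∣ sptG2 m
  G2-zero e = coeff≥1-∣ genG2 m (coefficient 0 deg-G2 m ℕ.≤-refl e)

  G2-two : m ℕ.% 3 ≡ 2 → + 3 ∣ sptG2 m
  G2-two e = coeff≥1-∣ genG2 m (coefficient 2 deg-G2 m ℕ.≤-refl e)

  L7-one : m ℕ.% 3 ≡ 1 → + 3 ∣ sptL7 m
  L7-one e = coeff≥1-∣ genL7 m (coefficient 1 deg-L7 m ℕ.≤-refl e)

  L9-two : m ℕ.% 3 ≡ 2 → + 3 ∣ sptL9 m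
  L9-two e = coeff≥1-∣ genL9 m (coefficient 2 deg-L9 m ℕ.≤-refl e)

  L12-zero : m ℕ.% 3 ≡ 0 → + 3 ∣ sptL12 m
  L12-zero e = coeff≥1-∣ genL12 m (coefficient 0 deg-L12 m ℕ.≤-refl e)

module _ (m : ℕ) where
  open Degrees (+ 5) (ℕ.suc m) 5 using (coefficient)
  open Five (ℕ.suc m)
  open Truncated (+ 5) (ℕ.suc m) using (coefficients)

  G3-three : m ℕ.% 5 ≡ 3 → + 5 ∣ sptG3 m
  G3-three e = coeff≥1-∣ genG3 m (coefficient 3 deg-G3 m ℕ.≤-refl e)

  F1-nine : m ℕ.% 5 ≡ 4 → m ℕ.% 2 ≡ 1 → + 5 ∣ sptF1 m
  F1-nine e₅ e₂ = coeff≥1-∣ genF1 m (halve (genF1 m) (≡.subst (+ 5 ∣ˢ_) (add-def genF1 genF1 m)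
    (≡.subst (+ 5 ∣ˢ_) (restore (add genF1 genF1 m) (add main-part J₂ m))
      (∣m∣n⇒∣m+n (coefficients F1-doubled m ℕ.≤-refl)
        (≡.subst (+ 5 ∣ˢ_) (≡.sym (add-def main-part J₂ m))
          (∣m∣n⇒∣m+n (coefficient 4 deg-main-part m ℕ.≤-refl e₅)
            (Parity.coefficient 1 even-J₂ m ℕ.≤-refl e₂)))))))
    where
    open Link (+ 5) (ℕ.suc m) using (q; q-nilp)
    open Sums (Truncated.ring (+ 5) (ℕ.suc m)) (ℕ.suc m) q q-nilp using (J₂)
    restore : ∀ i j → (i ℤ.- j) ℤ.+ j ≡ i
    restore = ℤ-solver.solve-∀
    triple : ∀ i → (i ℤ.+ i) ℤ.* + 3 ℤ.- i ℤ.* + 5 ≡ i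
    triple = ℤ-solver.solve-∀
    -- The doubling is undone by 3, the inverse of 2 modulo 5: 3 · 2i - 5i = i.
    halve : ∀ i → + 5 ∣ˢ i ℤ.+ i → + 5 ∣ˢ i
    halve i x = ≡.subst (+ 5 ∣ˢ_) (triple i)
      (∣m∣n⇒∣m-n (∣m⇒∣m*n (+ 3) x) (∣n⇒∣m*n i ∣-refl))

private
  3n 3n+1 3n+2 : ∀ n → _
  3n   n = residue 3 0 n (3 * n) (ℕ.*-comm 3 n)
  3n+1 n = residue 3 1 n (3 * n + 1) (arith n)
    where
    arith : ∀ n → 3 * n + 1 ≡ 1 + n * 3
    arith = ℕ-solver.solve-∀
  3n+2 n = residue 3 2 n (3 * n + 2) (arith n)
    where
    arith : ∀ n → 3 * n + 2 ≡ 2 + n * 3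
    arith = ℕ-solver.solve-∀

theorem2p1 : (n : ℕ) →
    (+ 3 ∣ sptG1 (3 * n)) × (+ 3 ∣ sptG2 (3 * n)) × (+ 3 ∣ sptG2 (3 * n + 2))
    × (+ 3 ∣ sptL7 (3 * n + 1)) × (+ 3 ∣ sptL9 (3 * n + 2)) × (+ 3 ∣ sptL12 (3 * n))
    × (+ 5 ∣ sptF1 (10 * n + 9)) × (+ 5 ∣ sptG3 (5 * n + 3))
theorem2p1 n =
  G1-zero (3 * n) (3n n) , G2-zero (3 * n) (3n n) , G2-two (3 * n + 2) (3n+2 n) ,
  L7-one (3 * n + 1) (3n+1 n) , L9-two (3 * n + 2) (3n+2 n) , L12-zero (3 * n) (3n n) ,
  F1-nine (10 * n + 9) (residue 5 4 (2 * n + 1) (10 * n + 9) (arith₅ n)) (residue 2 1 (5 * n + 4) (10 * n + 9) (arith₂ n)) ,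
  G3-three (5 * n + 3) (residue 5 3 n (5 * n + 3) (arith n))
  where
  arith₅ : ∀ n → 10 * n + 9 ≡ 4 + (2 * n + 1) * 5
  arith₅ = ℕ-solver.solve-∀
  arith₂ : ∀ n → 10 * n + 9 ≡ 1 + (5 * n + 4) * 2
  arith₂ = ℕ-solver.solve-∀
  arith : ∀ n → 5 * n + 3 ≡ 3 + n * 5
  arith = ℕ-solver.solve-∀
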